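{- Let $d$ and $m$ be integers with $1\le m<d$. For each $n\in\mathbb{Z}_+$, $1\le k\le m$ and $1\le i\le d$, let $b_{n,k,i}\in\mathbb{Z}$, and suppose that $|b_{n,k,i}|$ is bounded by a polynomial in $n$ (that is, there is a polynomial $f$ with $|b_{n,k,i}|\le f(n)$ for all $n,k,i$). For a given $n$, choose integers $s_{ki}$ ($1\le k\le m$, $1\le i\le d$) independently, with $s_{ki}$ uniformly distributed on the set of integers satisfying $b_{n,k,i}\le s_{ki}<b_{n,k,i}+n$. Let $s_k=(s_{k1},\ldots,s_{kd})\in\mathbb{Z}^d$ and let $S=\{s_1,s_2,\ldots,s_m\}$. Then, as $n\to\infty$, the probability that $S$ is a primitive set approaches \[\frac{1}{\zeta(d)\zeta(d-1)\cdots\zeta(d-m+1)},\] where $\zeta(a)=\sum_{i=1}^{\infty}\frac{1}{i^a}$ is the Riemann zeta function.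
   Context: $\mathbb{Z}_+$ denotes the positive integers. A set $S=\{s_1,\ldots,s_m\}\subset\mathbb{Z}^d$, where $1\le m\le d$, is called primitive if $S$ is a $\mathbb{Z}$-basis for the lattice $\operatorname{span}_{\mathbb{R}}(S)\cap\mathbb{Z}^d$. Here $S$ is understood as the list $s_1,\ldots,s_m$, so primitivity requires $s_1,\ldots,s_m$ to be linearly independent and to form a $\mathbb{Z}$-basis of $\operatorname{span}_{\mathbb{R}}(s_1,\ldots,s_m)\cap\mathbb{Z}^d$. -}

module Defs where

open import Level using (Level; 0ℓ; _⊔_)
open import Algebra.Bundles using (CommutativeMonoid; RawRing)
import Algebra.Definitions.RawMonoid as RawMonoidDefinitions
open import Data.Fin.Base as Fin using (Fin; toℕ)
open import Data.Fin.Properties using (toℕ<n)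
open import Data.Integer.Base as ℤ using (ℤ; +_; 1ℤ)
import Data.Integer.Properties as ℤ
open import Data.List.Base as List using (List; []; _∷_)
open import Data.Nat.Base as ℕ using (ℕ; zero; suc)
import Data.Nat.Properties as ℕ
open import Data.Product using (∃-syntax; _×_; _,_; proj₂)
open import Data.Rational.Base as ℚ
  using (ℚ; mkℚ; 0ℚ; 1ℚ; ½; *<*; positive; nonNegative; >-nonZero)
import Data.Rational.Properties as ℚ
import Data.Rational.Unnormalised.Base as ℚᵘ
import Data.Rational.Unnormalised.Properties as ℚᵘ
open import Data.Sum.Base using (inj₁; inj₂)
open import Data.Vec.Functional as Vector using (Vector)
open import Relation.Binary.PropositionalEquality
open import Relation.Nullary using (Dec; yes; no; contradiction)
open import Relation.Unary using (Pred; Decidable)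

private
  module ℚ+ where
    open import Algebra.Properties.AbelianGroup ℚ.+-0-abelianGroup public
    open import Algebra.Properties.CommutativeSemigroup
      (CommutativeMonoid.commutativeSemigroup ℚ.+-0-commutativeMonoid) public
  module ℚ* where
    open import Algebra.Properties.Ring ℚ.+-*-ring public
    open import Algebra.Properties.CommutativeSemigroup
      (CommutativeMonoid.commutativeSemigroup ℚ.*-1-commutativeMonoid) public

private
  variable
    a ℓ : Level
    A : Set a

Eventually : Pred ℕ ℓ → Set ℓ
Eventually P = ∃[ N ] ∀ n → N ℕ.≤ n → P n

IsCauchy : (ℕ → ℚ) → Set
IsCauchy x = ∀ ε → 0ℚ ℚ.< ε →
  ∃[ N ] ∀ m n → N ℕ.≤ m → N ℕ.≤ n → ℚ.∣ x m ℚ.- x n ∣ ℚ.< ε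

record ℝ : Set where
  constructor mkℝ
  field
    seq    : ℕ → ℚ
    cauchy : IsCauchy seq

open ℝ public

infix 4 _≈_ _≤_ _<_

_≈_ : ℝ → ℝ → Set
x ≈ y = ∀ ε → 0ℚ ℚ.< ε → Eventually λ n → ℚ.∣ seq x n ℚ.- seq y n ∣ ℚ.< ε

_≤_ : ℝ → ℝ → Set
x ≤ y = ∀ ε → 0ℚ ℚ.< ε → Eventually λ n → seq x n ℚ.< seq y n ℚ.+ ε

_<_ : ℝ → ℝ → Set
x < y = ∃[ δ ] 0ℚ ℚ.< δ × Eventually λ n → seq x n ℚ.+ δ ℚ.< seq y n

p-q≡0 : ∀ p → p ℚ.- p ≡ 0ℚ
p-q≡0 = ℚ.+-inverseʳ

half-pos : ∀ {ε} → 0ℚ ℚ.< ε → 0ℚ ℚ.< ε ℚ.* ½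
half-pos {ε} 0<ε =
  subst (ℚ._< ε ℚ.* ½) (ℚ.*-zeroˡ ½) (ℚ.*-monoˡ-<-pos ½ 0<ε)

half+half : ∀ ε → ε ℚ.* ½ ℚ.+ ε ℚ.* ½ ≡ ε
half+half ε = trans (sym (ℚ.*-distribˡ-+ ε ½ ½)) (ℚ.*-identityʳ ε)

*-pos : ∀ {p q} → 0ℚ ℚ.< p → 0ℚ ℚ.< q → 0ℚ ℚ.< p ℚ.* q
*-pos {p} {q} 0<p 0<q =
  ℚ.positive⁻¹ (p ℚ.* q) {{ℚ.pos*pos⇒pos p {{positive 0<p}} q {{positive 0<q}}}}

∣p-q∣≡∣q-p∣ : ∀ p q → ℚ.∣ p ℚ.- q ∣ ≡ ℚ.∣ q ℚ.- p ∣
∣p-q∣≡∣q-p∣ p q = trans (sym (ℚ.∣-p∣≡∣p∣ (p ℚ.- q)))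
  (cong ℚ.∣_∣ (ℚ+.⁻¹-anti-homo‿- p q))

p-q+q≡p : ∀ p q → (p ℚ.- q) ℚ.+ q ≡ p
p-q+q≡p p q = trans (ℚ.+-assoc p (ℚ.- q) q)
  (trans (cong (p ℚ.+_) (ℚ.+-inverseˡ q)) (ℚ.+-identityʳ p))

p+q-q≡p : ∀ p q → (p ℚ.+ q) ℚ.- q ≡ p
p+q-q≡p p q = trans (ℚ.+-assoc p q (ℚ.- q))
  (trans (cong (p ℚ.+_) (ℚ.+-inverseʳ q)) (ℚ.+-identityʳ p))

telescope : ∀ p q r → p ℚ.- r ≡ (p ℚ.- q) ℚ.+ (q ℚ.- r)
telescope p q r = trans (cong (ℚ._- r) (sym (p-q+q≡p p q)))
  (ℚ.+-assoc (p ℚ.- q) q (ℚ.- r))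

+-‿interchange : ∀ p q r s → (p ℚ.+ q) ℚ.- (r ℚ.+ s) ≡ (p ℚ.- r) ℚ.+ (q ℚ.- s)
+-‿interchange p q r s = trans (cong (p ℚ.+ q ℚ.+_) (ℚ.neg-distrib-+ r s))
  (ℚ+.interchange p q (ℚ.- r) (ℚ.- s))

product-difference : ∀ p q r s → p ℚ.* q ℚ.- r ℚ.* s ≡ p ℚ.* (q ℚ.- s) ℚ.+ s ℚ.* (p ℚ.- r)
product-difference p q r s = trans (telescope (p ℚ.* q) (p ℚ.* s) (r ℚ.* s))
  (cong₂ ℚ._+_ (sym (ℚ*.x[y-z]≈xy-xz p q s))
    (trans (sym (ℚ*.[y-z]x≈yx-zx s p r)) (ℚ.*-comm (p ℚ.- r) s)))

∣p∣≤ : ∀ {p q} → p ℚ.≤ q → ℚ.- p ℚ.≤ q → ℚ.∣ p ∣ ℚ.≤ q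
∣p∣≤ {p} {q} p≤q -p≤q with ℚ.∣p∣≡p∨∣p∣≡-p p
... | inj₁ eq = subst (ℚ._≤ q) (sym eq) p≤q
... | inj₂ eq = subst (ℚ._≤ q) (sym eq) -p≤q

∣∣p∣-∣q∣∣≤∣p-q∣ : ∀ p q → ℚ.∣ ℚ.∣ p ∣ ℚ.- ℚ.∣ q ∣ ∣ ℚ.≤ ℚ.∣ p ℚ.- q ∣
∣∣p∣-∣q∣∣≤∣p-q∣ p q = ∣p∣≤ (step p q)
  (subst₂ ℚ._≤_
    (sym (ℚ+.⁻¹-anti-homo‿- ℚ.∣ p ∣ ℚ.∣ q ∣))
    (∣p-q∣≡∣q-p∣ q p) (step q p))
  where
  step : ∀ p q → ℚ.∣ p ∣ ℚ.- ℚ.∣ q ∣ ℚ.≤ ℚ.∣ p ℚ.- q ∣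
  step p q = begin
    ℚ.∣ p ∣ ℚ.- ℚ.∣ q ∣
      ≡⟨ cong (λ r → ℚ.∣ r ∣ ℚ.- ℚ.∣ q ∣) (sym (p-q+q≡p p q)) ⟩
    ℚ.∣ (p ℚ.- q) ℚ.+ q ∣ ℚ.- ℚ.∣ q ∣
      ≤⟨ ℚ.+-monoˡ-≤ (ℚ.- ℚ.∣ q ∣) (ℚ.∣p+q∣≤∣p∣+∣q∣ (p ℚ.- q) q) ⟩
    (ℚ.∣ p ℚ.- q ∣ ℚ.+ ℚ.∣ q ∣) ℚ.- ℚ.∣ q ∣
      ≡⟨ p+q-q≡p ℚ.∣ p ℚ.- q ∣ ℚ.∣ q ∣ ⟩
    ℚ.∣ p ℚ.- q ∣ ∎
    where open ℚ.≤-Reasoning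

map-cauchy : ∀ (f : ℚ → ℚ) {x} →
  (∀ p q → ℚ.∣ f p ℚ.- f q ∣ ℚ.≤ ℚ.∣ p ℚ.- q ∣) → IsCauchy x → IsCauchy λ n → f (x n)
map-cauchy f {x} contraction x-cauchy ε 0<ε =
  let N , close = x-cauchy ε 0<ε in
  N , λ m n N≤m N≤n → ℚ.≤-<-trans (contraction (x m) (x n)) (close m n N≤m N≤n)

const-cauchy : ∀ p → IsCauchy λ _ → p
const-cauchy p ε 0<ε = 0 , λ _ _ _ _ →
  subst (λ q → ℚ.∣ q ∣ ℚ.< ε) (sym (p-q≡0 p)) 0<ε

+-cauchy : ∀ {x y} → IsCauchy x → IsCauchy y → IsCauchy λ n → x n ℚ.+ y n
+-cauchy {x} {y} x-cauchy y-cauchy ε 0<ε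
  with Nx , x-close ← x-cauchy (ε ℚ.* ½) (half-pos 0<ε)
     | Ny , y-close ← y-cauchy (ε ℚ.* ½) (half-pos 0<ε) =
  Nx ℕ.⊔ Ny , λ m n N≤m N≤n → begin-strict
    ℚ.∣ (x m ℚ.+ y m) ℚ.- (x n ℚ.+ y n) ∣
      ≡⟨ cong ℚ.∣_∣ (+-‿interchange (x m) (y m) (x n) (y n)) ⟩
    ℚ.∣ (x m ℚ.- x n) ℚ.+ (y m ℚ.- y n) ∣
      ≤⟨ ℚ.∣p+q∣≤∣p∣+∣q∣ (x m ℚ.- x n) (y m ℚ.- y n) ⟩
    ℚ.∣ x m ℚ.- x n ∣ ℚ.+ ℚ.∣ y m ℚ.- y n ∣
      <⟨ ℚ.+-mono-<
           (x-close m n (ℕ.m⊔n≤o⇒m≤o Nx Ny N≤m) (ℕ.m⊔n≤o⇒m≤o Nx Ny N≤n))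
           (y-close m n (ℕ.m⊔n≤o⇒n≤o Nx Ny N≤m) (ℕ.m⊔n≤o⇒n≤o Nx Ny N≤n)) ⟩
    ε ℚ.* ½ ℚ.+ ε ℚ.* ½
      ≡⟨ half+half ε ⟩
    ε ∎
  where open ℚ.≤-Reasoning

bounded : ∀ {x} → IsCauchy x → ∃[ B ] 0ℚ ℚ.< B × Eventually λ n → ℚ.∣ x n ∣ ℚ.≤ B
bounded {x} x-cauchy with N , close ← x-cauchy 1ℚ (ℚ.positive⁻¹ 1ℚ) =
  B , ℚ.<-≤-trans (ℚ.positive⁻¹ 1ℚ) 1≤B , N , bound
  where
  open ℚ.≤-Reasoning
  B = 1ℚ ℚ.+ ℚ.∣ x N ∣
  1≤B : 1ℚ ℚ.≤ B
  1≤B = subst (ℚ._≤ B) (ℚ.+-identityʳ 1ℚ) (ℚ.+-monoʳ-≤ 1ℚ (ℚ.0≤∣p∣ (x N)))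
  bound : ∀ n → N ℕ.≤ n → ℚ.∣ x n ∣ ℚ.≤ B
  bound n N≤n = begin
    ℚ.∣ x n ∣
      ≡⟨ cong ℚ.∣_∣ (sym (p-q+q≡p (x n) (x N))) ⟩
    ℚ.∣ (x n ℚ.- x N) ℚ.+ x N ∣
      ≤⟨ ℚ.∣p+q∣≤∣p∣+∣q∣ (x n ℚ.- x N) (x N) ⟩
    ℚ.∣ x n ℚ.- x N ∣ ℚ.+ ℚ.∣ x N ∣
      ≤⟨ ℚ.+-monoˡ-≤ ℚ.∣ x N ∣ (ℚ.<⇒≤ (close n N N≤n ℕ.≤-refl)) ⟩
    B ∎

-- If ∣p∣ ≤ B and ∣q∣ < ε/2B then ∣p q∣ < ε/2, where B is positive.
scaled : ∀ B (0<B : 0ℚ ℚ.< B) → ℚ → ℚ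
scaled B 0<B ε = ε ℚ.* ½ ℚ.* (ℚ.1/ B) {{>-nonZero 0<B}}

scaled-pos : ∀ {B} (0<B : 0ℚ ℚ.< B) {ε} → 0ℚ ℚ.< ε → 0ℚ ℚ.< scaled B 0<B ε
scaled-pos {B} 0<B 0<ε = *-pos (half-pos 0<ε)
  (ℚ.positive⁻¹ ((ℚ.1/ B) {{>-nonZero 0<B}}) {{ℚ.1/pos⇒pos B {{positive 0<B}}}})

scaled-bound : ∀ {B} (0<B : 0ℚ ℚ.< B) {ε p q} → ℚ.∣ p ∣ ℚ.≤ B →
  ℚ.∣ q ∣ ℚ.< scaled B 0<B ε → ℚ.∣ p ℚ.* q ∣ ℚ.< ε ℚ.* ½
scaled-bound {B} 0<B {ε} {p} {q} p≤B q<ε = begin-strict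
  ℚ.∣ p ℚ.* q ∣
    ≡⟨ ℚ.∣p*q∣≡∣p∣*∣q∣ p q ⟩
  ℚ.∣ p ∣ ℚ.* ℚ.∣ q ∣
    ≤⟨ ℚ.*-monoʳ-≤-nonNeg ℚ.∣ q ∣ {{ℚ.∣-∣-nonNeg q}} p≤B ⟩
  B ℚ.* ℚ.∣ q ∣
    <⟨ ℚ.*-monoʳ-<-pos B {{positive 0<B}} q<ε ⟩
  B ℚ.* (ε ℚ.* ½ ℚ.* 1/B)
    ≡⟨ ℚ*.x∙yz≈y∙xz B (ε ℚ.* ½) 1/B ⟩
  (ε ℚ.* ½) ℚ.* (B ℚ.* 1/B)
    ≡⟨ cong (ε ℚ.* ½ ℚ.*_) (ℚ.*-inverseʳ B {{>-nonZero 0<B}}) ⟩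
  (ε ℚ.* ½) ℚ.* 1ℚ
    ≡⟨ ℚ.*-identityʳ (ε ℚ.* ½) ⟩
  ε ℚ.* ½ ∎
  where
  open ℚ.≤-Reasoning
  1/B = (ℚ.1/ B) {{>-nonZero 0<B}}

*-cauchy : ∀ {x y} → IsCauchy x → IsCauchy y → IsCauchy λ n → x n ℚ.* y n
*-cauchy {x} {y} x-cauchy y-cauchy ε 0<ε
  with B , 0<B , M , x-bound ← bounded x-cauchy
     | C , 0<C , L , y-bound ← bounded y-cauchy
  with Nx , x-close ← x-cauchy (scaled C 0<C ε) (scaled-pos 0<C 0<ε)
     | Ny , y-close ← y-cauchy (scaled B 0<B ε) (scaled-pos 0<B 0<ε) =
  (M ℕ.⊔ L) ℕ.⊔ (Nx ℕ.⊔ Ny) , λ m n N≤m N≤n →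
    let
      M⊔L≤m = ℕ.m⊔n≤o⇒m≤o (M ℕ.⊔ L) (Nx ℕ.⊔ Ny) N≤m
      M⊔L≤n = ℕ.m⊔n≤o⇒m≤o (M ℕ.⊔ L) (Nx ℕ.⊔ Ny) N≤n
      N⊔N≤m = ℕ.m⊔n≤o⇒n≤o (M ℕ.⊔ L) (Nx ℕ.⊔ Ny) N≤m
      N⊔N≤n = ℕ.m⊔n≤o⇒n≤o (M ℕ.⊔ L) (Nx ℕ.⊔ Ny) N≤n
    in begin-strict
    ℚ.∣ x m ℚ.* y m ℚ.- x n ℚ.* y n ∣
      ≡⟨ cong ℚ.∣_∣ (product-difference (x m) (y m) (x n) (y n)) ⟩
    ℚ.∣ x m ℚ.* (y m ℚ.- y n) ℚ.+ y n ℚ.* (x m ℚ.- x n) ∣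
      ≤⟨ ℚ.∣p+q∣≤∣p∣+∣q∣ (x m ℚ.* (y m ℚ.- y n)) (y n ℚ.* (x m ℚ.- x n)) ⟩
    ℚ.∣ x m ℚ.* (y m ℚ.- y n) ∣ ℚ.+ ℚ.∣ y n ℚ.* (x m ℚ.- x n) ∣
      <⟨ ℚ.+-mono-<
           (scaled-bound 0<B {ε = ε} {p = x m} {q = y m ℚ.- y n}
             (x-bound m (ℕ.m⊔n≤o⇒m≤o M L M⊔L≤m))
             (y-close m n (ℕ.m⊔n≤o⇒n≤o Nx Ny N⊔N≤m) (ℕ.m⊔n≤o⇒n≤o Nx Ny N⊔N≤n)))
           (scaled-bound 0<C {ε = ε} {p = y n} {q = x m ℚ.- x n}
             (y-bound n (ℕ.m⊔n≤o⇒n≤o M L M⊔L≤n))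
             (x-close m n (ℕ.m⊔n≤o⇒m≤o Nx Ny N⊔N≤m) (ℕ.m⊔n≤o⇒m≤o Nx Ny N⊔N≤n))) ⟩
    ε ℚ.* ½ ℚ.+ ε ℚ.* ½
      ≡⟨ half+half ε ⟩
    ε ∎
  where open ℚ.≤-Reasoning

infixl 6 _+_ _-_
infixl 7 _*_
infix 8 -_

_+_ : ℝ → ℝ → ℝ
x + y = mkℝ (λ n → seq x n ℚ.+ seq y n) (+-cauchy {seq x} {seq y} (cauchy x) (cauchy y))

_*_ : ℝ → ℝ → ℝ
x * y = mkℝ (λ n → seq x n ℚ.* seq y n) (*-cauchy {seq x} {seq y} (cauchy x) (cauchy y))

-_ : ℝ → ℝ
- x = mkℝ (λ n → ℚ.- seq x n) (map-cauchy ℚ.-_ {seq x} neg-contraction (cauchy x))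
  where
  neg-contraction : ∀ p q → ℚ.∣ ℚ.- p ℚ.- ℚ.- q ∣ ℚ.≤ ℚ.∣ p ℚ.- q ∣
  neg-contraction p q = ℚ.≤-reflexive (trans
    (cong ℚ.∣_∣ (sym (ℚ.neg-distrib-+ p (ℚ.- q)))) (ℚ.∣-p∣≡∣p∣ (p ℚ.- q)))

_-_ : ℝ → ℝ → ℝ
x - y = x + - y

∣_∣ : ℝ → ℝ
∣ x ∣ = mkℝ (λ n → ℚ.∣ seq x n ∣) (map-cauchy ℚ.∣_∣ {seq x} ∣∣p∣-∣q∣∣≤∣p-q∣ (cauchy x))

fromℚ : ℚ → ℝ
fromℚ p = mkℝ (λ _ → p) (const-cauchy p)

fromℤ : ℤ → ℝ
fromℤ i = fromℚ (i ℚ./ 1)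

0ℝ 1ℝ : ℝ
0ℝ = fromℚ 0ℚ
1ℝ = fromℚ 1ℚ

ℝ-rawRing : RawRing 0ℓ 0ℓ
ℝ-rawRing = record
  { Carrier = ℝ
  ; _≈_ = _≈_
  ; _+_ = _+_
  ; _*_ = _*_
  ; -_ = -_
  ; 0# = 0ℝ
  ; 1# = 1ℝ
  }

-- Extended by the junk value 0⁻¹ = 0.
_⁻¹ℚ : ℚ → ℚ
p ⁻¹ℚ with p ℚ.≟ 0ℚ
... | yes _  = 0ℚ
... | no p≢0 = (ℚ.1/ p) {{ℚ.≢-nonZero p≢0}}

⁻¹ℚ-inverse : ∀ {p} → 0ℚ ℚ.< p → p ℚ.* p ⁻¹ℚ ≡ 1ℚ
⁻¹ℚ-inverse {p} 0<p with p ℚ.≟ 0ℚ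
... | yes p≡0 = contradiction (sym p≡0) (ℚ.<⇒≢ 0<p)
... | no p≢0  = ℚ.*-inverseʳ p {{ℚ.≢-nonZero p≢0}}

⁻¹ℚ-pos : ∀ {p} → 0ℚ ℚ.< p → 0ℚ ℚ.< p ⁻¹ℚ
⁻¹ℚ-pos {p} 0<p with p ℚ.≟ 0ℚ
... | yes p≡0 = contradiction (sym p≡0) (ℚ.<⇒≢ 0<p)
... | no p≢0  = ℚ.positive⁻¹ ((ℚ.1/ p) {{ℚ.≢-nonZero p≢0}}) {{ℚ.1/pos⇒pos p {{positive 0<p}}}}

-- For p, q > δ > 0:  δ² ∣p⁻¹ - q⁻¹∣ ≤ p q ∣p⁻¹ - q⁻¹∣ = ∣q - p∣
⁻¹ℚ-lipschitz : ∀ {δ p q} → 0ℚ ℚ.< δ → δ ℚ.< p → δ ℚ.< q →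
  δ ℚ.* δ ℚ.* ℚ.∣ p ⁻¹ℚ ℚ.- q ⁻¹ℚ ∣ ℚ.≤ ℚ.∣ p ℚ.- q ∣
⁻¹ℚ-lipschitz {δ} {p} {q} 0<δ δ<p δ<q = begin
  δ ℚ.* δ ℚ.* ℚ.∣ i ℚ.- j ∣
    ≤⟨ ℚ.*-monoʳ-≤-nonNeg ℚ.∣ i ℚ.- j ∣ {{ℚ.∣-∣-nonNeg (i ℚ.- j)}} δδ≤pq ⟩
  p ℚ.* q ℚ.* ℚ.∣ i ℚ.- j ∣
    ≡⟨ cong (ℚ._* ℚ.∣ i ℚ.- j ∣) (sym (ℚ.0≤p⇒∣p∣≡p (ℚ.<⇒≤ (*-pos 0<p 0<q)))) ⟩
  ℚ.∣ p ℚ.* q ∣ ℚ.* ℚ.∣ i ℚ.- j ∣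
    ≡⟨ sym (ℚ.∣p*q∣≡∣p∣*∣q∣ (p ℚ.* q) (i ℚ.- j)) ⟩
  ℚ.∣ p ℚ.* q ℚ.* (i ℚ.- j) ∣
    ≡⟨ cong ℚ.∣_∣ (ℚ*.x[y-z]≈xy-xz (p ℚ.* q) i j) ⟩
  ℚ.∣ p ℚ.* q ℚ.* i ℚ.- p ℚ.* q ℚ.* j ∣
    ≡⟨ cong₂ (λ u v → ℚ.∣ u ℚ.- v ∣) (ℚ*.xy∙z≈y∙xz p q i) (ℚ.*-assoc p q j) ⟩
  ℚ.∣ q ℚ.* (p ℚ.* i) ℚ.- p ℚ.* (q ℚ.* j) ∣
    ≡⟨ cong₂ (λ u v → ℚ.∣ q ℚ.* u ℚ.- p ℚ.* v ∣) (⁻¹ℚ-inverse 0<p) (⁻¹ℚ-inverse 0<q) ⟩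
  ℚ.∣ q ℚ.* 1ℚ ℚ.- p ℚ.* 1ℚ ∣
    ≡⟨ cong₂ (λ u v → ℚ.∣ u ℚ.- v ∣) (ℚ.*-identityʳ q) (ℚ.*-identityʳ p) ⟩
  ℚ.∣ q ℚ.- p ∣
    ≡⟨ ∣p-q∣≡∣q-p∣ q p ⟩
  ℚ.∣ p ℚ.- q ∣ ∎
  where
  open ℚ.≤-Reasoning
  i = p ⁻¹ℚ
  j = q ⁻¹ℚ
  0<p = ℚ.<-trans 0<δ δ<p
  0<q = ℚ.<-trans 0<δ δ<q
  δδ≤pq : δ ℚ.* δ ℚ.≤ p ℚ.* q
  δδ≤pq = ℚ.≤-trans
    (ℚ.*-monoʳ-≤-nonNeg δ {{nonNegative (ℚ.<⇒≤ 0<δ)}} (ℚ.<⇒≤ δ<p))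
    (ℚ.*-monoˡ-≤-nonNeg p {{nonNegative (ℚ.<⇒≤ 0<p)}} (ℚ.<⇒≤ δ<q))

drop-0+ : ∀ {δ p} → 0ℚ ℚ.+ δ ℚ.< p → δ ℚ.< p
drop-0+ {δ} {p} = subst (ℚ._< p) (ℚ.+-identityˡ δ)

⁻¹-cauchy : ∀ x → 0ℝ < x → IsCauchy λ n → seq x n ⁻¹ℚ
⁻¹-cauchy x (δ , 0<δ , M , above) ε 0<ε
  with N , close ← cauchy x (δ ℚ.* δ ℚ.* ε) (*-pos (*-pos 0<δ 0<δ) 0<ε) =
  M ℕ.⊔ N , λ m n N≤m N≤n →
    ℚ.*-cancelˡ-<-nonNeg (δ ℚ.* δ) {{nonNegative (ℚ.<⇒≤ (*-pos 0<δ 0<δ))}}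
      (ℚ.≤-<-trans
        (⁻¹ℚ-lipschitz 0<δ (drop-0+ (above m (ℕ.m⊔n≤o⇒m≤o M N N≤m)))
                           (drop-0+ (above n (ℕ.m⊔n≤o⇒m≤o M N N≤n))))
        (close m n (ℕ.m⊔n≤o⇒n≤o M N N≤m) (ℕ.m⊔n≤o⇒n≤o M N N≤n)))

recip : (x : ℝ) → 0ℝ < x → ℝ
recip x 0<x = mkℝ (λ n → seq x n ⁻¹ℚ) (⁻¹-cauchy x 0<x)

∏ : ∀ {k} → Vector ℝ k → ℝ
∏ = Vector.foldr _*_ 1ℝ

0<1ℝ : 0ℝ < 1ℝ
0<1ℝ = ½ , ℚ.positive⁻¹ ½ , 0 , λ _ _ → *<* (ℤ.+<+ (ℕ.s≤s (ℕ.s≤s ℕ.z≤n)))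

0<* : ∀ x y → 0ℝ < x → 0ℝ < y → 0ℝ < x * y
0<* x y (δ , 0<δ , M , x-above) (η , 0<η , N , y-above) =
  δ ℚ.* η , *-pos 0<δ 0<η , M ℕ.⊔ N , λ n N≤n →
    let
      δ<xn = drop-0+ (x-above n (ℕ.m⊔n≤o⇒m≤o M N N≤n))
      η<yn = drop-0+ (y-above n (ℕ.m⊔n≤o⇒n≤o M N N≤n))
      0<xn = ℚ.<-trans 0<δ δ<xn
    in subst (ℚ._< seq x n ℚ.* seq y n) (sym (ℚ.+-identityˡ (δ ℚ.* η)))
      (ℚ.<-trans (ℚ.*-monoˡ-<-pos η {{positive 0<η}} δ<xn)
                 (ℚ.*-monoʳ-<-pos (seq x n) {{positive 0<xn}} η<yn))

∏-pos : ∀ {k} (x : Vector ℝ k) → (∀ i → 0ℝ < x i) → 0ℝ < ∏ x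
∏-pos {zero}  x 0<x = 0<1ℝ
∏-pos {suc k} x 0<x = 0<* (x Fin.zero) (∏ (Vector.tail x)) (0<x Fin.zero)
  (∏-pos (Vector.tail x) (λ i → 0<x (Fin.suc i)))

infix 3 _⟶_

_⟶_ : ((n : ℕ) → .{{ℕ.NonZero n}} → ℝ) → ℝ → Set
x ⟶ l = ∀ ε → 0ℝ < ε →
  ∃[ N ] ∀ n → .{{_ : ℕ.NonZero n}} → N ℕ.≤ n → ∣ x n - l ∣ < ε

-- Coefficients in increasing degree.
Polynomial : Set
Polynomial = List ℝ

eval : Polynomial → ℝ → ℝ
eval f x = List.foldr (λ c y → c + x * y) 0ℝ f

ζ-term : ℕ → (i : ℕ) → .{{ℕ.NonZero i}} → ℚ
ζ-term a i = (1ℤ ℚ./ (i ℕ.^ a)) {{ℕ.m^n≢0 i a}}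

ζ-partial : ℕ → ℕ → ℚ
ζ-partial a zero    = 0ℚ
ζ-partial a (suc n) = ζ-partial a n ℚ.+ ζ-term a (suc n)

toℚᵘ-/ : ∀ i n .{{_ : ℕ.NonZero n}} → ℚ.toℚᵘ (i ℚ./ n) ℚᵘ.≃ (i ℚᵘ./ n)
toℚᵘ-/ i (suc n) = ℚ.toℚᵘ-fromℚᵘ (ℚᵘ.mkℚᵘ i n)

1/x+1/y≤1/z : ∀ x y z .{{_ : ℕ.NonZero x}} .{{_ : ℕ.NonZero y}} .{{_ : ℕ.NonZero z}} →
  (x ℕ.+ y) ℕ.* z ℕ.≤ x ℕ.* y → 1ℤ ℚ./ x ℚ.+ 1ℤ ℚ./ y ℚ.≤ 1ℤ ℚ./ z
1/x+1/y≤1/z (suc x) (suc y) (suc z) le = ℚ.toℚᵘ-cancel-≤ (begin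
  ℚ.toℚᵘ (1ℤ ℚ./ suc x ℚ.+ 1ℤ ℚ./ suc y)
    ≃⟨ ℚ.toℚᵘ-homo-+ (1ℤ ℚ./ suc x) (1ℤ ℚ./ suc y) ⟩
  ℚ.toℚᵘ (1ℤ ℚ./ suc x) ℚᵘ.+ ℚ.toℚᵘ (1ℤ ℚ./ suc y)
    ≃⟨ ℚᵘ.+-cong (toℚᵘ-/ 1ℤ (suc x)) (toℚᵘ-/ 1ℤ (suc y)) ⟩
  1ℤ ℚᵘ./ suc x ℚᵘ.+ 1ℤ ℚᵘ./ suc y
    ≤⟨ ℚᵘ.*≤* (subst₂ ℤ._≤_ (cong (ℤ._* + suc z) lhs) (sym (ℤ.*-identityˡ (+ (suc x ℕ.* suc y)))) (ℤ.+≤+ le)) ⟩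
  1ℤ ℚᵘ./ suc z
    ≃⟨ ℚᵘ.≃-sym (toℚᵘ-/ 1ℤ (suc z)) ⟩
  ℚ.toℚᵘ (1ℤ ℚ./ suc z) ∎)
  where
  open ℚᵘ.≤-Reasoning
  lhs : + (suc x ℕ.+ suc y) ≡ 1ℤ ℤ.* + suc y ℤ.+ 1ℤ ℤ.* + suc x
  lhs = trans (cong +_ (ℕ.+-comm (suc x) (suc y)))
    (sym (cong₂ ℤ._+_ (ℤ.*-identityˡ (+ suc y)) (ℤ.*-identityˡ (+ suc x))))

1/large<ε : ∀ ε → 0ℚ ℚ.< ε → 1ℤ ℚ./ suc (ℚ.denominatorℕ ε) ℚ.< ε
1/large<ε (mkℚ ℤ.+0 _ _) (*<* (ℤ.+<+ ()))
1/large<ε (mkℚ ℤ.-[1+ _ ] _ _) (*<* ())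
1/large<ε ε@(mkℚ ℤ.+[1+ k ] d _) _ = ℚ.toℚᵘ-cancel-< (begin-strict
  ℚ.toℚᵘ (1ℤ ℚ./ suc (suc d))  ≃⟨ toℚᵘ-/ 1ℤ (suc (suc d)) ⟩
  1ℤ ℚᵘ./ suc (suc d)          <⟨ ℚᵘ.*<* (subst (ℤ._< ℤ.+[1+ k ] ℤ.* + suc (suc d))
                                    (sym (ℤ.*-identityˡ (+ suc d)))
                                    (ℤ.+<+ (ℕ.m≤m+n (suc (suc d)) (k ℕ.* suc (suc d))))) ⟩
  ℚ.toℚᵘ ε                     ∎)
  where open ℚᵘ.≤-Reasoning

ζ-term-pos : ∀ a i .{{_ : ℕ.NonZero i}} → 0ℚ ℚ.< ζ-term a i
ζ-term-pos a i = ℚ.positive⁻¹ (ζ-term a i) {{ℚ.normalize-pos 1 (i ℕ.^ a) {{ℕ.m^n≢0 i a}}}}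

ζ-partial-mono : ∀ a {m n} → m ℕ.≤ n → ζ-partial a m ℚ.≤ ζ-partial a n
ζ-partial-mono a {m} m≤n = go (ℕ.≤⇒≤′ m≤n)
  where
  go : ∀ {n} → m ℕ.≤′ n → ζ-partial a m ℚ.≤ ζ-partial a n
  go ℕ.≤′-refl = ℚ.≤-refl
  go (ℕ.≤′-step {n} m≤n) = ℚ.≤-trans (go m≤n)
    (subst (ℚ._≤ ζ-partial a (suc n)) (ℚ.+-identityʳ (ζ-partial a n))
      (ℚ.+-monoʳ-≤ (ζ-partial a n) (ℚ.<⇒≤ (ζ-term-pos a (suc n)))))

-- 1/(n+1)ᵃ + 1/(n+1) ≤ 1/n for a ≥ 2
ζ-term-tail : ∀ {a} → 2 ℕ.≤ a → ∀ n .{{_ : ℕ.NonZero n}} →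
  ζ-term a (suc n) ℚ.+ 1ℤ ℚ./ suc n ℚ.≤ 1ℤ ℚ./ n
ζ-term-tail {a} 2≤a n =
  1/x+1/y≤1/z x (suc n) n {{ℕ.m^n≢0 (suc n) a}} (begin
    (x ℕ.+ suc n) ℕ.* n          ≡⟨ ℕ.*-distribʳ-+ n x (suc n) ⟩
    x ℕ.* n ℕ.+ suc n ℕ.* n      ≤⟨ ℕ.+-monoʳ-≤ (x ℕ.* n) n[n+1]≤x ⟩
    x ℕ.* n ℕ.+ x                ≡⟨ ℕ.+-comm (x ℕ.* n) x ⟩
    x ℕ.+ x ℕ.* n                ≡⟨ ℕ.*-suc x n ⟨
    x ℕ.* suc n                  ∎)
  where
  open ℕ.≤-Reasoning
  x = suc n ℕ.^ a
  n[n+1]≤x : suc n ℕ.* n ℕ.≤ x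
  n[n+1]≤x = begin
    suc n ℕ.* n      ≤⟨ ℕ.*-monoʳ-≤ (suc n) (ℕ.n≤1+n n) ⟩
    suc n ℕ.* suc n  ≡⟨ cong (suc n ℕ.*_) (ℕ.*-identityʳ (suc n)) ⟨
    suc n ℕ.^ 2      ≤⟨ ℕ.^-monoʳ-≤ (suc n) 2≤a ⟩
    x                ∎

ζ-partial-upper : ∀ {a} → 2 ℕ.≤ a → ∀ {m} {n} → suc m ℕ.≤ n →
  ζ-partial a n ℚ.≤ ζ-partial a (suc m) ℚ.+ 1ℤ ℚ./ suc m
ζ-partial-upper {a} 2≤a {m} m<n = go (ℕ.≤⇒≤′ m<n)
  where
  bound : ℕ → ℚ
  bound n = ζ-partial a (suc n) ℚ.+ 1ℤ ℚ./ suc n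
  antitone : ∀ n → bound (suc n) ℚ.≤ bound n
  antitone n = subst (ℚ._≤ bound n)
    (sym (ℚ.+-assoc (ζ-partial a (suc n)) (ζ-term a (suc (suc n))) (1ℤ ℚ./ suc (suc n))))
    (ℚ.+-monoʳ-≤ (ζ-partial a (suc n)) (ζ-term-tail 2≤a (suc n)))
  below : ∀ n → ζ-partial a (suc n) ℚ.≤ bound n
  below n = subst (ℚ._≤ bound n) (ℚ.+-identityʳ (ζ-partial a (suc n)))
    (ℚ.+-monoʳ-≤ (ζ-partial a (suc n))
      (ℚ.<⇒≤ (ℚ.positive⁻¹ (1ℤ ℚ./ suc n) {{ℚ.normalize-pos 1 (suc n)}})))
  descend : ∀ {n} → m ℕ.≤′ n → bound n ℚ.≤ bound m
  descend ℕ.≤′-refl = ℚ.≤-refl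
  descend (ℕ.≤′-step {n} m≤n) = ℚ.≤-trans (antitone n) (descend m≤n)
  go : ∀ {n} → suc m ℕ.≤′ n → ζ-partial a n ℚ.≤ bound m
  go ℕ.≤′-refl = below m
  go (ℕ.≤′-step {n} m<n) =
    ℚ.≤-trans (below n) (descend (ℕ.≤⇒≤′ (ℕ.<⇒≤ (ℕ.≤′⇒≤ m<n))))

ζ-cauchy : ∀ {a} → 2 ℕ.≤ a → IsCauchy (ζ-partial a)
ζ-cauchy {a} 2≤a ε 0<ε = N , λ m n N≤m N≤n → ℚ.≤-<-trans
    (∣p∣≤ (difference N≤m N≤n)
      (subst (ℚ._≤ 1/N) (sym (ℚ+.⁻¹-anti-homo‿- (ζ-partial a m) (ζ-partial a n)))
        (difference N≤n N≤m)))
    (1/large<ε ε 0<ε)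
  where
  N = suc (ℚ.denominatorℕ ε)
  1/N = 1ℤ ℚ./ N
  difference : ∀ {m n} → N ℕ.≤ m → N ℕ.≤ n → ζ-partial a m ℚ.- ζ-partial a n ℚ.≤ 1/N
  difference {m} {n} N≤m N≤n = begin
    ζ-partial a m ℚ.- ζ-partial a n
      ≤⟨ ℚ.+-mono-≤ (ζ-partial-upper 2≤a N≤m) (ℚ.neg-antimono-≤ (ζ-partial-mono a N≤n)) ⟩
    (ζ-partial a N ℚ.+ 1/N) ℚ.- ζ-partial a N
      ≡⟨ cong (ℚ._- ζ-partial a N) (ℚ.+-comm (ζ-partial a N) 1/N) ⟩
    (1/N ℚ.+ ζ-partial a N) ℚ.- ζ-partial a N
      ≡⟨ p+q-q≡p 1/N (ζ-partial a N) ⟩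
    1/N ∎
    where open ℚ.≤-Reasoning

ζ : (a : ℕ) → 2 ℕ.≤ a → ℝ
ζ a 2≤a = mkℝ (ζ-partial a) (ζ-cauchy 2≤a)

ζ-pos : ∀ a (2≤a : 2 ℕ.≤ a) → 0ℝ < ζ a 2≤a
ζ-pos a 2≤a = δ , half-pos 0<t , 1 , λ n 1≤n → begin-strict
  0ℚ ℚ.+ δ        ≡⟨ ℚ.+-identityˡ δ ⟩
  δ               <⟨ δ<t ⟩
  t               ≡⟨ ℚ.+-identityˡ t ⟨
  ζ-partial a 1   ≤⟨ ζ-partial-mono a 1≤n ⟩
  ζ-partial a n   ∎
  where
  open ℚ.≤-Reasoning
  t = ζ-term a 1
  0<t = ζ-term-pos a 1
  δ = t ℚ.* ½
  δ<t : δ ℚ.< t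
  δ<t = subst₂ ℚ._<_ (ℚ.+-identityʳ δ) (half+half t) (ℚ.+-monoʳ-< δ (half-pos 0<t))

2≤d∸k : ∀ {m d} → m ℕ.< d → (k : Fin m) → 2 ℕ.≤ d ℕ.∸ toℕ k
2≤d∸k {m} {d} m<d k = ℕ.m+n≤o⇒m≤o∸n 2 (ℕ.≤-trans (ℕ.s≤s (toℕ<n k)) m<d)

-- ζ(d) ζ(d-1) ⋯ ζ(d-m+1)
ζ-product : ∀ {m d} → m ℕ.< d → ℝ
ζ-product {m} {d} m<d = ∏ {m} λ k → ζ (d ℕ.∸ toℕ k) (2≤d∸k m<d k)

ζ-product-pos : ∀ {m d} (m<d : m ℕ.< d) → 0ℝ < ζ-product m<d
ζ-product-pos {m} {d} m<d =
  ∏-pos {m} (λ k → ζ (d ℕ.∸ toℕ k) (2≤d∸k m<d k)) (λ k → ζ-pos (d ℕ.∸ toℕ k) (2≤d∸k m<d k))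

module Linear {c ℓ : Level} (R : RawRing c ℓ) where

  private
    module R = RawRing R
  open RawMonoidDefinitions R.+-rawMonoid using (sum)

  linearCombination : ∀ {m d} → Vector R.Carrier m → Vector (Vector R.Carrier d) m →
    Vector R.Carrier d
  linearCombination c v i = sum λ k → c k R.* v k i

  LinearlyIndependent : ∀ {m d} → Vector (Vector R.Carrier d) m → Set (c ⊔ ℓ)
  LinearlyIndependent v =
    ∀ c → (∀ i → linearCombination c v i R.≈ R.0#) → ∀ k → c k R.≈ R.0#

  Span : ∀ {m d} → Vector (Vector R.Carrier d) m → Pred (Vector R.Carrier d) (c ⊔ ℓ)
  Span v w = ∃[ c ] ∀ i → linearCombination c v i R.≈ w i

  IsBasis : ∀ {m d p} → Vector (Vector R.Carrier d) m → Pred (Vector R.Carrier d) p →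
    Set (c ⊔ ℓ ⊔ p)
  IsBasis v M = (∀ k → M (v k)) × LinearlyIndependent v × (∀ w → M w → Span v w)

module Linearℤ = Linear ℤ.+-*-rawRing
module Linearℝ = Linear ℝ-rawRing

toℝ : ∀ {d} → Vector ℤ d → Vector ℝ d
toℝ = Vector.map fromℤ

-- span_ℝ(S) ∩ ℤᵈ
RealSpanLattice : ∀ {m d} → Vector (Vector ℤ d) m → Pred (Vector ℤ d) 0ℓ
RealSpanLattice S w = Linearℝ.Span (Vector.map toℝ S) (toℝ w)

Primitive : ∀ {m d} → Pred (Vector (Vector ℤ d) m) 0ℓ
Primitive S =
  Linearℝ.LinearlyIndependent (Vector.map toℝ S) × Linearℤ.IsBasis S (RealSpanLattice S)

Distribution : Set a → Set a
Distribution A = List (A × ℚ)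

-- On the integers s with b ≤ s < b + n.
uniform : ℤ → (n : ℕ) → .{{ℕ.NonZero n}} → Distribution ℤ
uniform b n = List.map (λ j → b ℤ.+ + j , 1ℤ ℚ./ n) (List.upTo n)

independent : ∀ {k} → Vector (Distribution A) k → Distribution (Vector A k)
independent {k = zero}  D = (Vector.[] , 1ℚ) ∷ []
independent {k = suc k} D =
  List.cartesianProductWith (λ (x , p) (xs , q) → x Vector.∷ xs , p ℚ.* q)
    (D Fin.zero) (independent (Vector.tail D))

-- The probability of an event; it does not depend on the choice of decision procedure.
probability : {P : Pred A ℓ} → Decidable P → Distribution A → ℚ
probability P? D =
  List.foldr ℚ._+_ 0ℚ (List.map proj₂ (List.filter (λ (x , _) → P? x) D))

randomVectors : ∀ {m d} → (Fin m → Fin d → ℤ) → (n : ℕ) → .{{ℕ.NonZero n}} →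
  Distribution (Vector (Vector ℤ d) m)
randomVectors b n = independent λ k → independent λ i → uniform (b k i) n

PolynomiallyBounded : ∀ {m d} → ((n : ℕ) → .{{ℕ.NonZero n}} → Fin m → Fin d → ℤ) → Set
PolynomiallyBounded b = ∃[ f ] ∀ n .{{_ : ℕ.NonZero n}} k i →
  fromℤ (+ ℤ.∣ b n k i ∣) ≤ eval f (fromℤ (+ n))

{-# OPTIONS --safe #-}

-- Rows are added one at a time. If s₁, …, sₖ is a basis of its saturation, then ℤᵈ / ⟨s₁, …, sₖ⟩ is free of
-- rank e = d - k, and adding a row s keeps the set primitive iff the coordinates of the image φ s ∈ ℤᵉ have
-- gcd 1. So it suffices that, uniformly in s₁, …, sₖ, a random s in the box satisfies this with probability
-- 1/ζ(e) + o(1); the factors 1/ζ(d), …, 1/ζ(d-m+1) then multiply up.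
--
-- For a fixed M, having no common divisor in [2, M] is a periodic condition on s. Since φ is onto, its frequency ρ
-- is that of the same condition on ℤᵉ. Sorting the vectors y by the q ≤ M such that y/q has no divisor in [2, M]
-- gives 1 - 1/M ≤ ρ (1 + 1/2ᵉ + ⋯ + 1/Mᵉ) ≤ 1, as a y without such a q has a divisor in (M, M²].
--
-- Otherwise φ s is divisible by some prime p > M. For p ≤ n this has probability at most 2ᵈ/pᵉ, with sum O(1/M).
-- For p > n, elimination on s₁, …, sₖ yields two forms ψ₀ = Δ xᵢ + ⋯ without xⱼ and ψ₁ = Δ xⱼ + ⋯ without xᵢ that
-- factor through φ, with coefficients polynomial in n. A nonzero integer of size at most n^K has at most K prime
-- factors above n, so outside an event of probability 1/n there are at most 2K candidates p, the divisors of Δ and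
-- of ψ₀ s. For each p ∣ Δ a coordinate of φ s, and for each other p the value ψ₁ s, leaves one choice mod p for
-- some coordinate of s, which has probability at most 1/n.
module Submission where

open import Data.Fin.Base as Fin using (Fin)
import Data.Fin.Properties as Fin
open import Data.Integer.Base as ℤ using (ℤ; 0ℤ; 1ℤ) renaming (+_ to pos; ∣_∣ to abs)
import Data.Integer.Divisibility.Signed as ℤ
import Data.Integer.Properties as ℤ
open import Data.Integer.Tactic.RingSolver using (solve-∀)
open import Data.List.Base using (List; []; _∷_)
open import Data.List.Membership.Propositional using (_∈_)
open import Data.List.Relation.Unary.Any using (here; there)
open import Data.Nat.Base as ℕ using (ℕ; zero; suc)
import Data.Nat.Divisibility as ℕ
import Data.Nat.Properties as ℕ
open import Data.Product using (_×_; _,_; ∃-syntax; Σ-syntax; proj₁; proj₂)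
open import Data.Rational.Base as ℚ using (ℚ; 0ℚ; 1ℚ; ½)
import Data.Rational.Properties as ℚ
open import Data.Rational.Solver using (module +-*-Solver)
open import Data.Sum.Base using (_⊎_; inj₁; inj₂)
open import Data.Vec.Base as Vec using (Vec; []; _∷_)
open import Data.Vec.Functional as Vector using (Vector)
open import Function.Base using (_∘_)
open import Relation.Binary.PropositionalEquality
open import Relation.Nullary using (Dec; yes; no; contradiction; ¬_; ¬?)
open import Relation.Unary using (Decidable)

-- The primes `p > n` shape the proof. A box of side `n` sees less than one period modulo `p`, and
-- far too many primes lie below `n^K` for a union bound in which each costs `1/n`. So the
-- candidates must be few, and fixed before the coordinate that decides about them: `ψ₀` omits `xⱼ`,
-- hence the divisors of `ψ₀ s` are known while `xⱼ` still varies, and along `xⱼ` the form `ψ₁` has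
-- slope `Δ`. Polynomial boundedness enters here, as the bound `n^K`. The hypothesis `m < d` gives
-- `e ≥ 2` at every row, hence two forms and tails of `1/q^e` of size at most `1/M`.
--
-- Primitivity speaks of Cauchy reals, whose equality is undecidable, so it is decided from integer
-- data. A unit gcd supplies a covector that vanishes on the earlier rows and is ±1 on the new one;
-- applied to a real relation it isolates one coefficient. Any other gcd refutes saturation, which
-- primitivity implies.
--
-- Counts are compared with volumes in the form `ζ-partial e j * count`, with a relative error and
-- with `j` independent of `n`; reciprocals of ζ appear only at the end.

-- Finite sums, indicators, and sums over intervals and boxes of integers.

module Sums where

  import Algebra.Properties.AbelianGroup ℤ.+-0-abelianGroup as ℤ+
  open import Data.List.Base using (_++_; map; length; cartesianProductWith)
  open import Data.Nat.Base
  open import Data.Nat.Properties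
  open import Algebra.Properties.CommutativeSemigroup +-commutativeSemigroup using (interchange)
  open import Data.Vec.Base using (insertAt; removeAt; lookup)

  ∑ : {A : Set} → List A → (A → ℕ) → ℕ
  ∑ []       f = 0
  ∑ (x ∷ xs) f = f x + ∑ xs f

  ∑-cong : ∀ {A : Set} (xs : List A) {f g : A → ℕ} → (∀ x → f x ≡ g x) → ∑ xs f ≡ ∑ xs g
  ∑-cong []       f≗g = refl
  ∑-cong (x ∷ xs) f≗g = cong₂ _+_ (f≗g x) (∑-cong xs f≗g)

  ∑-mono-∈ : ∀ {A : Set} (xs : List A) {f g : A → ℕ} → (∀ {x} → x ∈ xs → f x ≤ g x) → ∑ xs f ≤ ∑ xs g
  ∑-mono-∈ []       f≤g = z≤n
  ∑-mono-∈ (x ∷ xs) f≤g = +-mono-≤ (f≤g (here refl)) (∑-mono-∈ xs (f≤g ∘ there))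

  ∑-mono : ∀ {A : Set} (xs : List A) {f g : A → ℕ} → (∀ x → f x ≤ g x) → ∑ xs f ≤ ∑ xs g
  ∑-mono xs f≤g = ∑-mono-∈ xs (λ {x} _ → f≤g x)

  ∑-++ : ∀ {A : Set} (xs ys : List A) f → ∑ (xs ++ ys) f ≡ ∑ xs f + ∑ ys f
  ∑-++ []       ys f = refl
  ∑-++ (x ∷ xs) ys f = trans (cong (f x +_) (∑-++ xs ys f)) (sym (+-assoc (f x) _ _))

  ∑-map : ∀ {A B : Set} (g : A → B) xs f → ∑ (map g xs) f ≡ ∑ xs (f ∘ g)
  ∑-map g []       f = refl
  ∑-map g (x ∷ xs) f = cong (f (g x) +_) (∑-map g xs f)

  ∑-+ : ∀ {A : Set} (xs : List A) f g → ∑ xs (λ x → f x + g x) ≡ ∑ xs f + ∑ xs g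
  ∑-+ []       f g = refl
  ∑-+ (x ∷ xs) f g = trans (cong (f x + g x +_) (∑-+ xs f g)) (interchange (f x) (g x) _ _)

  ∑-*ˡ : ∀ {A : Set} (xs : List A) c f → ∑ xs (λ x → c * f x) ≡ c * ∑ xs f
  ∑-*ˡ []       c f = sym (*-zeroʳ c)
  ∑-*ˡ (x ∷ xs) c f = trans (cong (c * f x +_) (∑-*ˡ xs c f)) (sym (*-distribˡ-+ c (f x) _))

  ∑-const : ∀ {A : Set} (xs : List A) c → ∑ xs (λ _ → c) ≡ length xs * c
  ∑-const []       c = refl
  ∑-const (x ∷ xs) c = cong (c +_) (∑-const xs c)

  ∑-zero : ∀ {A : Set} (xs : List A) {f} → (∀ {x} → x ∈ xs → f x ≡ 0) → ∑ xs f ≡ 0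
  ∑-zero []       f≡0 = refl
  ∑-zero (x ∷ xs) f≡0 rewrite f≡0 (here refl) = ∑-zero xs (f≡0 ∘ there)

  ∑-swap : ∀ {A B : Set} (xs : List A) (ys : List B) (f : A → B → ℕ) →
    ∑ xs (λ x → ∑ ys (f x)) ≡ ∑ ys (λ y → ∑ xs (λ x → f x y))
  ∑-swap []       ys f = sym (∑-zero ys (λ _ → refl))
  ∑-swap (x ∷ xs) ys f = trans (cong (∑ ys (f x) +_) (∑-swap xs ys f))
    (sym (∑-+ ys (f x) (λ y → ∑ xs (λ x → f x y))))

  ∑-cartesianProductWith : ∀ {A B C : Set} (g : A → B → C) xs ys f →
    ∑ (cartesianProductWith g xs ys) f ≡ ∑ xs (λ x → ∑ ys (λ y → f (g x y)))
  ∑-cartesianProductWith g []       ys f = refl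
  ∑-cartesianProductWith g (x ∷ xs) ys f =
    trans (∑-++ (map (g x) ys) _ f)
      (cong₂ _+_ (∑-map (g x) ys f) (∑-cartesianProductWith g xs ys f))

  ∑-∈ : ∀ {A : Set} (xs : List A) f {x} → x ∈ xs → f x ≤ ∑ xs f
  ∑-∈ (x ∷ xs) f (here refl) = m≤m+n (f x) _
  ∑-∈ (x ∷ xs) f (there x∈) = ≤-trans (∑-∈ xs f x∈) (m≤n+m _ (f x))

  𝟙 : {P : Set} → Dec P → ℕ
  𝟙 (yes _) = 1
  𝟙 (no _)  = 0

  𝟙≤1 : ∀ {P : Set} (P? : Dec P) → 𝟙 P? ≤ 1
  𝟙≤1 (yes _) = ≤-refl
  𝟙≤1 (no _)  = z≤n

  𝟙-yes : ∀ {P : Set} (P? : Dec P) → P → 𝟙 P? ≡ 1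
  𝟙-yes (yes _) p = refl
  𝟙-yes (no ¬p) p = contradiction p ¬p

  𝟙-no : ∀ {P : Set} (P? : Dec P) → ¬ P → 𝟙 P? ≡ 0
  𝟙-no (yes p) ¬p = contradiction p ¬p
  𝟙-no (no _)  ¬p = refl

  𝟙-mono : ∀ {P Q : Set} (P? : Dec P) (Q? : Dec Q) → (P → Q) → 𝟙 P? ≤ 𝟙 Q?
  𝟙-mono (yes p) Q? P⇒Q = ≤-reflexive (sym (𝟙-yes Q? (P⇒Q p)))
  𝟙-mono (no _)  Q? P⇒Q = z≤n

  𝟙-cong : ∀ {P Q : Set} (P? : Dec P) (Q? : Dec Q) → (P → Q) → (Q → P) → 𝟙 P? ≡ 𝟙 Q?
  𝟙-cong P? Q? P⇒Q Q⇒P = ≤-antisym (𝟙-mono P? Q? P⇒Q) (𝟙-mono Q? P? Q⇒P)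

  1≤𝟙 : ∀ {P : Set} (P? : Dec P) → P → 1 ≤ 𝟙 P?
  1≤𝟙 P? p = ≤-reflexive (sym (𝟙-yes P? p))

  interval : ℤ → ℕ → List ℤ
  interval b zero    = []
  interval b (suc n) = b ∷ interval (b ℤ.+ 1ℤ) n

  length-interval : ∀ b n → length (interval b n) ≡ n
  length-interval b zero    = refl
  length-interval b (suc n) = cong suc (length-interval _ n)

  suc-shift : ∀ b n → b ℤ.+ 1ℤ ℤ.+ pos n ≡ b ℤ.+ pos (suc n)
  suc-shift b n = trans (ℤ.+-assoc b 1ℤ (pos n)) refl

  interval-++ : ∀ b m n → interval b (m + n) ≡ interval b m ++ interval (b ℤ.+ pos m) n
  interval-++ b zero    n = cong (λ c → interval c n) (sym (ℤ.+-identityʳ b))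
  interval-++ b (suc m) n = cong (b ∷_)
    (trans (interval-++ (b ℤ.+ 1ℤ) m n) (cong (λ c → interval _ m ++ interval c n) (suc-shift b m)))

  ∈-interval⁻ : ∀ b n {x} → x ∈ interval b n → ∃[ j ] j < n × x ≡ b ℤ.+ pos j
  ∈-interval⁻ b (suc n) (here refl) = 0 , s≤s z≤n , sym (ℤ.+-identityʳ b)
  ∈-interval⁻ b (suc n) (there x∈) with j , j<n , refl ← ∈-interval⁻ (b ℤ.+ 1ℤ) n x∈ =
    suc j , s≤s j<n , suc-shift b j

  ∑-interval-+ : ∀ b v n f → ∑ (interval b n) (λ x → f (x ℤ.+ v)) ≡ ∑ (interval (b ℤ.+ v) n) f
  ∑-interval-+ b v zero    f = refl
  ∑-interval-+ b v (suc n) f = cong (f (b ℤ.+ v) +_) (trans (∑-interval-+ (b ℤ.+ 1ℤ) v n f)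
    (cong (λ c → ∑ (interval c n) f)
      (trans (ℤ.+-assoc b 1ℤ v) (trans (cong (λ w → b ℤ.+ w) (ℤ.+-comm 1ℤ v)) (sym (ℤ.+-assoc b v 1ℤ))))))

  ∑-interval-≤1 : ∀ b n {P : ℤ → Set} (P? : ∀ x → Dec (P x)) →
    (∀ {x y} → x ∈ interval b n → y ∈ interval b n → P x → P y → x ≡ y) →
    ∑ (interval b n) (λ x → 𝟙 (P? x)) ≤ 1
  ∑-interval-≤1 b zero    P? unique = z≤n
  ∑-interval-≤1 b (suc n) P? unique with P? b
  ... | no _   = ∑-interval-≤1 (b ℤ.+ 1ℤ) n P? (λ x∈ y∈ → unique (there x∈) (there y∈))
  ... | yes pb = ≤-reflexive (cong suc (∑-zero (interval (b ℤ.+ 1ℤ) n) λ {x} x∈ → 𝟙-no (P? x) λ px →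
    let j , _ , eq = ∈-interval⁻ _ n x∈ in
    b≢ j (trans (unique (here refl) (there x∈) pb px) (trans eq (suc-shift b j)))))
    where
    b≢ : ∀ j → b ≢ b ℤ.+ pos (suc j)
    b≢ j eq with ℤ+.∙-cancelˡ b 0ℤ (pos (suc j)) (trans (ℤ.+-identityʳ b) eq)
    ... | ()

  box : ∀ {d} → Vec ℤ d → ℕ → List (Vec ℤ d)
  box []       n = [] ∷ []
  box (b ∷ bs) n = cartesianProductWith _∷_ (interval b n) (box bs n)

  ∑-box-∷ : ∀ {d} b (bs : Vec ℤ d) n f →
    ∑ (box (b ∷ bs) n) f ≡ ∑ (interval b n) (λ x → ∑ (box bs n) (λ xs → f (x ∷ xs)))
  ∑-box-∷ b bs n f = ∑-cartesianProductWith _∷_ (interval b n) (box bs n) f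

  ∑-box-const : ∀ {d} (bs : Vec ℤ d) n c → ∑ (box bs n) (λ _ → c) ≡ n ^ d * c
  ∑-box-const []       n c = refl
  ∑-box-const {suc d} (b ∷ bs) n c = begin
    ∑ (box (b ∷ bs) n) (λ _ → c)                     ≡⟨ ∑-box-∷ b bs n _ ⟩
    ∑ (interval b n) (λ _ → ∑ (box bs n) (λ _ → c))  ≡⟨ ∑-cong (interval b n) (λ _ → ∑-box-const bs n c) ⟩
    ∑ (interval b n) (λ _ → n ^ d * c)               ≡⟨ ∑-const (interval b n) _ ⟩
    length (interval b n) * (n ^ d * c)              ≡⟨ cong (_* (n ^ d * c)) (length-interval b n) ⟩
    n * (n ^ d * c)                                  ≡⟨ *-assoc n (n ^ d) c ⟨
    n ^ suc d * c                                    ∎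
    where open ≡-Reasoning

  ∑-box-≤ : ∀ {d} (bs : Vec ℤ d) n {f} c → (∀ {x} → x ∈ box bs n → f x ≤ c) → ∑ (box bs n) f ≤ n ^ d * c
  ∑-box-≤ bs n c f≤c = ≤-trans (∑-mono-∈ (box bs n) f≤c) (≤-reflexive (∑-box-const bs n c))

  ∑-interval-mono-length : ∀ b {m n} f → m ≤ n → ∑ (interval b m) f ≤ ∑ (interval b n) f
  ∑-interval-mono-length b {m} {n} f m≤n = begin
    ∑ (interval b m) f                                         ≤⟨ m≤m+n _ _ ⟩
    ∑ (interval b m) f + ∑ (interval (b ℤ.+ pos m) (n ∸ m)) f    ≡⟨ ∑-++ (interval b m) _ f ⟨
    ∑ (interval b m ++ interval (b ℤ.+ pos m) (n ∸ m)) f         ≡⟨ cong (λ xs → ∑ xs f) (interval-++ b m (n ∸ m)) ⟨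
    ∑ (interval b (m + (n ∸ m))) f                             ≡⟨ cong (λ k → ∑ (interval b k) f) (m+[n∸m]≡n m≤n) ⟩
    ∑ (interval b n) f                                         ∎
    where open ≤-Reasoning

  ∑-box-mono-side : ∀ {d} (bs : Vec ℤ d) {m n} f → m ≤ n → ∑ (box bs m) f ≤ ∑ (box bs n) f
  ∑-box-mono-side []       f m≤n = ≤-refl
  ∑-box-mono-side (b ∷ bs) {m} {n} f m≤n = begin
    ∑ (box (b ∷ bs) m) f                                          ≡⟨ ∑-box-∷ b bs m f ⟩
    ∑ (interval b m) (λ x → ∑ (box bs m) (λ xs → f (x ∷ xs)))     ≤⟨ ∑-mono (interval b m) (λ x → ∑-box-mono-side bs _ m≤n) ⟩
    ∑ (interval b m) (λ x → ∑ (box bs n) (λ xs → f (x ∷ xs)))     ≤⟨ ∑-interval-mono-length b _ m≤n ⟩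
    ∑ (interval b n) (λ x → ∑ (box bs n) (λ xs → f (x ∷ xs)))     ≡⟨ ∑-box-∷ b bs n f ⟨
    ∑ (box (b ∷ bs) n) f                                          ∎
    where open ≤-Reasoning

  -- Fubini with coordinate `i` innermost. All estimates for primes above `n` fix the other
  -- coordinates and count on such a line.
  ∑-box-insertAt : ∀ {d} (bs : Vec ℤ (suc d)) n i f →
    ∑ (box bs n) f ≡ ∑ (box (removeAt bs i) n) (λ xs → ∑ (interval (lookup bs i) n) (λ t → f (insertAt xs i t)))
  ∑-box-insertAt (b ∷ bs) n Fin.zero f = trans (∑-box-∷ b bs n f) (∑-swap (interval b n) (box bs n) _)
  ∑-box-insertAt {suc d} (b ∷ bs@(_ ∷ _)) n (Fin.suc i) f = begin
    ∑ (box (b ∷ bs) n) f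
      ≡⟨ ∑-box-∷ b bs n f ⟩
    ∑ (interval b n) (λ x → ∑ (box bs n) (λ xs → f (x ∷ xs)))
      ≡⟨ ∑-cong (interval b n) (λ x → ∑-box-insertAt bs n i _) ⟩
    ∑ (interval b n) (λ x → ∑ (box (removeAt bs i) n) (λ xs → ∑ (interval (lookup bs i) n) (λ t → f (x ∷ insertAt xs i t))))
      ≡⟨ ∑-box-∷ b (removeAt bs i) n _ ⟨
    ∑ (box (b ∷ removeAt bs i) n) (λ xs → ∑ (interval (lookup bs i) n) (λ t → f (insertAt xs (Fin.suc i) t))) ∎
    where open ≡-Reasoning

  -- The integers q with k < q ≤ k + n.
  range : ℕ → ℕ → List ℕ
  range k zero    = []
  range k (suc n) = suc (k + n) ∷ range k n

  ∈-range⁺ : ∀ k n {q} → k < q → q ≤ k + n → q ∈ range k n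
  ∈-range⁺ k zero    k<q q≤k = contradiction (≤-trans k<q q≤k) (λ le → <⇒≱ le (≤-reflexive (+-identityʳ k)))
  ∈-range⁺ k (suc n) {q} k<q q≤ with m≤n⇒m<n∨m≡n (subst (q ≤_) (+-suc k n) q≤)
  ... | inj₁ (s≤s q≤′) = there (∈-range⁺ k n k<q q≤′)
  ... | inj₂ refl      = here refl

  ∈-range⁻ : ∀ k n {q} → q ∈ range k n → k < q × q ≤ k + n
  ∈-range⁻ k (suc n) (here refl) = s≤s (m≤m+n k n) , ≤-reflexive (sym (+-suc k n))
  ∈-range⁻ k (suc n) (there q∈) with k<q , q≤ ← ∈-range⁻ k n q∈ = k<q , ≤-trans q≤ (+-monoʳ-≤ k (n≤1+n n))

-- Linear algebra over ℤ and divisibility of vectors.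

module Vectors where

  open import Data.Integer.Base using (-_; _+_; _*_; NonZero)
  open import Data.Integer.Divisibility.Signed using (_∣_; divides; _∣?_)
  open import Data.Integer.Properties
  open import Data.Vec.Base using (map; zipWith; replicate; lookup; insertAt; removeAt)
  open import Data.Vec.Properties using (zipWith-assoc; zipWith-comm; zipWith-identityˡ; zipWith-identityʳ; lookup-map; lookup-replicate; ∷-injective)
  open import Relation.Nullary using (map′)
  open import Relation.Nullary.Decidable using (_×-dec_)

  infixl 6 _⊕_
  infixr 7 _⊙_
  infix  8 _∙_ _·_

  0ᵛ : ∀ {d} → Vec ℤ d
  0ᵛ = replicate _ 0ℤ

  _⊕_ : ∀ {d} → Vec ℤ d → Vec ℤ d → Vec ℤ d
  _⊕_ = zipWith _+_

  _⊙_ : ∀ {d} → ℤ → Vec ℤ d → Vec ℤ d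
  c ⊙ x = map (c *_) x

  _∙_ : ∀ {d} → Vec ℤ d → Vec ℤ d → ℤ
  []       ∙ []       = 0ℤ
  (x ∷ xs) ∙ (y ∷ ys) = x * y + xs ∙ ys

  _·_ : ∀ {d e} → Vec (Vec ℤ d) e → Vec ℤ d → Vec ℤ e
  M · x = map (_∙ x) M

  comb : ∀ {k d} → Vec ℤ k → Vec (Vec ℤ d) k → Vec ℤ d
  comb []       []       = 0ᵛ
  comb (c ∷ cs) (v ∷ vs) = c ⊙ v ⊕ comb cs vs

  identity : ∀ d → Vec (Vec ℤ d) d
  identity zero    = []
  identity (suc d) = (1ℤ ∷ 0ᵛ) ∷ map (0ℤ ∷_) (identity d)

  ⊕-assoc : ∀ {d} (x y z : Vec ℤ d) → x ⊕ y ⊕ z ≡ x ⊕ (y ⊕ z)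
  ⊕-assoc = zipWith-assoc +-assoc

  ⊕-comm : ∀ {d} (x y : Vec ℤ d) → x ⊕ y ≡ y ⊕ x
  ⊕-comm = zipWith-comm +-comm

  ⊕-identityˡ : ∀ {d} (x : Vec ℤ d) → 0ᵛ ⊕ x ≡ x
  ⊕-identityˡ = zipWith-identityˡ +-identityˡ

  ⊕-identityʳ : ∀ {d} (x : Vec ℤ d) → x ⊕ 0ᵛ ≡ x
  ⊕-identityʳ = zipWith-identityʳ +-identityʳ

  ⊙-distribˡ : ∀ {d} c (x y : Vec ℤ d) → c ⊙ (x ⊕ y) ≡ c ⊙ x ⊕ c ⊙ y
  ⊙-distribˡ c []       []       = refl
  ⊙-distribˡ c (x ∷ xs) (y ∷ ys) = cong₂ _∷_ (*-distribˡ-+ c x y) (⊙-distribˡ c xs ys)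

  ⊙-distribʳ : ∀ {d} c c′ (x : Vec ℤ d) → (c + c′) ⊙ x ≡ c ⊙ x ⊕ c′ ⊙ x
  ⊙-distribʳ c c′ []       = refl
  ⊙-distribʳ c c′ (x ∷ xs) = cong₂ _∷_ (*-distribʳ-+ x c c′) (⊙-distribʳ c c′ xs)

  ⊙-assoc : ∀ {d} c c′ (x : Vec ℤ d) → (c * c′) ⊙ x ≡ c ⊙ c′ ⊙ x
  ⊙-assoc c c′ []       = refl
  ⊙-assoc c c′ (x ∷ xs) = cong₂ _∷_ (*-assoc c c′ x) (⊙-assoc c c′ xs)

  ⊙-identity : ∀ {d} (x : Vec ℤ d) → 1ℤ ⊙ x ≡ x
  ⊙-identity []       = refl
  ⊙-identity (x ∷ xs) = cong₂ _∷_ (*-identityˡ x) (⊙-identity xs)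

  ⊙-zeroˡ : ∀ {d} (x : Vec ℤ d) → 0ℤ ⊙ x ≡ 0ᵛ
  ⊙-zeroˡ []       = refl
  ⊙-zeroˡ (x ∷ xs) = cong (0ℤ ∷_) (⊙-zeroˡ xs)

  ⊙-zeroʳ : ∀ {d} c → c ⊙ 0ᵛ {d} ≡ 0ᵛ
  ⊙-zeroʳ {zero}  c = refl
  ⊙-zeroʳ {suc d} c = cong₂ _∷_ (*-zeroʳ c) (⊙-zeroʳ c)

  ⊙-cancel : ∀ {d} c .{{_ : NonZero c}} (x y : Vec ℤ d) → c ⊙ x ≡ c ⊙ y → x ≡ y
  ⊙-cancel c []       []       _  = refl
  ⊙-cancel c (x ∷ xs) (y ∷ ys) eq with eq₁ , eq₂ ← ∷-injective eq =
    cong₂ _∷_ (*-cancelˡ-≡ c x y eq₁) (⊙-cancel c xs ys eq₂)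

  ⊕-inverseˡ : ∀ {d} c (x : Vec ℤ d) → (- c) ⊙ x ⊕ c ⊙ x ≡ 0ᵛ
  ⊕-inverseˡ c x = trans (sym (⊙-distribʳ (- c) c x)) (trans (cong (_⊙ x) (+-inverseˡ c)) (⊙-zeroˡ x))

  ⊕-inverseʳ : ∀ {d} c (x : Vec ℤ d) → c ⊙ x ⊕ (- c) ⊙ x ≡ 0ᵛ
  ⊕-inverseʳ c x = trans (⊕-comm _ _) (⊕-inverseˡ c x)

  ⊕-cancelʳ-⊙ : ∀ {d} c (x y : Vec ℤ d) → x ⊕ (- c) ⊙ y ⊕ c ⊙ y ≡ x
  ⊕-cancelʳ-⊙ c x y = trans (⊕-assoc x _ _) (trans (cong (x ⊕_) (⊕-inverseˡ c y)) (⊕-identityʳ x))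

  ∙-zeroʳ : ∀ {d} (r : Vec ℤ d) → r ∙ 0ᵛ ≡ 0ℤ
  ∙-zeroʳ []       = refl
  ∙-zeroʳ (r ∷ rs) = cong₂ _+_ (*-zeroʳ r) (∙-zeroʳ rs)

  ∙-comm : ∀ {d} (r x : Vec ℤ d) → r ∙ x ≡ x ∙ r
  ∙-comm []       []       = refl
  ∙-comm (r ∷ rs) (x ∷ xs) = cong₂ _+_ (*-comm r x) (∙-comm rs xs)

  ∙-⊕ʳ : ∀ {d} (r x y : Vec ℤ d) → r ∙ (x ⊕ y) ≡ r ∙ x + r ∙ y
  ∙-⊕ʳ []       []       []       = refl
  ∙-⊕ʳ (r ∷ rs) (x ∷ xs) (y ∷ ys) rewrite ∙-⊕ʳ rs xs ys = lemma r x y (rs ∙ xs) (rs ∙ ys)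
    where
    lemma : ∀ r x y u v → r * (x + y) + (u + v) ≡ r * x + u + (r * y + v)
    lemma = solve-∀

  ∙-⊙ʳ : ∀ {d} (r : Vec ℤ d) c x → r ∙ (c ⊙ x) ≡ c * (r ∙ x)
  ∙-⊙ʳ []       c []       = sym (*-zeroʳ c)
  ∙-⊙ʳ (r ∷ rs) c (x ∷ xs) rewrite ∙-⊙ʳ rs c xs = lemma r c x (rs ∙ xs)
    where
    lemma : ∀ r c x u → r * (c * x) + c * u ≡ c * (r * x + u)
    lemma = solve-∀

  ∙-zeroˡ : ∀ {d} (x : Vec ℤ d) → 0ᵛ ∙ x ≡ 0ℤ
  ∙-zeroˡ x = trans (∙-comm 0ᵛ x) (∙-zeroʳ x)

  ∙-⊕ˡ : ∀ {d} (r s x : Vec ℤ d) → (r ⊕ s) ∙ x ≡ r ∙ x + s ∙ x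
  ∙-⊕ˡ r s x = trans (∙-comm (r ⊕ s) x) (trans (∙-⊕ʳ x r s) (cong₂ _+_ (∙-comm x r) (∙-comm x s)))

  ∙-⊙ˡ : ∀ {d} c (r x : Vec ℤ d) → (c ⊙ r) ∙ x ≡ c * (r ∙ x)
  ∙-⊙ˡ c r x = trans (∙-comm (c ⊙ r) x) (trans (∙-⊙ʳ x c r) (cong (c *_) (∙-comm x r)))

  ·-⊕ : ∀ {d e} (M : Vec (Vec ℤ d) e) x y → M · (x ⊕ y) ≡ M · x ⊕ M · y
  ·-⊕ []      x y = refl
  ·-⊕ (r ∷ M) x y = cong₂ _∷_ (∙-⊕ʳ r x y) (·-⊕ M x y)

  ·-⊙ : ∀ {d e} (M : Vec (Vec ℤ d) e) c x → M · (c ⊙ x) ≡ c ⊙ (M · x)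
  ·-⊙ []      c x = refl
  ·-⊙ (r ∷ M) c x = cong₂ _∷_ (∙-⊙ʳ r c x) (·-⊙ M c x)

  ·-zero : ∀ {d e} (M : Vec (Vec ℤ d) e) → M · 0ᵛ ≡ 0ᵛ
  ·-zero []      = refl
  ·-zero (r ∷ M) = cong₂ _∷_ (∙-zeroʳ r) (·-zero M)

  comb-∙ : ∀ {d e} (r : Vec ℤ e) (M : Vec (Vec ℤ d) e) x → comb r M ∙ x ≡ r ∙ (M · x)
  comb-∙ []       []      x = ∙-zeroˡ x
  comb-∙ (c ∷ cs) (v ∷ M) x = trans (∙-⊕ˡ (c ⊙ v) (comb cs M) x) (cong₂ _+_ (∙-⊙ˡ c v x) (comb-∙ cs M x))

  -- `map (λ r → comb r M) N` is the matrix product of `N` and `M`; in this form a quotient map is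
  -- followed by a further projection.
  map-comb-· : ∀ {d e f} (N : Vec (Vec ℤ e) f) (M : Vec (Vec ℤ d) e) x → map (λ r → comb r M) N · x ≡ N · (M · x)
  map-comb-· []      M x = refl
  map-comb-· (r ∷ N) M x = cong₂ _∷_ (comb-∙ r M x) (map-comb-· N M x)

  comb-⊙ : ∀ {k d} q (c : Vec ℤ k) (S : Vec (Vec ℤ d) k) → comb (q ⊙ c) S ≡ q ⊙ comb c S
  comb-⊙ q []       []      = sym (⊙-zeroʳ q)
  comb-⊙ q (c ∷ cs) (s ∷ S) = trans (cong₂ _⊕_ (⊙-assoc q c s) (comb-⊙ q cs S))
    (sym (⊙-distribˡ q (c ⊙ s) (comb cs S)))

  comb-zero : ∀ {k d} (S : Vec (Vec ℤ d) k) → comb 0ᵛ S ≡ 0ᵛ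
  comb-zero []      = refl
  comb-zero (s ∷ S) = trans (cong₂ _⊕_ (⊙-zeroˡ s) (comb-zero S)) (⊕-identityˡ 0ᵛ)

  ⊕-interchange : ∀ {d} (w x y z : Vec ℤ d) → w ⊕ x ⊕ (y ⊕ z) ≡ w ⊕ y ⊕ (x ⊕ z)
  ⊕-interchange []       []       []       []       = refl
  ⊕-interchange (w ∷ ws) (x ∷ xs) (y ∷ ys) (z ∷ zs) = cong₂ _∷_ (lemma w x y z) (⊕-interchange ws xs ys zs)
    where
    lemma : ∀ w x y z → w + x + (y + z) ≡ w + y + (x + z)
    lemma = solve-∀

  comb-⊕ : ∀ {k d} (b c : Vec ℤ k) (S : Vec (Vec ℤ d) k) → comb (b ⊕ c) S ≡ comb b S ⊕ comb c S
  comb-⊕ []       []       []      = sym (⊕-identityˡ 0ᵛ)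
  comb-⊕ (b ∷ bs) (c ∷ cs) (s ∷ S) = trans (cong₂ _⊕_ (⊙-distribʳ b c s) (comb-⊕ bs cs S))
    (⊕-interchange (b ⊙ s) (c ⊙ s) (comb bs S) (comb cs S))

  ∙-0∷ : ∀ {d} (r : Vec ℤ d) x xs → (0ℤ ∷ r) ∙ (x ∷ xs) ≡ r ∙ xs
  ∙-0∷ r x xs = +-identityˡ (r ∙ xs)

  map-0∷-· : ∀ {d e} (M : Vec (Vec ℤ d) e) x xs → map (0ℤ ∷_) M · (x ∷ xs) ≡ M · xs
  map-0∷-· []      x xs = refl
  map-0∷-· (r ∷ M) x xs = cong₂ _∷_ (∙-0∷ r x xs) (map-0∷-· M x xs)

  identity-· : ∀ {d} (x : Vec ℤ d) → identity d · x ≡ x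
  identity-· []       = refl
  identity-· (x ∷ xs) = cong₂ _∷_
    (trans (cong₂ _+_ (*-identityˡ x) (∙-zeroˡ xs)) (+-identityʳ x))
    (trans (map-0∷-· (identity _) x xs) (identity-· xs))

  unit : ∀ {d} → Fin d → Vec ℤ d
  unit a = lookup (identity _) a

  lookup-unit-diagonal : ∀ {d} (a : Fin d) → lookup (unit a) a ≡ 1ℤ
  lookup-unit-diagonal Fin.zero    = refl
  lookup-unit-diagonal (Fin.suc a) =
    trans (cong (λ v → lookup v (Fin.suc a)) (lookup-map a (0ℤ ∷_) (identity _))) (lookup-unit-diagonal a)

  lookup-unit-off : ∀ {d} {a b : Fin d} → a ≢ b → lookup (unit a) b ≡ 0ℤ
  lookup-unit-off {a = Fin.zero}  {Fin.zero}  a≢b = contradiction refl a≢b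
  lookup-unit-off {a = Fin.zero}  {Fin.suc b} a≢b = lookup-replicate b 0ℤ
  lookup-unit-off {a = Fin.suc a} {Fin.zero}  a≢b = cong (λ v → lookup v Fin.zero) (lookup-map a (0ℤ ∷_) (identity _))
  lookup-unit-off {a = Fin.suc a} {Fin.suc b} a≢b =
    trans (cong (λ v → lookup v (Fin.suc b)) (lookup-map a (0ℤ ∷_) (identity _)))
      (lookup-unit-off (λ a≡b → a≢b (cong Fin.suc a≡b)))

  ∙-insertAt : ∀ {d} (r : Vec ℤ (suc d)) xs i t → r ∙ insertAt xs i t ≡ lookup r i * t + removeAt r i ∙ xs
  ∙-insertAt (r ∷ rs)            xs       Fin.zero    t = refl
  ∙-insertAt (r ∷ rs@(_ ∷ _)) (x ∷ xs) (Fin.suc i) t rewrite ∙-insertAt rs xs i t =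
    lemma (r * x) (lookup rs i * t) (removeAt rs i ∙ xs)
    where
    lemma : ∀ u v w → u + (v + w) ≡ v + (u + w)
    lemma = solve-∀

  infix 4 _∣ᵛ_ _∣ᵛ?_

  -- The quotient is kept as one vector, not as a family of divisibilities, because it is later
  -- lifted through the section `σ` of a quotient map.
  record _∣ᵛ_ {d} (q : ℤ) (y : Vec ℤ d) : Set where
    constructor dividesᵛ
    field
      quotient : Vec ℤ d
      equality : y ≡ q ⊙ quotient

  _∣ᵛ?_ : ∀ {d} q (y : Vec ℤ d) → Dec (q ∣ᵛ y)
  q ∣ᵛ? []       = yes (dividesᵛ [] refl)
  q ∣ᵛ? (y ∷ ys) = map′
    (λ { (divides z refl , dividesᵛ zs refl) → dividesᵛ (z ∷ zs) (cong₂ _∷_ (*-comm z q) refl) })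
    (λ { (dividesᵛ (z ∷ zs) refl) → divides z (*-comm q z) , dividesᵛ zs refl })
    ((q ∣? y) ×-dec (q ∣ᵛ? ys))

  ∣ᵛ⇒∣∙ : ∀ {d} {q} (r : Vec ℤ d) {x} → q ∣ᵛ x → q ∣ r ∙ x
  ∣ᵛ⇒∣∙ {q = q} r (dividesᵛ z refl) = divides (r ∙ z) (trans (∙-⊙ʳ r q z) (*-comm q _))

  ∣ᵛ-⊕ : ∀ {d} {q} {x y : Vec ℤ d} → q ∣ᵛ x → q ∣ᵛ y → q ∣ᵛ x ⊕ y
  ∣ᵛ-⊕ {q = q} (dividesᵛ u refl) (dividesᵛ v refl) = dividesᵛ (u ⊕ v) (sym (⊙-distribˡ q u v))

  ∣ᵛ-⊙ : ∀ {d} {q} c {x : Vec ℤ d} → q ∣ᵛ x → q ∣ᵛ c ⊙ x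
  ∣ᵛ-⊙ {q = q} c (dividesᵛ u refl) = dividesᵛ (c ⊙ u) (trans (sym (⊙-assoc c q u)) (trans (cong (_⊙ u) (*-comm c q)) (⊙-assoc q c u)))

  ∣⇒∣ᵛ⊙ : ∀ {d} {q c} (x : Vec ℤ d) → q ∣ c → q ∣ᵛ c ⊙ x
  ∣⇒∣ᵛ⊙ {q = q} x (divides a refl) = dividesᵛ (a ⊙ x) (trans (cong (_⊙ x) (*-comm a q)) (⊙-assoc q a x))

  ∣ᵛ-⊕⁻ : ∀ {d} {q} {x y : Vec ℤ d} → q ∣ᵛ x ⊕ y → q ∣ᵛ y → q ∣ᵛ x
  ∣ᵛ-⊕⁻ {q = q} {x} {y} q∣x+y q∣y = subst (q ∣ᵛ_) eq (∣ᵛ-⊕ q∣x+y (∣ᵛ-⊙ (- 1ℤ) q∣y))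
    where
    eq : x ⊕ y ⊕ (- 1ℤ) ⊙ y ≡ x
    eq = trans (⊕-assoc x y _) (trans (cong (x ⊕_) (trans (cong (_⊕ (- 1ℤ) ⊙ y) (sym (⊙-identity y))) (⊕-inverseʳ 1ℤ y))) (⊕-identityʳ x))

-- Sums of periodic functions over boxes.

module Periodic where

  open Sums
  open Vectors
  open import Data.List.Base using (_++_)
  open import Data.Nat.Base
  open import Data.Nat.Properties

  Periodic : ∀ {d} → ℕ → (Vec ℤ d → ℕ) → Set
  Periodic q f = ∀ x z → f (x ⊕ pos q ⊙ z) ≡ f x

  Periodic₁ : ℕ → (ℤ → ℕ) → Set
  Periodic₁ q f = ∀ x → f (x ℤ.+ pos q) ≡ f x

  periodic-head : ∀ {d q} {f : Vec ℤ (suc d) → ℕ} → Periodic q f → ∀ xs → Periodic₁ q (λ x → f (x ∷ xs))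
  periodic-head {q = q} {f} periodic xs x = trans
    (cong f (sym (cong₂ _∷_ (cong (λ y → x ℤ.+ y) (ℤ.*-identityʳ (pos q)))
      (trans (cong (xs ⊕_) (⊙-zeroʳ (pos q))) (⊕-identityʳ xs)))))
    (periodic (x ∷ xs) (1ℤ ∷ 0ᵛ))

  periodic-tail : ∀ {d q} {f : Vec ℤ (suc d) → ℕ} → Periodic q f → ∀ x → Periodic q (λ xs → f (x ∷ xs))
  periodic-tail {q = q} {f} periodic x xs z = trans
    (cong f (sym (cong₂ _∷_ (trans (cong (λ y → x ℤ.+ y) (ℤ.*-zeroʳ (pos q))) (ℤ.+-identityʳ x)) refl)))
    (periodic (x ∷ xs) (0ℤ ∷ z))

  -- With `f b` added, both sides sum `f` over the same `q + 1` points: the window is split once at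
  -- its left end and once at its right end, where `f` takes equal values.
  interval-suc : ∀ {q f} → Periodic₁ q f → ∀ b → ∑ (interval (b ℤ.+ 1ℤ) q) f ≡ ∑ (interval b q) f
  interval-suc {q} {f} periodic b = +-cancelˡ-≡ (f b) _ _ (begin
    f b + ∑ (interval (b ℤ.+ 1ℤ) q) f                 ≡⟨⟩
    ∑ (interval b (1 + q)) f                          ≡⟨ cong (λ k → ∑ (interval b k) f) (+-comm 1 q) ⟩
    ∑ (interval b (q + 1)) f                          ≡⟨ cong (λ xs → ∑ xs f) (interval-++ b q 1) ⟩
    ∑ (interval b q ++ interval (b ℤ.+ pos q) 1) f    ≡⟨ ∑-++ (interval b q) _ f ⟩
    ∑ (interval b q) f + (f (b ℤ.+ pos q) + 0)        ≡⟨ cong (∑ (interval b q) f +_) (trans (+-identityʳ _) (periodic b)) ⟩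
    ∑ (interval b q) f + f b                          ≡⟨ +-comm _ (f b) ⟩
    f b + ∑ (interval b q) f                          ∎)
    where open ≡-Reasoning

  interval-origin : ∀ {q f} → Periodic₁ q f → ∀ b → ∑ (interval b q) f ≡ ∑ (interval 0ℤ q) f
  interval-origin periodic (pos zero)    = refl
  interval-origin {q} {f} periodic (pos (suc n)) = trans
    (trans (cong (λ m → ∑ (interval (pos m) q) f) (+-comm 1 n)) (interval-suc periodic (pos n)))
    (interval-origin periodic (pos n))
  interval-origin periodic (ℤ.-[1+ zero ])  = sym (interval-suc periodic (ℤ.-[1+ zero ]))
  interval-origin periodic (ℤ.-[1+ suc n ]) =
    trans (sym (interval-suc periodic (ℤ.-[1+ suc n ]))) (interval-origin periodic (ℤ.-[1+ n ]))

  interval-shift : ∀ {q f} → Periodic₁ q f → ∀ b c → ∑ (interval b q) f ≡ ∑ (interval c q) f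
  interval-shift periodic b c = trans (interval-origin periodic b) (sym (interval-origin periodic c))

  box-shift : ∀ {d q} {f : Vec ℤ d → ℕ} → Periodic q f → ∀ b c → ∑ (box b q) f ≡ ∑ (box c q) f
  box-shift periodic [] [] = refl
  box-shift {q = q} {f} periodic (b ∷ bs) (c ∷ cs) = begin
    ∑ (box (b ∷ bs) q) f                                        ≡⟨ ∑-box-∷ b bs q f ⟩
    ∑ (interval b q) (λ x → ∑ (box bs q) (λ xs → f (x ∷ xs)))   ≡⟨ ∑-cong (interval b q) (λ x → box-shift (periodic-tail {q = q} periodic x) bs cs) ⟩
    ∑ (interval b q) (λ x → ∑ (box cs q) (λ xs → f (x ∷ xs)))   ≡⟨ interval-shift {q} (λ x → ∑-cong (box cs q) (λ xs → periodic-head {q = q} periodic xs x)) b c ⟩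
    ∑ (interval c q) (λ x → ∑ (box cs q) (λ xs → f (x ∷ xs)))   ≡⟨ ∑-box-∷ c cs q f ⟨
    ∑ (box (c ∷ cs) q) f                                        ∎
    where open ≡-Reasoning

  ∑-box-⊕ : ∀ {d} (b v : Vec ℤ d) n f → ∑ (box b n) (λ x → f (x ⊕ v)) ≡ ∑ (box (b ⊕ v) n) f
  ∑-box-⊕ []       []       n f = refl
  ∑-box-⊕ (b ∷ bs) (v ∷ vs) n f = begin
    ∑ (box (b ∷ bs) n) (λ x → f (x ⊕ (v ∷ vs)))                               ≡⟨ ∑-box-∷ b bs n _ ⟩
    ∑ (interval b n) (λ x → ∑ (box bs n) (λ xs → f (x ℤ.+ v ∷ xs ⊕ vs)))      ≡⟨ ∑-cong (interval b n) (λ x → ∑-box-⊕ bs vs n _) ⟩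
    ∑ (interval b n) (λ x → ∑ (box (bs ⊕ vs) n) (λ xs → f (x ℤ.+ v ∷ xs)))    ≡⟨ ∑-interval-+ b v n _ ⟩
    ∑ (interval (b ℤ.+ v) n) (λ x → ∑ (box (bs ⊕ vs) n) (λ xs → f (x ∷ xs)))  ≡⟨ ∑-box-∷ (b ℤ.+ v) (bs ⊕ vs) n f ⟨
    ∑ (box ((b ∷ bs) ⊕ (v ∷ vs)) n) f                                         ∎
    where open ≡-Reasoning

  box-translate : ∀ {d q} {f : Vec ℤ d → ℕ} → Periodic q f → ∀ b v → ∑ (box b q) (λ x → f (x ⊕ v)) ≡ ∑ (box b q) f
  box-translate {f = f} periodic b v = trans (∑-box-⊕ b v _ f) (box-shift periodic (b ⊕ v) b)

  interval-tile : ∀ {q f} → Periodic₁ q f → ∀ b t → ∑ (interval b (t * q)) f ≡ t * ∑ (interval b q) f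
  interval-tile periodic b zero = refl
  interval-tile {q} {f} periodic b (suc t) = begin
    ∑ (interval b (q + t * q)) f                                  ≡⟨ cong (λ xs → ∑ xs f) (interval-++ b q (t * q)) ⟩
    ∑ (interval b q ++ interval (b ℤ.+ pos q) (t * q)) f          ≡⟨ ∑-++ (interval b q) _ f ⟩
    ∑ (interval b q) f + ∑ (interval (b ℤ.+ pos q) (t * q)) f     ≡⟨ cong (∑ (interval b q) f +_) (interval-tile periodic _ t) ⟩
    ∑ (interval b q) f + t * ∑ (interval (b ℤ.+ pos q) q) f       ≡⟨ cong (λ s → ∑ (interval b q) f + t * s) (interval-shift periodic _ b) ⟩
    suc t * ∑ (interval b q) f                                    ∎
    where open ≡-Reasoning

  box-tile : ∀ {d q} {f : Vec ℤ d → ℕ} → Periodic q f → ∀ b t → ∑ (box b (t * q)) f ≡ t ^ d * ∑ (box b q) f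
  box-tile periodic [] t = sym (+-identityʳ _)
  box-tile {suc d} {q} {f} periodic (b ∷ bs) t = begin
    ∑ (box (b ∷ bs) (t * q)) f
      ≡⟨ ∑-box-∷ b bs (t * q) f ⟩
    ∑ (interval b (t * q)) (λ x → ∑ (box bs (t * q)) (λ xs → f (x ∷ xs)))
      ≡⟨ ∑-cong (interval b (t * q)) (λ x → box-tile (periodic-tail {q = q} periodic x) bs t) ⟩
    ∑ (interval b (t * q)) (λ x → t ^ d * ∑ (box bs q) (λ xs → f (x ∷ xs)))
      ≡⟨ ∑-*ˡ (interval b (t * q)) (t ^ d) _ ⟩
    t ^ d * ∑ (interval b (t * q)) (λ x → ∑ (box bs q) (λ xs → f (x ∷ xs)))
      ≡⟨ cong (t ^ d *_) (interval-tile {q} (λ x → ∑-cong (box bs q) (λ xs → periodic-head {q = q} periodic xs x)) b t) ⟩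
    t ^ d * (t * ∑ (interval b q) (λ x → ∑ (box bs q) (λ xs → f (x ∷ xs))))
      ≡⟨ *-assoc (t ^ d) t _ ⟨
    t ^ d * t * ∑ (interval b q) (λ x → ∑ (box bs q) (λ xs → f (x ∷ xs)))
      ≡⟨ cong₂ _*_ (*-comm (t ^ d) t) (sym (∑-box-∷ b bs q f)) ⟩
    t ^ suc d * ∑ (box (b ∷ bs) q) f ∎
    where open ≡-Reasoning

  periodic-pullback : ∀ {d e q} {f : Vec ℤ e → ℕ} (M : Vec (Vec ℤ d) e) → Periodic q f → Periodic q (f ∘ (M ·_))
  periodic-pullback {q = q} {f} M periodic x z = trans
    (cong f (trans (·-⊕ M x _) (cong (M · x ⊕_) (·-⊙ M (pos q) z)))) (periodic (M · x) (M · z))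

  -- Both sides count the double sum of f (M · x ⊕ y), since adding M · x permutes the residues y
  -- and, thanks to the section, adding y amounts to translating x.
  equidistribution : ∀ {d e q} {f : Vec ℤ e → ℕ} (M : Vec (Vec ℤ d) e) (σ : Vec ℤ e → Vec ℤ d) →
    (∀ y → M · σ y ≡ y) → Periodic q f → ∀ b c →
    q ^ e * ∑ (box b q) (λ x → f (M · x)) ≡ q ^ d * ∑ (box c q) f
  equidistribution {d} {e} {q} {f} M σ section periodic b c = begin
    q ^ e * ∑ (box b q) (f ∘ (M ·_))                             ≡⟨ ∑-box-const c q _ ⟨
    ∑ (box c q) (λ y → ∑ (box b q) (f ∘ (M ·_)))                 ≡⟨ ∑-cong (box c q) (λ y → sym (box-translate {q = q} (periodic-pullback {q = q} {f} M periodic) b (σ y))) ⟩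
    ∑ (box c q) (λ y → ∑ (box b q) (λ x → f (M · (x ⊕ σ y))))    ≡⟨ ∑-cong (box c q) (λ y → ∑-cong (box b q) (λ x → cong f (lift x y))) ⟩
    ∑ (box c q) (λ y → ∑ (box b q) (λ x → f (y ⊕ M · x)))        ≡⟨ ∑-swap (box c q) (box b q) _ ⟩
    ∑ (box b q) (λ x → ∑ (box c q) (λ y → f (y ⊕ M · x)))        ≡⟨ ∑-cong (box b q) (λ x → box-translate periodic c (M · x)) ⟩
    ∑ (box b q) (λ x → ∑ (box c q) f)                            ≡⟨ ∑-box-const b q _ ⟩
    q ^ d * ∑ (box c q) f                                        ∎
    where
    open ≡-Reasoning
    lift : ∀ x y → M · (x ⊕ σ y) ≡ y ⊕ M · x
    lift x y = trans (·-⊕ M x (σ y)) (trans (cong (M · x ⊕_) (section y)) (⊕-comm (M · x) y))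

  -- The interval starts at a multiple of `q`, so in every block of length `q` only the first point
  -- is a multiple, and `f` vanishes at the others.
  interval-multiples : ∀ q .{{_ : NonZero q}} f → (∀ x → ¬ pos q ℤ.∣ x → f x ≡ 0) → ∀ b n →
    ∑ (interval (pos q ℤ.* b) (n * q)) f ≡ ∑ (interval b n) (λ x → f (pos q ℤ.* x))
  interval-multiples q f vanish b zero = refl
  interval-multiples q@(suc q′) f vanish b (suc n) = begin
    ∑ (interval (pos q ℤ.* b) (q + n * q)) f
      ≡⟨ cong (λ xs → ∑ xs f) (interval-++ (pos q ℤ.* b) q (n * q)) ⟩
    ∑ (interval (pos q ℤ.* b) q ++ interval (pos q ℤ.* b ℤ.+ pos q) (n * q)) f
      ≡⟨ ∑-++ (interval (pos q ℤ.* b) q) _ f ⟩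
    ∑ (interval (pos q ℤ.* b) q) f + ∑ (interval (pos q ℤ.* b ℤ.+ pos q) (n * q)) f
      ≡⟨ cong₂ (λ u c → u + ∑ (interval c (n * q)) f) first (step (pos q) b) ⟩
    f (pos q ℤ.* b) + ∑ (interval (pos q ℤ.* (b ℤ.+ 1ℤ)) (n * q)) f
      ≡⟨ cong (f (pos q ℤ.* b) +_) (interval-multiples q f vanish (b ℤ.+ 1ℤ) n) ⟩
    ∑ (interval b (suc n)) (λ x → f (pos q ℤ.* x)) ∎
    where
    open ≡-Reasoning
    step : ∀ q b → q ℤ.* b ℤ.+ q ≡ q ℤ.* (b ℤ.+ 1ℤ)
    step = solve-∀
    first : ∑ (interval (pos q ℤ.* b) q) f ≡ f (pos q ℤ.* b)
    first = trans (cong (f (pos q ℤ.* b) +_) (∑-zero (interval (pos q ℤ.* b ℤ.+ 1ℤ) q′) λ x∈ → vanish _ (not-multiple x∈)))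
      (+-identityʳ _)
      where
      not-multiple : ∀ {x} → x ∈ interval (pos q ℤ.* b ℤ.+ 1ℤ) q′ → ¬ pos q ℤ.∣ x
      not-multiple x∈ q∣x with j , j<q′ , refl ← ∈-interval⁻ (pos q ℤ.* b ℤ.+ 1ℤ) q′ x∈ =
        <⇒≱ (s≤s j<q′) (ℕ.∣⇒≤ (ℤ.∣⇒∣ᵤ (ℤ.∣m+n∣m⇒∣n {m = pos q ℤ.* b}
          (subst (pos q ℤ.∣_) (suc-shift (pos q ℤ.* b) j) q∣x) (ℤ.∣m⇒∣m*n b ℤ.∣-refl))))

  box-multiples : ∀ {d} q .{{_ : NonZero q}} (f : Vec ℤ d → ℕ) → (∀ x → ¬ pos q ∣ᵛ x → f x ≡ 0) → ∀ b n →
    ∑ (box (pos q ⊙ b) (n * q)) f ≡ ∑ (box b n) (λ x → f (pos q ⊙ x))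
  box-multiples q f vanish [] n = refl
  box-multiples q f vanish (b ∷ bs) n = begin
    ∑ (box (pos q ⊙ (b ∷ bs)) (n * q)) f
      ≡⟨ ∑-box-∷ (pos q ℤ.* b) (pos q ⊙ bs) (n * q) f ⟩
    ∑ (interval (pos q ℤ.* b) (n * q)) (λ x → ∑ (box (pos q ⊙ bs) (n * q)) (λ xs → f (x ∷ xs)))
      ≡⟨ interval-multiples q _ (λ x q∤x → ∑-zero (box (pos q ⊙ bs) (n * q)) (λ {xs} _ → vanish (x ∷ xs) (q∤x ∘ head))) b n ⟩
    ∑ (interval b n) (λ x → ∑ (box (pos q ⊙ bs) (n * q)) (λ xs → f (pos q ℤ.* x ∷ xs)))
      ≡⟨ ∑-cong (interval b n) (λ x → box-multiples q _ (λ xs q∤xs → vanish _ (q∤xs ∘ tail)) bs n) ⟩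
    ∑ (interval b n) (λ x → ∑ (box bs n) (λ xs → f (pos q ℤ.* x ∷ pos q ⊙ xs)))
      ≡⟨ ∑-box-∷ b bs n _ ⟨
    ∑ (box (b ∷ bs) n) (λ x → f (pos q ⊙ x)) ∎
    where
    open ≡-Reasoning
    head : ∀ {d x} {xs : Vec ℤ d} → pos q ∣ᵛ x ∷ xs → pos q ℤ.∣ x
    head (dividesᵛ (z ∷ zs) refl) = ℤ.divides z (ℤ.*-comm (pos q) z)
    tail : ∀ {d x} {xs : Vec ℤ d} → pos q ∣ᵛ x ∷ xs → pos q ∣ᵛ xs
    tail (dividesᵛ (z ∷ zs) refl) = dividesᵛ zs refl

-- Embedding of the integers into ℚ, and rational null sequences.

module Rationals where

  open import Defs using (toℚᵘ-/; Eventually; half-pos; half+half; scaled; scaled-pos; scaled-bound; ζ-term; ζ-partial)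
  open import Data.Rational.Base using (_+_; _*_; _≤_; _<_; ∣_∣; _/_; toℚᵘ; positive; nonNegative; NonZero; ≢-nonZero)
  open import Data.Rational.Properties
  import Data.Rational.Unnormalised.Base as ℚᵘ
  import Data.Rational.Unnormalised.Properties as ℚᵘ

  ι : ℤ → ℚ
  ι i = i / 1

  private
    toℚᵘ-ι : ∀ i → toℚᵘ (ι i) ℚᵘ.≃ ℚᵘ.mkℚᵘ i 0
    toℚᵘ-ι i = toℚᵘ-/ i 1

  ι-+ : ∀ i j → ι (i ℤ.+ j) ≡ ι i + ι j
  ι-+ i j = toℚᵘ-injective (ℚᵘ.≃-trans (toℚᵘ-ι (i ℤ.+ j)) (ℚᵘ.≃-trans (ℚᵘ.*≡* eq)
    (ℚᵘ.≃-sym (ℚᵘ.≃-trans (toℚᵘ-homo-+ (ι i) (ι j)) (ℚᵘ.+-cong (toℚᵘ-ι i) (toℚᵘ-ι j))))))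
    where
    eq : (i ℤ.+ j) ℤ.* 1ℤ ≡ (i ℤ.* 1ℤ ℤ.+ j ℤ.* 1ℤ) ℤ.* 1ℤ
    eq = cong (ℤ._* 1ℤ) (sym (cong₂ ℤ._+_ (ℤ.*-identityʳ i) (ℤ.*-identityʳ j)))

  ι-* : ∀ i j → ι (i ℤ.* j) ≡ ι i * ι j
  ι-* i j = toℚᵘ-injective (ℚᵘ.≃-trans (toℚᵘ-ι (i ℤ.* j)) (ℚᵘ.≃-trans (ℚᵘ.*≡* refl)
    (ℚᵘ.≃-sym (ℚᵘ.≃-trans (toℚᵘ-homo-* (ι i) (ι j)) (ℚᵘ.*-cong (toℚᵘ-ι i) (toℚᵘ-ι j))))))

  ι-mono-≤ : ∀ {i j} → i ℤ.≤ j → ι i ≤ ι j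
  ι-mono-≤ {i} {j} i≤j = toℚᵘ-cancel-≤ (begin
    toℚᵘ (ι i)     ≃⟨ toℚᵘ-ι i ⟩
    ℚᵘ.mkℚᵘ i 0    ≤⟨ ℚᵘ.*≤* (subst₂ ℤ._≤_ (sym (ℤ.*-identityʳ i)) (sym (ℤ.*-identityʳ j)) i≤j) ⟩
    ℚᵘ.mkℚᵘ j 0    ≃⟨ ℚᵘ.≃-sym (toℚᵘ-ι j) ⟩
    toℚᵘ (ι j)     ∎)
    where open ℚᵘ.≤-Reasoning

  ι-cancel-≤ : ∀ {i j} → ι i ≤ ι j → i ℤ.≤ j
  ι-cancel-≤ {i} {j} ιi≤ιj with ℚᵘ.≤-trans (ℚᵘ.≤-respˡ-≃ (toℚᵘ-ι i) (toℚᵘ-mono-≤ ιi≤ιj)) (ℚᵘ.≤-reflexive (toℚᵘ-ι j))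
  ... | ℚᵘ.*≤* le = subst₂ ℤ._≤_ (ℤ.*-identityʳ i) (ℤ.*-identityʳ j) le

  ι-injective : ∀ {i j} → ι i ≡ ι j → i ≡ j
  ι-injective eq = ℤ.≤-antisym (ι-cancel-≤ (≤-reflexive eq)) (ι-cancel-≤ (≤-reflexive (sym eq)))

  ι≢0 : ∀ q .{{_ : ℤ.NonZero q}} → NonZero (ι q)
  ι≢0 q = ≢-nonZero (λ eq → ℕ.≢-nonZero⁻¹ (ℤ.∣ q ∣) (cong (ℤ.∣_∣) (ι-injective {q} {0ℤ} eq)))

  -- Opaque, so that `ιₙ n` remains an atom in rational identities and does not unfold to a
  -- normalised fraction; the lemmas of this block are its whole interface.
  opaque
    ιₙ : ℕ → ℚ
    ιₙ n = ι (pos n)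

    ιₙ≡ι : ∀ n → ιₙ n ≡ ι (pos n)
    ιₙ≡ι n = refl

    ιₙ-cancel-≤ : ∀ {m n} → ιₙ m ≤ ιₙ n → m ℕ.≤ n
    ιₙ-cancel-≤ le = ℤ.drop‿+≤+ (ι-cancel-≤ le)

    ιₙ-zero : ιₙ 0 ≡ 0ℚ
    ιₙ-zero = refl

    ιₙ-one : ιₙ 1 ≡ 1ℚ
    ιₙ-one = refl

    ιₙ-+ : ∀ m n → ιₙ (m ℕ.+ n) ≡ ιₙ m + ιₙ n
    ιₙ-+ m n = ι-+ (pos m) (pos n)

    ιₙ-* : ∀ m n → ιₙ (m ℕ.* n) ≡ ιₙ m * ιₙ n
    ιₙ-* m n = trans (cong ι (ℤ.pos-* m n)) (ι-* (pos m) (pos n))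

    ιₙ-mono-≤ : ∀ {m n} → m ℕ.≤ n → ιₙ m ≤ ιₙ n
    ιₙ-mono-≤ m≤n = ι-mono-≤ (ℤ.+≤+ m≤n)

    0≤ιₙ : ∀ n → 0ℚ ≤ ιₙ n
    0≤ιₙ n = ιₙ-mono-≤ {0} {n} ℕ.z≤n

    1/n*n≡1 : ∀ n .{{_ : ℕ.NonZero n}} → (1ℤ / n) * ιₙ n ≡ 1ℚ
    1/n*n≡1 n@(suc m) = toℚᵘ-injective (ℚᵘ.≃-trans (toℚᵘ-homo-* (1ℤ / n) (ιₙ n))
      (ℚᵘ.≃-trans (ℚᵘ.*-cong (toℚᵘ-/ 1ℤ n) (toℚᵘ-ι (pos n)))
        (ℚᵘ.*≡* (cong pos (trans (cong (ℕ._* 1) (ℕ.*-identityˡ n)) (trans (ℕ.*-identityʳ n) (sym (trans (cong (λ k → suc k ℕ.+ 0) (ℕ.*-identityʳ m)) (ℕ.+-identityʳ n)))))))))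

    0<ιₙ : ∀ n .{{_ : ℕ.NonZero n}} → 0ℚ < ιₙ n
    0<ιₙ n = positive⁻¹ (ιₙ n) {{normalize-pos n 1}}

  -- Counting yields exact equations `q ^ e * y ≡ x` in ℕ. This reads them as `y = x / q^e`, which
  -- is how terms of ζ arise from counts.
  ζ-term-* : ∀ e q .{{_ : ℕ.NonZero q}} {x y} → q ℕ.^ e ℕ.* y ≡ x → ζ-term e q * ιₙ x ≡ ιₙ y
  ζ-term-* e q {x} {y} refl = begin
    ζ-term e q * ιₙ (q ℕ.^ e ℕ.* y)             ≡⟨ cong (ζ-term e q *_) (ιₙ-* (q ℕ.^ e) y) ⟩
    ζ-term e q * (ιₙ (q ℕ.^ e) * ιₙ y)          ≡⟨ *-assoc (ζ-term e q) _ _ ⟨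
    ζ-term e q * ιₙ (q ℕ.^ e) * ιₙ y            ≡⟨ cong (_* ιₙ y) (1/n*n≡1 (q ℕ.^ e) {{ℕ.m^n≢0 q e}}) ⟩
    1ℚ * ιₙ y                                   ≡⟨ *-identityˡ _ ⟩
    ιₙ y                                        ∎
    where open ≡-Reasoning

  ζ-partial-one : ∀ e → ζ-partial e 1 ≡ 1ℚ
  ζ-partial-one e = begin
    0ℚ + ζ-term e 1      ≡⟨ +-identityˡ (ζ-term e 1) ⟩
    ζ-term e 1           ≡⟨ *-identityʳ (ζ-term e 1) ⟨
    ζ-term e 1 * 1ℚ      ≡⟨ cong (ζ-term e 1 *_) ιₙ-one ⟨
    ζ-term e 1 * ιₙ 1    ≡⟨ ζ-term-* e 1 (trans (ℕ.*-identityʳ (1 ℕ.^ e)) (ℕ.^-zeroˡ e)) ⟩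
    ιₙ 1                 ≡⟨ ιₙ-one ⟩
    1ℚ                   ∎
    where open ≡-Reasoning

  0≤1/ : ∀ n .{{_ : ℕ.NonZero n}} → 0ℚ ≤ 1ℤ / n
  0≤1/ n = <⇒≤ (positive⁻¹ (1ℤ / n) {{normalize-pos 1 n}})

  *-monoˡ-0≤ : ∀ {c x y} → 0ℚ ≤ c → x ≤ y → c * x ≤ c * y
  *-monoˡ-0≤ {c} 0≤c = *-monoˡ-≤-nonNeg c {{nonNegative 0≤c}}

  *-monoʳ-0≤ : ∀ {c x y} → 0ℚ ≤ c → x ≤ y → x * c ≤ y * c
  *-monoʳ-0≤ {c} 0≤c = *-monoʳ-≤-nonNeg c {{nonNegative 0≤c}}

  0≤* : ∀ {x y} → 0ℚ ≤ x → 0ℚ ≤ y → 0ℚ ≤ x * y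
  0≤* {x} {y} 0≤x 0≤y = subst (_≤ x * y) (*-zeroʳ x) (*-monoˡ-0≤ 0≤x 0≤y)

  *-monoˡ-ι : ∀ n {x y} → x ≤ y → ιₙ n * x ≤ ιₙ n * y
  *-monoˡ-ι n = *-monoˡ-0≤ (0≤ιₙ n)

  *-monoʳ-ι : ∀ n {x y} → x ≤ y → x * ιₙ n ≤ y * ιₙ n
  *-monoʳ-ι n = *-monoʳ-0≤ (0≤ιₙ n)

  *-cancelˡ-ι : ∀ n .{{_ : ℕ.NonZero n}} {x y} → ιₙ n * x ≤ ιₙ n * y → x ≤ y
  *-cancelˡ-ι n = *-cancelˡ-≤-pos (ιₙ n) {{positive (0<ιₙ n)}}

  -- Equality of reals unfolds to nullity of a difference. Wrapping it in a record lets the sequence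
  -- be inferred from the type.
  record Null (x : ℕ → ℚ) : Set where
    constructor mkNull
    field
      close : ∀ ε → 0ℚ < ε → Eventually λ n → ∣ x n ∣ < ε

  open Null public

  null-cong : ∀ {x y} → (∀ n → x n ≡ y n) → Null x → Null y
  null-cong x≗y x-null = mkNull λ ε 0<ε → let N , small = close x-null ε 0<ε in
    N , λ n N≤n → subst (λ p → ∣ p ∣ < ε) (x≗y n) (small n N≤n)

  null-+ : ∀ {x y} → Null x → Null y → Null (λ n → x n + y n)
  null-+ {x} {y} x-null y-null = mkNull λ ε 0<ε →
    let M , x-small = close x-null (ε * ½) (half-pos 0<ε)
        N , y-small = close y-null (ε * ½) (half-pos 0<ε) in
    M ℕ.⊔ N , λ n le → ≤-<-trans (∣p+q∣≤∣p∣+∣q∣ (x n) (y n)) (subst (∣ x n ∣ + ∣ y n ∣ <_) (half+half ε)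
      (+-mono-< (x-small n (ℕ.m⊔n≤o⇒m≤o M N le)) (y-small n (ℕ.m⊔n≤o⇒n≤o M N le))))

  null-*ˡ : ∀ c {x} → Null x → Null (λ n → c * x n)
  null-*ˡ c {x} x-null = mkNull λ ε 0<ε → let N , small = close x-null (scaled B 0<B ε) (scaled-pos 0<B 0<ε) in
    N , λ n N≤n → <-trans (scaled-bound 0<B {ε} {c} {x n} ∣c∣≤B (small n N≤n)) (half< 0<ε)
    where
    -- The summand `1ℚ` keeps `B` positive when `c` is zero.
    B = 1ℚ + ∣ c ∣
    0<B : 0ℚ < B
    0<B = <-≤-trans (positive⁻¹ 1ℚ) (subst (_≤ B) (+-identityʳ 1ℚ) (+-monoʳ-≤ 1ℚ (0≤∣p∣ c)))
    ∣c∣≤B : ∣ c ∣ ≤ B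
    ∣c∣≤B = subst (_≤ B) (+-identityˡ ∣ c ∣) (+-monoˡ-≤ ∣ c ∣ (<⇒≤ (positive⁻¹ 1ℚ)))
    half< : ∀ {ε} → 0ℚ < ε → ε * ½ < ε
    half< {ε} 0<ε = subst₂ _<_ (+-identityʳ (ε * ½)) (half+half ε) (+-monoʳ-< (ε * ½) (half-pos 0<ε))

  null-zero : Null (λ _ → 0ℚ)
  null-zero = mkNull λ ε 0<ε → 0 , λ _ _ → 0<ε

  null-const : ∀ {p} → Null (λ _ → p) → p ≡ 0ℚ
  null-const {p} p-null with p ≟ 0ℚ
  ... | yes p≡0 = p≡0
  ... | no p≢0 with N , small ← close p-null ∣ p ∣ (positive⁻¹ ∣ p ∣ {{nonNeg∧nonZero⇒pos ∣ p ∣ {{∣-∣-nonNeg p}} {{≢-nonZero (λ eq → p≢0 (∣p∣≡0⇒p≡0 p eq))}}}}) =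
    contradiction (small N ℕ.≤-refl) (<-irrefl refl)

-- Unimodular reduction of a vector, free quotients of ℤᵈ, and saturation.

module Quotients where

  open Vectors
  open import Data.Integer.Base using (-_; _+_; _*_; NonZero; ≢-nonZero; -[1+_])
  open import Data.Integer.Divisibility.Signed using (divides; ∣⇒∣ᵤ)
  open import Data.Integer.Properties
  open import Data.Nat.GCD using (GCD; module Bézout)
  open import Data.Vec.Base using (map)
  open import Data.Vec.Properties using (∷-injective)
  open import Data.Vec.Relation.Unary.All as All using (All; []; _∷_)

  -- The Bézout identity is stated for the cofactors, after division by the gcd, so that it keeps
  -- its content when `a` and `b` both vanish: the matrix with rows `(u, v)` and `(- b/g, a/g)`
  -- always has determinant 1.
  record Coefficients (a b : ℤ) : Set where
    field
      gcd a/g b/g u v : ℤ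
      a≡ : a ≡ a/g * gcd
      b≡ : b ≡ b/g * gcd
      identity≡ : u * a/g + v * b/g ≡ 1ℤ

  sign-abs : ∀ a → ∃[ ε ] a ≡ ε * pos (abs a) × ε * ε ≡ 1ℤ
  sign-abs (pos n)  = 1ℤ , sym (*-identityˡ _) , refl
  sign-abs -[1+ n ] = - 1ℤ , sym (-1*i≡-i (pos (suc n))) , refl

  bézout : ∀ a b → Coefficients a b
  bézout a b with Bézout.lemma (abs a) (abs b)
  ... | Bézout.result zero (GCD.is (0∣a , 0∣b) _) _ = record
    { gcd = 0ℤ ; a/g = 1ℤ ; b/g = 0ℤ ; u = 1ℤ ; v = 0ℤ
    ; a≡ = ∣i∣≡0⇒i≡0 (ℕ.0∣⇒≡0 0∣a) ; b≡ = ∣i∣≡0⇒i≡0 (ℕ.0∣⇒≡0 0∣b) ; identity≡ = refl }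
  ... | Bézout.result g@(suc _) (GCD.is (ℕ.divides a₀ a₀≡ , ℕ.divides b₀ b₀≡) _) id
    with ε , εa≡ , εε≡1 ← sign-abs a | δ , δb≡ , δδ≡1 ← sign-abs b = record
    { gcd = pos g ; a/g = ε * pos a₀ ; b/g = δ * pos b₀ ; u = ε * proj₁ w ; v = δ * proj₁ (proj₂ w)
    ; a≡ = trans εa≡ (trans (cong (ε *_) (trans (cong pos a₀≡) (pos-* a₀ g))) (sym (*-assoc ε (pos a₀) (pos g))))
    ; b≡ = trans δb≡ (trans (cong (δ *_) (trans (cong pos b₀≡) (pos-* b₀ g))) (sym (*-assoc δ (pos b₀) (pos g))))
    ; identity≡ = trans (regroup ε δ (proj₁ w) (proj₁ (proj₂ w)) (pos a₀) (pos b₀))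
        (trans (cong₂ (λ s t → s * (proj₁ w * pos a₀) + t * (proj₁ (proj₂ w) * pos b₀)) εε≡1 δδ≡1)
          (trans (cong₂ _+_ (*-identityˡ (proj₁ w * pos a₀)) (*-identityˡ (proj₁ (proj₂ w) * pos b₀))) (proj₂ (proj₂ w))))
    }
    where
    regroup : ∀ ε δ x y a b → ε * x * (ε * a) + δ * y * (δ * b) ≡ ε * ε * (x * a) + δ * δ * (y * b)
    regroup = solve-∀
    cancel : ∀ {x y m n} → m ≡ x ℕ.* g → n ≡ y ℕ.* g → ∀ s t → g ℕ.+ t ℕ.* n ≡ s ℕ.* m → pos s * pos x + - pos t * pos y ≡ 1ℤ
    cancel {x} {y} refl refl s t eq = begin
      pos s * pos x + - pos t * pos y             ≡⟨ cong₂ _+_ (sym (pos-* s x)) (trans (sym (neg-distribˡ-* (pos t) (pos y))) (cong -_ (sym (pos-* t y)))) ⟩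
      pos (s ℕ.* x) + - pos (t ℕ.* y)             ≡⟨ cong (λ n → pos n + - pos (t ℕ.* y)) sx≡ ⟨
      1ℤ + pos (t ℕ.* y) + - pos (t ℕ.* y)        ≡⟨ +-assoc 1ℤ (pos (t ℕ.* y)) (- pos (t ℕ.* y)) ⟩
      1ℤ + (pos (t ℕ.* y) + - pos (t ℕ.* y))      ≡⟨ cong (1ℤ +_) (+-inverseʳ (pos (t ℕ.* y))) ⟩
      1ℤ                                          ∎
      where
      open ≡-Reasoning
      sx≡ : suc (t ℕ.* y) ≡ s ℕ.* x
      sx≡ = ℕ.*-cancelʳ-≡ _ _ g (trans (cong (g ℕ.+_) (ℕ.*-assoc t y g)) (trans eq (sym (ℕ.*-assoc s x g))))
    coefficients : Bézout.Identity.Identity g (abs a) (abs b) → ∃[ x ] ∃[ y ] x * pos a₀ + y * pos b₀ ≡ 1ℤ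
    coefficients (Bézout.Identity.+- s t eq) = pos s , - pos t , cancel a₀≡ b₀≡ s t eq
    coefficients (Bézout.Identity.-+ s t eq) = - pos s , pos t , trans (+-comm (- pos s * pos a₀) _) (cancel b₀≡ a₀≡ t s eq)
    w = coefficients id

  -- An automorphism (β, π) of ℤ^(e+1), with inverse τ, mapping y to a multiple of the first unit vector.
  record Reduction {e} (y : Vec ℤ (suc e)) : Set where
    field
      gcd : ℤ
      β   : Vec ℤ (suc e)
      π   : Vec (Vec ℤ (suc e)) e
      τ   : ℤ → Vec ℤ e → Vec ℤ (suc e)
      β-τ : ∀ a z → β ∙ τ a z ≡ a
      π-τ : ∀ a z → π · τ a z ≡ z
      τ-βπ : ∀ x → τ (β ∙ x) (π · x) ≡ x
      β-y : β ∙ y ≡ gcd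
      π-y : π · y ≡ 0ᵛ

  -- The tail is reduced first. The Bézout matrix with rows `(u, v)` and `(- b′, a′)` then acts on
  -- the head and on the coordinate `R.β` of the tail; its inverse, with rows `(a′, - v)` and
  -- `(b′, u)`, gives `τ`. In one dimension the gcd is the coordinate itself, sign included, which
  -- is why later statements use `abs` or the square of `gcd`.
  reduce : ∀ {e} (y : Vec ℤ (suc e)) → Reduction y
  reduce (a ∷ []) = record
    { gcd = a ; β = 1ℤ ∷ [] ; π = [] ; τ = λ a _ → a ∷ []
    ; β-τ = λ a _ → trans (+-identityʳ _) (*-identityˡ a)
    ; π-τ = λ { _ [] → refl }
    ; τ-βπ = λ { (x ∷ []) → cong (_∷ []) (trans (+-identityʳ _) (*-identityˡ x)) }
    ; β-y = trans (+-identityʳ _) (*-identityˡ a) ; π-y = refl }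
  reduce (a ∷ y@(_ ∷ _)) = record
    { gcd = g
    ; β = u ∷ v ⊙ R.β
    ; π = (- b′ ∷ a′ ⊙ R.β) ∷ map (0ℤ ∷_) R.π
    ; τ = λ { p (q ∷ ws) → a′ * p + - (v * q) ∷ R.τ (b′ * p + u * q) ws }
    ; β-τ = λ { p (q ∷ ws) → trans (cong (u * (a′ * p + - (v * q)) +_) (β-τ′ v _ ws)) (trans (expand₁ u v a′ b′ p q) (unit-* p)) }
    ; π-τ = λ { p (q ∷ ws) → cong₂ _∷_
        (trans (cong (- b′ * (a′ * p + - (v * q)) +_) (β-τ′ a′ _ ws)) (trans (expand₂ u v a′ b′ p q) (unit-* q)))
        (trans (map-0∷-· R.π _ _) (R.π-τ _ ws)) }
    ; τ-βπ = λ { (x ∷ xs) → trans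
        (cong₂ (λ s t → a′ * (u * x + s) + - (v * (- b′ * x + t)) ∷ R.τ (b′ * (u * x + s) + u * (- b′ * x + t)) (map (0ℤ ∷_) R.π · (x ∷ xs)))
          (∙-⊙ˡ v R.β xs) (∙-⊙ˡ a′ R.β xs))
        (cong₂ _∷_ (trans (expand₃ u v a′ b′ x (R.β ∙ xs)) (unit-* x))
          (trans (cong₂ R.τ (trans (expand₄ u v a′ b′ x (R.β ∙ xs)) (unit-* (R.β ∙ xs))) (map-0∷-· R.π x xs)) (R.τ-βπ xs))) }
    ; β-y = trans (cong₂ (λ s t → u * s + t) a≡ (trans (∙-⊙ˡ v R.β y) (cong (v *_) (trans R.β-y b≡))))
        (trans (expand₅ u v a′ b′ g) (unit-* g))
    ; π-y = cong₂ _∷_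
        (trans (cong₂ (λ s t → - b′ * s + t) a≡ (trans (∙-⊙ˡ a′ R.β y) (cong (a′ *_) (trans R.β-y b≡)))) (expand₆ a′ b′ g))
        (trans (map-0∷-· R.π a y) R.π-y)
    }
    where
    module R = Reduction (reduce y)
    open Coefficients (bézout a R.gcd) renaming (gcd to g; a/g to a′; b/g to b′)
    unit-* : ∀ x → (u * a′ + v * b′) * x ≡ x
    unit-* x = trans (cong (_* x) identity≡) (*-identityˡ x)
    β-τ′ : ∀ c w ws → (c ⊙ R.β) ∙ R.τ w ws ≡ c * w
    β-τ′ c w ws = trans (∙-⊙ˡ c R.β _) (cong (c *_) (R.β-τ w ws))
    expand₁ : ∀ u v a b p q → u * (a * p + - (v * q)) + v * (b * p + u * q) ≡ (u * a + v * b) * p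
    expand₁ = solve-∀
    expand₂ : ∀ u v a b p q → - b * (a * p + - (v * q)) + a * (b * p + u * q) ≡ (u * a + v * b) * q
    expand₂ = solve-∀
    expand₃ : ∀ u v a b x w → a * (u * x + v * w) + - (v * (- b * x + a * w)) ≡ (u * a + v * b) * x
    expand₃ = solve-∀
    expand₄ : ∀ u v a b x w → b * (u * x + v * w) + u * (- b * x + a * w) ≡ (u * a + v * b) * w
    expand₄ = solve-∀
    expand₅ : ∀ u v a b g → u * (a * g) + v * (b * g) ≡ (u * a + v * b) * g
    expand₅ = solve-∀
    expand₆ : ∀ a b g → - b * (a * g) + a * (b * g) ≡ 0ℤ
    expand₆ = solve-∀

  module _ {e} {y : Vec ℤ (suc e)} (R : Reduction y) where
    open Reduction R

    βπ-injective : ∀ {x x′} → β ∙ x ≡ β ∙ x′ → π · x ≡ π · x′ → x ≡ x′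
    βπ-injective {x} {x′} eq₁ eq₂ = trans (sym (τ-βπ x)) (trans (cong₂ τ eq₁ eq₂) (τ-βπ x′))

    -- In the coordinates `(β, π)` the vector `y` is `(gcd, 0)`, so dividing `gcd` divides `y`.
    gcd-divides : ∀ {q h} → gcd ≡ h * q → q ∣ᵛ y
    gcd-divides {q} {h} eq = dividesᵛ (τ h 0ᵛ) (βπ-injective
      (trans β-y (trans eq (trans (*-comm h q) (sym (trans (∙-⊙ʳ β q (τ h 0ᵛ)) (cong (q *_) (β-τ h 0ᵛ)))))))
      (trans π-y (sym (trans (·-⊙ π q (τ h 0ᵛ)) (trans (cong (q ⊙_) (π-τ h 0ᵛ)) (⊙-zeroʳ q))))))

  -- A presentation of ℤᵈ / ⟨S⟩ ≅ ℤᵉ.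
  record Quotient {k d} (S : Vec (Vec ℤ d) k) (e : ℕ) : Set where
    field
      φ       : Vec (Vec ℤ d) e
      σ       : Vec ℤ e → Vec ℤ d
      section : ∀ y → φ · σ y ≡ y
      kills   : All (λ s → φ · s ≡ 0ᵛ) S
      kernel  : ∀ x → φ · x ≡ 0ᵛ → ∃[ c ] comb c S ≡ x

  trivial-quotient : ∀ {d} → Quotient {d = d} [] d
  trivial-quotient {d} = record
    { φ = identity d ; σ = λ y → y ; section = identity-· ; kills = []
    ; kernel = λ x φx≡0 → [] , sym (trans (sym (identity-· x)) φx≡0) }

  ∙-comb-zero : ∀ {k d} {r : Vec ℤ d} {S : Vec (Vec ℤ d) k} → All (λ v → r ∙ v ≡ 0ℤ) S → ∀ c → r ∙ comb c S ≡ 0ℤ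
  ∙-comb-zero {r = r} []            []       = ∙-zeroʳ r
  ∙-comb-zero {r = r} {v ∷ S} (r∙v≡0 ∷ kills) (c ∷ cs) = trans (∙-⊕ʳ r (c ⊙ v) (comb cs S))
    (cong₂ _+_ (trans (∙-⊙ʳ r c v) (trans (cong (c *_) r∙v≡0) (*-zeroʳ c))) (∙-comb-zero {r = r} kills cs))

  -- In the coordinates `(β, π)` of ℤ^(e+1) the image `φ s` is `(gcd, 0)` with `gcd` a unit. It
  -- spans the first axis, and dividing by it leaves `π`.
  extend : ∀ {k d e} {S : Vec (Vec ℤ d) k} (Q : Quotient S (suc e)) s →
    let open Quotient Q in (R : Reduction (φ · s)) → Reduction.gcd R * Reduction.gcd R ≡ 1ℤ → Quotient (s ∷ S) e
  extend {S = S} Q s R gg≡1 = record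
    { φ = map (λ r → comb r φ) π
    ; σ = λ z → σ (τ 0ℤ z)
    ; section = λ z → trans (map-comb-· π φ _) (trans (cong (π ·_) (section _)) (π-τ 0ℤ z))
    ; kills = trans (map-comb-· π φ s) π-y
        ∷ All.map (λ {v} φv≡0 → trans (map-comb-· π φ v) (trans (cong (π ·_) φv≡0) (·-zero π))) kills
    ; kernel = kernel′
    }
    where
    open Quotient Q
    open Reduction R
    kernel′ : ∀ x → map (λ r → comb r φ) π · x ≡ 0ᵛ → ∃[ c ] comb c (s ∷ S) ≡ x
    kernel′ x eq with b ← β ∙ (φ · x) in β≡ = let c , c≡ = kernel (x ⊕ (- a) ⊙ s) φ≡0 in
      a ∷ c , trans (cong (a ⊙ s ⊕_) c≡) (trans (⊕-comm (a ⊙ s) _) (⊕-cancelʳ-⊙ a x s))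
      where
      open ≡-Reasoning
      -- As `gcd` is its own inverse, subtracting `a` copies of `s` removes the `β` coordinate `b`
      -- of `φ · x`; the `π` coordinates already vanish.
      a = b * gcd
      expand : ∀ b g → b + - (b * g) * g ≡ b + - b * (g * g)
      expand = solve-∀
      φ≡0 : φ · (x ⊕ (- a) ⊙ s) ≡ 0ᵛ
      φ≡0 = trans (trans (·-⊕ φ x _) (cong (φ · x ⊕_) (·-⊙ φ (- a) s))) (βπ-injective R
        (begin
          β ∙ (φ · x ⊕ (- a) ⊙ (φ · s))        ≡⟨ ∙-⊕ʳ β _ _ ⟩
          β ∙ (φ · x) + β ∙ ((- a) ⊙ (φ · s))  ≡⟨ cong₂ _+_ β≡ (trans (∙-⊙ʳ β (- a) _) (cong (- a *_) β-y)) ⟩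
          b + - (b * gcd) * gcd                ≡⟨ expand b gcd ⟩
          b + - b * (gcd * gcd)                ≡⟨ cong (λ g → b + - b * g) gg≡1 ⟩
          b + - b * 1ℤ                         ≡⟨ cong (b +_) (*-identityʳ (- b)) ⟩
          b + - b                              ≡⟨ +-inverseʳ b ⟩
          0ℤ                                   ≡⟨ ∙-zeroʳ β ⟨
          β ∙ 0ᵛ                               ∎)
        (begin
          π · (φ · x ⊕ (- a) ⊙ (φ · s))        ≡⟨ ·-⊕ π _ _ ⟩
          π · (φ · x) ⊕ π · ((- a) ⊙ (φ · s))  ≡⟨ cong₂ _⊕_ (trans (sym (map-comb-· π φ x)) eq) (trans (·-⊙ π (- a) _) (trans (cong ((- a) ⊙_) π-y) (⊙-zeroʳ (- a)))) ⟩
          0ᵛ ⊕ 0ᵛ                              ≡⟨ ⊕-identityˡ 0ᵛ ⟩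
          0ᵛ                                   ≡⟨ ·-zero π ⟨
          π · 0ᵛ                               ∎))

  -- The part of primitivity that integers alone can express. It serves to refute primitivity;
  -- proofs of primitivity go through a stronger property that speaks of real coefficients.
  record Saturated {k d} (S : Vec (Vec ℤ d) k) : Set where
    field
      independent : ∀ c → comb c S ≡ 0ᵛ → c ≡ 0ᵛ
      saturated   : ∀ q .{{_ : NonZero q}} w c → comb c S ≡ q ⊙ w → ∃[ b ] comb b S ≡ w

  comb-injective : ∀ {k d} {S : Vec (Vec ℤ d) k} → Saturated S → ∀ b c → comb b S ≡ comb c S → b ≡ c
  comb-injective {S = S} sat b c eq = begin
    b                           ≡⟨ ⊕-cancelʳ-⊙ 1ℤ b c ⟨
    b ⊕ (- 1ℤ) ⊙ c ⊕ 1ℤ ⊙ c     ≡⟨ cong₂ _⊕_ (Saturated.independent sat _ zero≡) (⊙-identity c) ⟩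
    0ᵛ ⊕ c                      ≡⟨ ⊕-identityˡ c ⟩
    c                           ∎
    where
    open ≡-Reasoning
    zero≡ : comb (b ⊕ (- 1ℤ) ⊙ c) S ≡ 0ᵛ
    zero≡ = begin
      comb (b ⊕ (- 1ℤ) ⊙ c) S          ≡⟨ comb-⊕ b _ S ⟩
      comb b S ⊕ comb ((- 1ℤ) ⊙ c) S   ≡⟨ cong₂ _⊕_ (trans eq (sym (⊙-identity (comb c S)))) (comb-⊙ (- 1ℤ) c S) ⟩
      1ℤ ⊙ comb c S ⊕ (- 1ℤ) ⊙ comb c S ≡⟨ ⊕-inverseʳ 1ℤ (comb c S) ⟩
      0ᵛ                               ∎

  -- Division by `q` takes place in the span of `s ∷ S` and might bring in `s`. By uniqueness of
  -- coefficients, `q` times the new coefficient of `s` is the old one, which is zero.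
  saturated-tail : ∀ {k d} {s} {S : Vec (Vec ℤ d) k} → Saturated (s ∷ S) → Saturated S
  saturated-tail {s = s} {S} sat = record
    { independent = λ c eq → proj₂ (∷-injective (independent (0ℤ ∷ c) (trans (drop c) eq)))
    ; saturated = λ q w c eq → tail-coefficients q c w eq (saturated q w (0ℤ ∷ c) (trans (drop c) eq))
    }
    where
    open Saturated sat
    drop : ∀ c → comb (0ℤ ∷ c) (s ∷ S) ≡ comb c S
    drop c = trans (cong (_⊕ comb c S) (⊙-zeroˡ s)) (⊕-identityˡ _)
    tail-coefficients : ∀ q .{{_ : NonZero q}} c w → comb c S ≡ q ⊙ w → ∃[ b ] comb b (s ∷ S) ≡ w → ∃[ b ] comb b S ≡ w
    tail-coefficients q c w eq (b₀ ∷ b , refl) = b , trans (sym (drop b)) (cong (λ x → comb (x ∷ b) (s ∷ S)) (sym b₀≡0))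
      where
      b₀≡0 : b₀ ≡ 0ℤ
      b₀≡0 = *-cancelˡ-≡ q b₀ 0ℤ (trans
        (proj₁ (∷-injective (comb-injective sat (q ⊙ (b₀ ∷ b)) (0ℤ ∷ c) (trans (comb-⊙ q (b₀ ∷ b) (s ∷ S)) (trans (sym eq) (sym (drop c)))))))
        (sym (*-zeroʳ q)))

  -- With y₀ = φ s / gcd, the vector gcd · σ y₀ lies in s + ⟨S⟩. Saturation puts σ y₀ in the span of s ∷ S,
  -- and comparing coefficients of s shows that gcd divides 1.
  saturated⇒gcd≡1 : ∀ {k d e} {s} {S : Vec (Vec ℤ d) k} → Saturated (s ∷ S) → (Q : Quotient S (suc e)) →
    (R : Reduction (Quotient.φ Q · s)) → abs (Reduction.gcd R) ≡ 1
  saturated⇒gcd≡1 {s = s} {S} sat Q R with gcd-divides R {Reduction.gcd R} {1ℤ} (sym (*-identityˡ _))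
  ... | dividesᵛ y₀ φs≡gy₀ = conclude (gcd ≟ 0ℤ)
    where
    open Quotient Q
    open Reduction R
    open Saturated sat
    in-kernel : φ · (s ⊕ (- gcd) ⊙ σ y₀) ≡ 0ᵛ
    in-kernel = trans (·-⊕ φ s _) (trans (cong₂ _⊕_ φs≡gy₀ (trans (·-⊙ φ (- gcd) _) (cong ((- gcd) ⊙_) (section y₀)))) (⊕-inverseʳ gcd y₀))
    c = proj₁ (kernel _ in-kernel)
    relation : comb (1ℤ ∷ (- 1ℤ) ⊙ c) (s ∷ S) ≡ gcd ⊙ σ y₀
    relation = begin
      1ℤ ⊙ s ⊕ comb ((- 1ℤ) ⊙ c) S                      ≡⟨ cong₂ _⊕_ (⊙-identity s) (comb-⊙ (- 1ℤ) c S) ⟩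
      s ⊕ (- 1ℤ) ⊙ comb c S                             ≡⟨ cong (λ x → s ⊕ (- 1ℤ) ⊙ x) (proj₂ (kernel _ in-kernel)) ⟩
      s ⊕ (- 1ℤ) ⊙ (s ⊕ (- gcd) ⊙ σ y₀)                 ≡⟨ cong (s ⊕_) (⊙-distribˡ (- 1ℤ) s _) ⟩
      s ⊕ ((- 1ℤ) ⊙ s ⊕ (- 1ℤ) ⊙ (- gcd) ⊙ σ y₀)        ≡⟨ ⊕-assoc s _ _ ⟨
      s ⊕ (- 1ℤ) ⊙ s ⊕ (- 1ℤ) ⊙ (- gcd) ⊙ σ y₀          ≡⟨ cong₂ _⊕_ (trans (cong (_⊕ (- 1ℤ) ⊙ s) (sym (⊙-identity s))) (⊕-inverseʳ 1ℤ s)) (sym (⊙-assoc (- 1ℤ) (- gcd) _)) ⟩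
      0ᵛ ⊕ (- 1ℤ * - gcd) ⊙ σ y₀                        ≡⟨ ⊕-identityˡ _ ⟩
      (- 1ℤ * - gcd) ⊙ σ y₀                             ≡⟨ cong (_⊙ σ y₀) (trans (-1*i≡-i (- gcd)) (neg-involutive gcd)) ⟩
      gcd ⊙ σ y₀                                        ∎
      where open ≡-Reasoning
    conclude : _ → abs gcd ≡ 1
    conclude (yes gcd≡0) = contradiction
      (proj₁ (∷-injective (independent (1ℤ ∷ (- 1ℤ) ⊙ c) (trans relation (trans (cong (_⊙ σ y₀) gcd≡0) (⊙-zeroˡ _)))))) (λ ())
    conclude (no gcd≢0) with (b ∷ bs) , b≡ ← saturated gcd {{≢-nonZero gcd≢0}} (σ y₀) (1ℤ ∷ (- 1ℤ) ⊙ c) relation =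
      ℕ.∣1⇒≡1 (∣⇒∣ᵤ (divides b (trans
        (proj₁ (∷-injective (comb-injective sat (1ℤ ∷ (- 1ℤ) ⊙ c) (gcd ⊙ (b ∷ bs))
          (trans relation (trans (cong (gcd ⊙_) (sym b≡)) (sym (comb-⊙ gcd (b ∷ bs) (s ∷ S))))))))
        (*-comm gcd b))))

-- From real linear relations to integer ones.

module RealSpans where

  open Vectors
  open Quotients
  open Rationals
  open import Defs using (ℝ; seq; fromℚ; module Linearℝ; module Linearℤ; toℝ; RealSpanLattice; Primitive)
  open import Data.Rational.Base using (_+_; _*_; -_; _-_; 1/_)
  open import Data.Rational.Properties
  import Algebra.Properties.AbelianGroup +-0-abelianGroup as ℚ+
  open import Data.Vec.Base using (lookup; tabulate)
  open import Data.Vec.Properties using (lookup∘tabulate; tabulate∘lookup; lookup-zipWith; lookup-map; lookup-replicate; tabulate-cong)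
  open import Data.Vec.Relation.Unary.All using (All; []; _∷_)

  combℚ : ∀ {k d} → (Fin k → ℚ) → Vec (Vec ℤ d) k → Fin d → ℚ
  combℚ c []      i = 0ℚ
  combℚ c (s ∷ S) i = c Fin.zero * ι (lookup s i) + combℚ (c ∘ Fin.suc) S i

  dotℚ : ∀ {d} → Vec ℤ d → (Fin d → ℚ) → ℚ
  dotℚ []       u = 0ℚ
  dotℚ (r ∷ rs) u = ι r * u Fin.zero + dotℚ rs (u ∘ Fin.suc)

  dotℚ-linear : ∀ {d} (r : Vec ℤ d) c s u → dotℚ r (λ i → c * ι (lookup s i) + u i) ≡ c * ι (r ∙ s) + dotℚ r u
  dotℚ-linear []       c []       u = sym (trans (+-identityʳ _) (*-zeroʳ c))
  dotℚ-linear (r ∷ rs) c (s ∷ ss) u = begin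
    ι r * (c * ι s + u Fin.zero) + dotℚ rs (λ i → c * ι (lookup ss i) + u (Fin.suc i))
      ≡⟨ cong (ι r * (c * ι s + u Fin.zero) +_) (dotℚ-linear rs c ss _) ⟩
    ι r * (c * ι s + u Fin.zero) + (c * ι (rs ∙ ss) + dotℚ rs (u ∘ Fin.suc))
      ≡⟨ solve 6 (λ r c s u p q → r :* (c :* s :+ u) :+ (c :* p :+ q) := c :* (r :* s :+ p) :+ (r :* u :+ q)) refl
           (ι r) c (ι s) (u Fin.zero) (ι (rs ∙ ss)) (dotℚ rs (u ∘ Fin.suc)) ⟩
    c * (ι r * ι s + ι (rs ∙ ss)) + (ι r * u Fin.zero + dotℚ rs (u ∘ Fin.suc))
      ≡⟨ cong (λ p → c * p + (ι r * u Fin.zero + dotℚ rs (u ∘ Fin.suc)))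
           (trans (cong (_+ ι (rs ∙ ss)) (sym (ι-* r s))) (sym (ι-+ (r ℤ.* s) (rs ∙ ss)))) ⟩
    c * ι ((r ∷ rs) ∙ (s ∷ ss)) + dotℚ (r ∷ rs) u ∎
    where
    open ≡-Reasoning
    open +-*-Solver

  dotℚ-zero : ∀ {d} (r : Vec ℤ d) → dotℚ r (λ _ → 0ℚ) ≡ 0ℚ
  dotℚ-zero []       = refl
  dotℚ-zero (r ∷ rs) = trans (cong₂ _+_ (*-zeroʳ (ι r)) (dotℚ-zero rs)) (+-identityˡ 0ℚ)

  dotℚ-kills : ∀ {k d} (r : Vec ℤ d) {S : Vec (Vec ℤ d) k} → All (λ s → r ∙ s ≡ 0ℤ) S → ∀ c → dotℚ r (combℚ c S) ≡ 0ℚ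
  dotℚ-kills r []                 c = dotℚ-zero r
  dotℚ-kills r {s ∷ S} (r∙s≡0 ∷ kills) c = trans (dotℚ-linear r (c Fin.zero) s (combℚ (c ∘ Fin.suc) S))
    (trans (cong₂ (λ z w → c Fin.zero * ι z + w) r∙s≡0 (dotℚ-kills r kills (c ∘ Fin.suc)))
      (trans (+-identityʳ _) (*-zeroʳ (c Fin.zero))))

  null-dotℚ : ∀ {d} (r : Vec ℤ d) {u : Fin d → ℕ → ℚ} → (∀ i → Null (u i)) → Null (λ n → dotℚ r (λ i → u i n))
  null-dotℚ []       u-null = null-zero
  null-dotℚ (r ∷ rs) u-null = null-+ (null-*ˡ (ι r) (u-null Fin.zero)) (null-dotℚ rs (u-null ∘ Fin.suc))

  -- Real coefficients are represented by arbitrary rational sequences, equality of reals by a null difference.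
  record RealBasis {k d} (S : Vec (Vec ℤ d) k) : Set where
    field
      independent  : ∀ (c : Fin k → ℕ → ℚ) → (∀ i → Null (λ n → combℚ (λ k → c k n) S i)) → ∀ k → Null (c k)
      independentℤ : ∀ c → comb c S ≡ 0ᵛ → c ≡ 0ᵛ
      span         : ∀ (c : Fin k → ℕ → ℚ) w →
        (∀ i → Null (λ n → combℚ (λ k → c k n) S i - ι (lookup w i))) → ∃[ b ] comb b S ≡ w

  vec-zero : ∀ {d} (w : Vec ℤ d) → (∀ i → lookup w i ≡ 0ℤ) → w ≡ 0ᵛ
  vec-zero []       _ = refl
  vec-zero (w ∷ ws) h = cong₂ _∷_ (h Fin.zero) (vec-zero ws (h ∘ Fin.suc))

  realBasis-[] : ∀ {d} → RealBasis {d = d} []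
  realBasis-[] = record
    { independent  = λ _ _ ()
    ; independentℤ = λ { [] _ → refl }
    ; span = λ c w h → [] , sym (vec-zero w (λ i → ι-injective (neg-injective (trans (sym (+-identityˡ _)) (null-const (h i))))))
    }

  -- A covector that kills S and is ±1 on s isolates the coefficient of s.
  realBasis-∷ : ∀ {k d} {S : Vec (Vec ℤ d) k} (r s : Vec ℤ d) → (r ∙ s) ℤ.* (r ∙ s) ≡ 1ℤ →
    All (λ v → r ∙ v ≡ 0ℤ) S → RealBasis S → RealBasis (s ∷ S)
  realBasis-∷ {k} {d} {S} r s gg≡1 kills basis = record
    { independent = independent′ ; independentℤ = independentℤ′ ; span = span′ }
    where
    open RealBasis basis
    open +-*-Solver
    g = r ∙ s

    ιgg≡1 : ι g * ι g ≡ 1ℚ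
    ιgg≡1 = trans (sym (ι-* g g)) (cong ι gg≡1)

    isolate : ∀ c → dotℚ r (combℚ c (s ∷ S)) ≡ c Fin.zero * ι g
    isolate c = trans (dotℚ-linear r (c Fin.zero) s _)
      (trans (cong (c Fin.zero * ι g +_) (dotℚ-kills r kills (c ∘ Fin.suc))) (+-identityʳ _))

    g-involutive : ∀ x → ι g * (x * ι g) ≡ x
    g-involutive x = trans (solve 2 (λ g x → g :* (x :* g) := g :* g :* x) refl (ι g) x)
      (trans (cong (_* x) ιgg≡1) (*-identityˡ x))

    tail-null : ∀ {x y : ℕ → ℚ} z p → Null (λ n → (x n * ι z + y n) - p) → ∀ q → Null (λ n → x n - q) →
      Null (λ n → y n - (p - q * ι z))
    tail-null {x} {y} z p total q head = null-cong
      (λ n → solve 5 (λ x y z p q → (x :* z :+ y :- p) :+ :- z :* (x :- q) := y :- (p :- q :* z)) refl (x n) (y n) (ι z) p q)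
      (null-+ total (null-*ˡ (- ι z) head))

    independent′ : ∀ (c : Fin (suc k) → ℕ → ℚ) → (∀ i → Null (λ n → combℚ (λ k → c k n) (s ∷ S) i)) → ∀ k → Null (c k)
    independent′ c h = λ { Fin.zero → head ; (Fin.suc k) → independent (c ∘ Fin.suc) tail k }
      where
      head : Null (c Fin.zero)
      head = null-cong (λ n → trans (cong (ι g *_) (isolate (λ k → c k n))) (g-involutive (c Fin.zero n)))
        (null-*ˡ (ι g) (null-dotℚ r h))
      tail : ∀ i → Null (λ n → combℚ (λ k → c (Fin.suc k) n) S i)
      tail i = null-cong
        (λ n → solve 3 (λ x y z → (x :* z :+ y) :+ :- z :* x := y) refl (c Fin.zero n) _ (ι (lookup s i)))
        (null-+ (h i) (null-*ˡ (- ι (lookup s i)) head))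

    independentℤ′ : ∀ c → comb c (s ∷ S) ≡ 0ᵛ → c ≡ 0ᵛ
    independentℤ′ (c₀ ∷ c) eq = cong₂ _∷_ c₀≡0 (independentℤ c (trans (sym (trans
      (cong (λ x → x ⊙ s ⊕ comb c S) c₀≡0) (trans (cong (_⊕ comb c S) (⊙-zeroˡ s)) (⊕-identityˡ _)))) eq))
      where
      c₀g≡0 : c₀ ℤ.* g ≡ 0ℤ
      c₀g≡0 = trans (sym (trans (∙-⊕ʳ r _ _) (trans (cong₂ ℤ._+_ (∙-⊙ʳ r c₀ s) (∙-comb-zero {r = r} kills c)) (ℤ.+-identityʳ _))))
        (trans (cong (r ∙_) eq) (∙-zeroʳ r))
      c₀≡0 : c₀ ≡ 0ℤ
      c₀≡0 = trans (sym (trans (ℤ.*-assoc c₀ g g) (trans (cong (c₀ ℤ.*_) gg≡1) (ℤ.*-identityʳ c₀)))) (cong (ℤ._* g) c₀g≡0)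

    dotℚ-difference : ∀ {d} (r : Vec ℤ d) u w → dotℚ r (λ i → u i - ι (lookup w i)) ≡ dotℚ r u - ι (r ∙ w)
    dotℚ-difference []       u []       = refl
    dotℚ-difference (r ∷ rs) u (w ∷ ws) = trans (cong (ι r * (u Fin.zero - ι w) +_) (dotℚ-difference rs (u ∘ Fin.suc) ws))
      (trans (solve 5 (λ r u w p q → r :* (u :- w) :+ (p :- q) := (r :* u :+ p) :- (r :* w :+ q)) refl
        (ι r) (u Fin.zero) (ι w) (dotℚ rs (u ∘ Fin.suc)) (ι (rs ∙ ws)))
      (cong (λ p → dotℚ (r ∷ rs) u - p) (trans (cong (_+ ι (rs ∙ ws)) (sym (ι-* r w))) (sym (ι-+ (r ℤ.* w) (rs ∙ ws))))))

    span′ : ∀ (c : Fin (suc k) → ℕ → ℚ) w →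
      (∀ i → Null (λ n → combℚ (λ k → c k n) (s ∷ S) i - ι (lookup w i))) → ∃[ b ] comb b (s ∷ S) ≡ w
    span′ c w h = let b , b≡ = span (c ∘ Fin.suc) w′ tail in
      a ∷ b , trans (cong (a ⊙ s ⊕_) b≡) (trans (⊕-comm (a ⊙ s) w′) (⊕-cancelʳ-⊙ a w s))
      where
      -- Applying `r` to the relation leaves the coefficient of `s` times `g` on one side and the
      -- integer `r ∙ w` on the other. Since `g` is ±1, the real coefficient is this integer.
      a = g ℤ.* (r ∙ w)
      w′ = w ⊕ (ℤ.- a) ⊙ s
      head : Null (λ n → c Fin.zero n - ι a)
      head = null-cong
        (λ n → trans (cong (ι g *_) (trans (dotℚ-difference r _ w) (cong (_- ι (r ∙ w)) (isolate (λ k → c k n)))))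
          (trans (solve 3 (λ g x p → g :* (x :* g :- p) := g :* (x :* g) :- g :* p) refl (ι g) (c Fin.zero n) (ι (r ∙ w)))
            (cong₂ _-_ (g-involutive (c Fin.zero n)) (sym (ι-* g (r ∙ w))))))
        (null-*ˡ (ι g) (null-dotℚ r h))
      entry : ∀ i → lookup w′ i ≡ lookup w i ℤ.+ ℤ.- a ℤ.* lookup s i
      entry i = trans (lookup-zipWith ℤ._+_ i w _) (cong (λ z → lookup w i ℤ.+ z) (lookup-map i (ℤ.- a ℤ.*_) s))
      neg-ι : ∀ x y → ι (x ℤ.+ ℤ.- a ℤ.* y) ≡ ι x - ι a * ι y
      neg-ι x y = trans (ι-+ x (ℤ.- a ℤ.* y)) (cong (ι x +_) (trans (cong ι (sym (ℤ.neg-distribˡ-* a y)))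
        (trans (ι-neg (a ℤ.* y)) (cong -_ (ι-* a y)))))
        where
        ι-neg : ∀ i → ι (ℤ.- i) ≡ - ι i
        ι-neg i = ℚ+.inverseʳ-unique (ι i) (ι (ℤ.- i)) (trans (sym (ι-+ i (ℤ.- i))) (cong ι (ℤ.+-inverseʳ i)))
      tail : ∀ i → Null (λ n → combℚ (λ k → c (Fin.suc k) n) S i - ι (lookup w′ i))
      tail i = null-cong (λ n → cong (λ p → combℚ (λ k → c (Fin.suc k) n) S i - p) (sym (trans (cong ι (entry i)) (neg-ι (lookup w i) (lookup s i)))))
        (tail-null {c Fin.zero} {λ n → combℚ (λ k → c (Fin.suc k) n) S i} (lookup s i) (ι (lookup w i)) (h i) (ι a) head)

  rows : ∀ {k d} → Vector (Vector ℤ d) k → Vec (Vec ℤ d) k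
  rows F = tabulate (λ k → tabulate (F k))

  seq-linearCombination : ∀ {k d} (c : Vector ℝ k) (F : Vector (Vector ℤ d) k) i n →
    combℚ (λ k → seq (c k) n) (rows F) i ≡ seq (Linearℝ.linearCombination c (Vector.map toℝ F) i) n
  seq-linearCombination {zero}  c F i n = refl
  seq-linearCombination {suc k} c F i n = cong₂ (λ z p → seq (c Fin.zero) n * ι z + p)
    (lookup∘tabulate (F Fin.zero) i) (seq-linearCombination (c ∘ Fin.suc) (F ∘ Fin.suc) i n)

  tabulate-comb : ∀ {k d} (c : Vector ℤ k) (F : Vector (Vector ℤ d) k) i →
    lookup (comb (tabulate c) (rows F)) i ≡ Linearℤ.linearCombination c F i
  tabulate-comb {zero}  c F i = lookup-replicate i 0ℤ
  tabulate-comb {suc k} c F i = trans (lookup-zipWith ℤ._+_ i (c Fin.zero ⊙ tabulate (F Fin.zero)) (comb (tabulate (c ∘ Fin.suc)) (rows (F ∘ Fin.suc))))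
    (cong₂ ℤ._+_ (trans (lookup-map i (c Fin.zero ℤ.*_) (tabulate (F Fin.zero))) (cong (c Fin.zero ℤ.*_) (lookup∘tabulate (F Fin.zero) i)))
      (tabulate-comb (c ∘ Fin.suc) (F ∘ Fin.suc) i))

  linearCombination-comb : ∀ {k d} (c : Vec ℤ k) (F : Vector (Vector ℤ d) k) i →
    lookup (comb c (rows F)) i ≡ Linearℤ.linearCombination (lookup c) F i
  linearCombination-comb c F i = trans (cong (λ v → lookup (comb v (rows F)) i) (sym (tabulate∘lookup c)))
    (tabulate-comb (lookup c) F i)

  -- The scalar `κ` is `1ℚ` when a row is placed in the real span, and `1 / q` when a vector is
  -- divided by `q` there.
  combℚ-ι : ∀ {k d} κ (c : Vec ℤ k) (S : Vec (Vec ℤ d) k) i → combℚ (λ k → κ * ι (lookup c k)) S i ≡ κ * ι (lookup (comb c S) i)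
  combℚ-ι κ []       []      i = sym (trans (cong (λ z → κ * ι z) (lookup-replicate i 0ℤ)) (*-zeroʳ κ))
  combℚ-ι κ (c ∷ cs) (s ∷ S) i = begin
    κ * ι c * ι (lookup s i) + combℚ (λ k → κ * ι (lookup cs k)) S i
      ≡⟨ cong₂ _+_ (trans (*-assoc κ _ _) (cong (κ *_) (sym (ι-* c (lookup s i))))) (combℚ-ι κ cs S i) ⟩
    κ * ι (c ℤ.* lookup s i) + κ * ι (lookup (comb cs S) i)
      ≡⟨ *-distribˡ-+ κ _ _ ⟨
    κ * (ι (c ℤ.* lookup s i) + ι (lookup (comb cs S) i))
      ≡⟨ cong (κ *_) (ι-+ (c ℤ.* lookup s i) _) ⟨
    κ * ι (c ℤ.* lookup s i ℤ.+ lookup (comb cs S) i)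
      ≡⟨ cong (λ z → κ * ι z) (trans (cong (λ z → z ℤ.+ lookup (comb cs S) i) (sym (lookup-map i (c ℤ.*_) s))) (sym (lookup-zipWith ℤ._+_ i (c ⊙ s) (comb cs S)))) ⟩
    κ * ι (lookup (comb (c ∷ cs) (s ∷ S)) i) ∎
    where open ≡-Reasoning

  comb-unit : ∀ {k d} (S : Vec (Vec ℤ d) k) j → comb (unit j) S ≡ lookup S j
  comb-unit (s ∷ S) Fin.zero    = trans (cong₂ _⊕_ (⊙-identity s) (comb-zero S)) (⊕-identityʳ s)
  comb-unit (s ∷ S) (Fin.suc j) = trans (cong (λ c → comb c (s ∷ S)) (lookup-map j (0ℤ ∷_) (identity _)))
    (trans (cong₂ _⊕_ (⊙-zeroˡ s) (comb-unit S j)) (⊕-identityˡ _))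

  vec-ext : ∀ {d} {v w : Vec ℤ d} → (∀ i → lookup v i ≡ lookup w i) → v ≡ w
  vec-ext {v = v} {w} h = trans (sym (tabulate∘lookup v)) (trans (tabulate-cong h) (tabulate∘lookup w))

  private
    realComb : ∀ {k d} → Vector ℝ k → Vector (Vector ℤ d) k → Fin d → ℕ → ℚ
    realComb c F i n = seq (Linearℝ.linearCombination c (Vector.map toℝ F) i) n

    null-comb : ∀ {k d} (F : Vector (Vector ℤ d) k) c i z →
      Null (λ n → realComb c F i n - z) → Null (λ n → combℚ (λ k → seq (c k) n) (rows F) i - z)
    null-comb F c i z = null-cong {λ n → realComb c F i n - z} (λ n → cong (_- z) (sym (seq-linearCombination c F i n)))

    in-span : ∀ {k d} (F : Vector (Vector ℤ d) k) (c : Vector ℝ k) w →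
      (∀ i n → combℚ (λ k → seq (c k) n) (rows F) i ≡ ι (w i)) → RealSpanLattice F w
    in-span F c w h = c , λ i → close (null-cong {λ _ → 0ℚ} {λ n → realComb c F i n - ι (w i)} (λ n → sym (difference i n)) null-zero)
      where
      difference : ∀ i n → realComb c F i n - ι (w i) ≡ 0ℚ
      difference i n = trans (cong (_- ι (w i)) (trans (sym (seq-linearCombination c F i n)) (h i n))) (+-inverseʳ (ι (w i)))

  module _ {k d} (F : Vector (Vector ℤ d) k) (basis : RealBasis (rows F)) where
    open RealBasis basis

    realBasis⇒independentℝ : Linearℝ.LinearlyIndependent (Vector.map toℝ F)
    realBasis⇒independentℝ c h k = close (null-cong {seq (c k)} {λ n → seq (c k) n - 0ℚ}
      (λ n → sym (+-identityʳ (seq (c k) n))) (independent (λ k → seq (c k)) combination-null k))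
      where
      combination-null : ∀ i → Null (λ n → combℚ (λ k → seq (c k) n) (rows F) i)
      combination-null i = null-cong {λ n → combℚ (λ k → seq (c k) n) (rows F) i - 0ℚ} (λ n → +-identityʳ _)
        (null-comb F c i 0ℚ (mkNull (h i)))

    realBasis⇒member : ∀ k → RealSpanLattice F (F k)
    realBasis⇒member k = in-span F (λ j → fromℚ (1ℚ * ι (lookup (unit k) j))) (F k)
      (λ i n → trans (combℚ-ι 1ℚ (unit k) (rows F) i) (trans (*-identityˡ _) (cong ι (entry i))))
      where
      entry : ∀ i → lookup (comb (unit k) (rows F)) i ≡ F k i
      entry i = trans (cong (λ v → lookup v i) (trans (comb-unit (rows F) k) (lookup∘tabulate (λ k → tabulate (F k)) k)))
        (lookup∘tabulate (F k) i)

    realBasis⇒independentℤ : Linearℤ.LinearlyIndependent F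
    realBasis⇒independentℤ c h k = trans (sym (lookup∘tabulate c k)) (trans (cong (λ v → lookup v k)
      (independentℤ (tabulate c) (vec-zero _ λ i → trans (tabulate-comb c F i) (h i)))) (lookup-replicate k 0ℤ))

    realBasis⇒span : ∀ w → RealSpanLattice F w → Linearℤ.Span F w
    realBasis⇒span w (c , h) = lookup (proj₁ spanned) , λ i → trans (sym (linearCombination-comb (proj₁ spanned) F i))
      (trans (cong (λ v → lookup v i) (proj₂ spanned)) (lookup∘tabulate w i))
      where
      difference-null : ∀ i → Null (λ n → combℚ (λ k → seq (c k) n) (rows F) i - ι (lookup (tabulate w) i))
      difference-null i = subst (λ z → Null (λ n → combℚ (λ k → seq (c k) n) (rows F) i - ι z)) (sym (lookup∘tabulate w i))
        (null-comb F c i (ι (w i)) (mkNull (h i)))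
      spanned : ∃[ b ] comb b (rows F) ≡ tabulate w
      spanned = span (λ k → seq (c k)) (tabulate w) difference-null

    realBasis⇒primitive : Primitive F
    realBasis⇒primitive = realBasis⇒independentℝ , realBasis⇒member , realBasis⇒independentℤ , realBasis⇒span

  -- If `q ⊙ w` has the integer coefficients `c`, then `w` has the real coefficients `c / q`, given
  -- by constant sequences. So `w` lies in the lattice of which `F` is a basis.
  primitive⇒saturated : ∀ {k d} (F : Vector (Vector ℤ d) k) → Primitive F → Saturated (rows F)
  primitive⇒saturated F (_ , _ , independent , span) = record
    { independent = λ c eq → vec-zero c (independent (lookup c) (λ i → trans (sym (linearCombination-comb c F i))
        (trans (cong (λ v → lookup v i) eq) (lookup-replicate i 0ℤ))))
    ; saturated = saturate
    }
    where
    saturate : ∀ q .{{_ : ℤ.NonZero q}} w c → comb c (rows F) ≡ q ⊙ w → ∃[ b ] comb b (rows F) ≡ w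
    saturate q w c eq = tabulate (proj₁ spanned) , vec-ext λ i → trans (tabulate-comb (proj₁ spanned) F i) (proj₂ spanned i)
      where
      κ = (1/ ι q) {{ι≢0 q}}
      cancel : ∀ i → κ * ι (lookup (q ⊙ w) i) ≡ ι (lookup w i)
      cancel i = trans (cong (λ z → κ * ι z) (lookup-map i (q ℤ.*_) w)) (trans (cong (κ *_) (ι-* q (lookup w i)))
        (trans (sym (*-assoc κ _ _)) (trans (cong (_* ι (lookup w i)) (*-inverseˡ (ι q) {{ι≢0 q}})) (*-identityˡ _))))
      spanned : Linearℤ.Span F (lookup w)
      spanned = span (lookup w) (in-span F (λ k → fromℚ (κ * ι (lookup c k))) (lookup w)
        (λ i n → trans (combℚ-ι κ c (rows F) i) (trans (cong (λ v → κ * ι (lookup v i)) eq) (cancel i))))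

-- Deciding primitivity row by row.

module Classification where

  open Vectors
  open Quotients
  open RealSpans
  open Sums using (𝟙)
  open import Defs using (Primitive)
  open import Data.Integer.Base using (_*_; -[1+_])
  open import Data.Nat.Properties using (_≟_)
  import Data.Vec.Relation.Unary.All as All

  abs≡1⇒square≡1 : ∀ g → abs g ≡ 1 → g * g ≡ 1ℤ
  abs≡1⇒square≡1 (pos 1)  refl = refl
  abs≡1⇒square≡1 -[1+ 0 ] refl = refl

  Unimodular : ∀ {e} → Vec ℤ (suc e) → Set
  Unimodular y = abs (Reduction.gcd (reduce y)) ≡ 1

  unimodular? : ∀ {e} (y : Vec ℤ (suc e)) → Dec (Unimodular y)
  unimodular? y = abs (Reduction.gcd (reduce y)) ≟ 1

  Completable : ∀ {k d} → Vec (Vec ℤ d) k → ℕ → Set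
  Completable S e = Quotient S e × RealBasis S

  -- Each alternative carries the evidence that the next row needs: a quotient map to test the row
  -- against, or a refutation inherited by every extension.
  classify-∷ : ∀ {k d e} s {S : Vec (Vec ℤ d) k} → Completable S (suc e) ⊎ ¬ Saturated S →
    Completable (s ∷ S) e ⊎ ¬ Saturated (s ∷ S)
  classify-∷ s (inj₂ ¬sat) = inj₂ (¬sat ∘ saturated-tail)
  classify-∷ s {S} (inj₁ (Q , basis)) with unimodular? (Quotient.φ Q · s)
  ... | no ¬g≡1 = inj₂ (λ sat → ¬g≡1 (saturated⇒gcd≡1 sat Q (reduce _)))
  ... | yes g≡1 = inj₁
    ( extend Q s R (abs≡1⇒square≡1 gcd g≡1)
    -- `comb β φ` is the coordinate `β` pulled back to ℤᵈ: it vanishes on `S` because `φ` does, and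
    -- its value at `s` is `gcd`.
    , realBasis-∷ (comb β φ) s (trans (cong (λ g → g * g) (trans (comb-∙ β φ s) β-y)) (abs≡1⇒square≡1 gcd g≡1))
        (All.map (λ {v} φv≡0 → trans (comb-∙ β φ v) (trans (cong (β ∙_) φv≡0) (∙-zeroʳ β))) kills) basis )
    where
    open Quotient Q
    R = reduce (φ · s)
    open Reduction R

  classify : ∀ {k d} e (S : Vec (Vec ℤ d) k) → k ℕ.+ e ≡ d → Completable S e ⊎ ¬ Saturated S
  classify e []      refl = inj₁ (trivial-quotient , realBasis-[])
  classify {suc k} e (s ∷ S) eq = classify-∷ s (classify (suc e) S (trans (ℕ.+-suc k e) eq))

  decide : ∀ {k d} e (F : Vector (Vector ℤ d) k) → Completable (rows F) e ⊎ ¬ Saturated (rows F) → Dec (Primitive F)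
  decide e F (inj₁ (_ , basis)) = yes (realBasis⇒primitive F basis)
  decide e F (inj₂ ¬sat)        = no (¬sat ∘ primitive⇒saturated F)

  -- Counting with the classification itself, instead of a decision of `Primitive`, keeps the
  -- recursion over rows available to the count.
  indicator : ∀ {A B : Set} → A ⊎ B → ℕ
  indicator (inj₁ _) = 1
  indicator (inj₂ _) = 0

  𝟙-decide : ∀ {k d} e (F : Vector (Vector ℤ d) k) c → 𝟙 (decide e F c) ≡ indicator c
  𝟙-decide e F (inj₁ _) = refl
  𝟙-decide e F (inj₂ _) = refl

  indicator-classify-∷ : ∀ {k d e} s {S : Vec (Vec ℤ d) k} Q basis →
    indicator (classify-∷ {e = e} s {S} (inj₁ (Q , basis))) ≡ 𝟙 (unimodular? (Quotient.φ Q · s))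
  indicator-classify-∷ s Q basis with unimodular? (Quotient.φ Q · s)
  ... | yes _ = refl
  ... | no _  = refl

-- Density of the integer vectors without divisors in `[2, M]`.

module Density where

  open Sums
  open Vectors
  open Periodic
  open Rationals
  open import Defs using (ζ-partial; ζ-term; ζ-partial-upper)
  open import Data.List.Membership.Propositional using (find)
  open import Data.List.Relation.Unary.Any using (any?)
  open import Data.List.Relation.Unary.All as All using (All; []; _∷_; all?)
  import Data.List.Relation.Unary.All.Properties as All
  open import Data.Nat.Base
  open import Data.Nat.Divisibility
  open import Data.Nat.LCM using (lcm; m∣lcm[m,n]; n∣lcm[m,n]; lcm-least)
  open import Data.Nat.Properties
  open import Relation.Nullary.Decidable using (_×-dec_)

  ∣ᵛ-lcm : ∀ {d} m n {y : Vec ℤ d} → pos m ∣ᵛ y → pos n ∣ᵛ y → pos (lcm m n) ∣ᵛ y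
  ∣ᵛ-lcm m n {[]}    _ _ = dividesᵛ [] refl
  ∣ᵛ-lcm m n {y ∷ ys} (dividesᵛ (u ∷ us) refl) (dividesᵛ (v ∷ vs) eq)
    with ℤ.divides z eq′ ← ℤ.∣ᵤ⇒∣ {pos (lcm m n)} {pos m ℤ.* u} (lcm-least
      (ℤ.∣⇒∣ᵤ {pos m} {pos m ℤ.* u} (ℤ.∣m⇒∣m*n u ℤ.∣-refl))
      (ℤ.∣⇒∣ᵤ {pos n} (subst (pos n ℤ.∣_) (sym (cong Vec.head eq)) (ℤ.∣m⇒∣m*n v ℤ.∣-refl))))
    | dividesᵛ zs eq″ ← ∣ᵛ-lcm m n {pos m ⊙ us} (dividesᵛ us refl) (dividesᵛ vs (cong Vec.tail eq)) =
    dividesᵛ (z ∷ zs) (cong₂ _∷_ (trans eq′ (ℤ.*-comm z _)) eq″)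

  ∣ᵛ-*⁻ : ∀ {d} q .{{_ : NonZero q}} r {y : Vec ℤ d} → pos (q * r) ∣ᵛ pos q ⊙ y → pos r ∣ᵛ y
  ∣ᵛ-*⁻ q@(suc _) r {y} (dividesᵛ z eq) = dividesᵛ z (⊙-cancel (pos q) y (pos r ⊙ z)
    (trans eq (trans (cong (_⊙ z) (ℤ.pos-* q r)) (⊙-assoc (pos q) (pos r) z))))

  ∣ᵛ-*⁺ : ∀ {d} q r {y : Vec ℤ d} → pos r ∣ᵛ y → pos (q * r) ∣ᵛ pos q ⊙ y
  ∣ᵛ-*⁺ q r (dividesᵛ z refl) = dividesᵛ z (trans (sym (⊙-assoc (pos q) (pos r) z)) (cong (_⊙ z) (sym (ℤ.pos-* q r))))

  divides-periodic⁺ : ∀ {d q N} → q ∣ N → (x z : Vec ℤ d) → pos q ∣ᵛ x → pos q ∣ᵛ x ⊕ pos N ⊙ z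
  divides-periodic⁺ {N = N} q∣N x z q∣x = ∣ᵛ-⊕ q∣x (∣⇒∣ᵛ⊙ {c = pos N} z (ℤ.∣ᵤ⇒∣ q∣N))

  divides-periodic⁻ : ∀ {d q N} → q ∣ N → (x z : Vec ℤ d) → pos q ∣ᵛ x ⊕ pos N ⊙ z → pos q ∣ᵛ x
  divides-periodic⁻ {N = N} q∣N x z q∣x+Nz = ∣ᵛ-⊕⁻ q∣x+Nz (∣⇒∣ᵛ⊙ {c = pos N} z (ℤ.∣ᵤ⇒∣ q∣N))

  -- y is q times a vector without divisors in [2, M], where M = m + 1.
  Good : ∀ {d} → ℕ → ℕ → Vec ℤ d → Set
  Good m q y = (pos q ∣ᵛ y) × All (λ r → ¬ pos (q * r) ∣ᵛ y) (range 1 m)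

  good? : ∀ {d} m q (y : Vec ℤ d) → Dec (Good m q y)
  good? m q y = (pos q ∣ᵛ? y) ×-dec all? (λ r → ¬? (pos (q * r) ∣ᵛ? y)) (range 1 m)

  good-periodic : ∀ {d} m q {N} → q ∣ N → (∀ {r} → r ∈ range 1 m → q * r ∣ N) → Periodic {d} N (λ y → 𝟙 (good? m q y))
  good-periodic m q q∣N qr∣N x z = 𝟙-cong (good? m q _) (good? m q x)
    (λ (q∣y , rough) → divides-periodic⁻ q∣N x z q∣y , All.tabulate λ r∈ qr∣x → All.lookup rough r∈ (divides-periodic⁺ (qr∣N r∈) x z qr∣x))
    (λ (q∣x , rough) → divides-periodic⁺ q∣N x z q∣x , All.tabulate λ r∈ qr∣y → All.lookup rough r∈ (divides-periodic⁻ (qr∣N r∈) x z qr∣y))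

  divides-periodic : ∀ {d} q {N} → q ∣ N → Periodic {d} N (λ y → 𝟙 (pos q ∣ᵛ? y))
  divides-periodic q q∣N x z = 𝟙-cong (pos q ∣ᵛ? _) (pos q ∣ᵛ? x) (divides-periodic⁻ q∣N x z) (divides-periodic⁺ q∣N x z)

  -- Write `lcm q q′` as `r * q`. Then `q * r` divides `y`, and `r` divides `q′`, so `r ≤ M`. As
  -- `y / q` has no divisor in `[2, M]`, only `r = 1` remains.
  good-divides : ∀ {d} m {q q′} {y : Vec ℤ d} .{{_ : NonZero q}} .{{_ : NonZero q′}} → q′ ≤ suc m → Good m q y → Good m q′ y → q′ ∣ q
  good-divides m {q} {q′} {y} q′≤M (q∣y , rough) (q′∣y , _) with m∣lcm[m,n] q q′
  ... | divides r lcm≡ = conclude r lcm≡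
    where
    qr∣y : ∀ r → lcm q q′ ≡ r * q → pos (q * r) ∣ᵛ y
    qr∣y r lcm≡ = subst (λ n → pos n ∣ᵛ y) (trans lcm≡ (*-comm r q)) (∣ᵛ-lcm q q′ q∣y q′∣y)
    r∣q′ : ∀ r → lcm q q′ ≡ r * q → r ∣ q′
    r∣q′ r lcm≡ = *-cancelˡ-∣ q (subst (_∣ q * q′) (trans lcm≡ (*-comm r q)) (lcm-least {q} (m∣m*n q′) (n∣m*n q)))
    conclude : ∀ r → lcm q q′ ≡ r * q → q′ ∣ q
    conclude zero lcm≡ = contradiction (0∣⇒≡0 (r∣q′ zero lcm≡)) (≢-nonZero⁻¹ q′)
    conclude (suc zero) lcm≡ = subst (q′ ∣_) (trans lcm≡ (*-identityˡ q)) (n∣lcm[m,n] q q′)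
    conclude r@(suc (suc _)) lcm≡ = contradiction (qr∣y r lcm≡)
      (All.lookup rough (∈-range⁺ 1 m (s≤s (s≤s z≤n)) (≤-trans (∣⇒≤ (r∣q′ r lcm≡)) q′≤M)))

  ∑-range-≤1 : ∀ n {P : ℕ → Set} (P? : ∀ q → Dec (P q)) →
    (∀ {q q′} → q ∈ range 0 n → q′ ∈ range 0 n → P q → P q′ → q ≡ q′) → ∑ (range 0 n) (λ q → 𝟙 (P? q)) ≤ 1
  ∑-range-≤1 zero    P? unique = z≤n
  ∑-range-≤1 (suc n) P? unique with P? (suc n)
  ... | no _  = ∑-range-≤1 n P? (λ q∈ q′∈ → unique (there q∈) (there q′∈))
  ... | yes p = ≤-reflexive (cong suc (∑-zero (range 0 n) λ {q} q∈ → 𝟙-no (P? q) λ p′ →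
    <⇒≢ (s≤s (proj₂ (∈-range⁻ 0 n q∈))) (unique (there q∈) (here refl) p′ p)))

  range-nonZero : ∀ k n {q} → q ∈ range k n → NonZero q
  range-nonZero k n q∈ = >-nonZero (≤-<-trans z≤n (proj₁ (∈-range⁻ k n q∈)))

  good-unique : ∀ {d} m (y : Vec ℤ d) → ∑ (range 0 (suc m)) (λ q → 𝟙 (good? m q y)) ≤ 1
  good-unique m y = ∑-range-≤1 (suc m) (λ q → good? m q y) λ {q} {q′} q∈ q′∈ good good′ →
    let instance
          _ = range-nonZero 0 (suc m) q∈
          _ = range-nonZero 0 (suc m) q′∈
    in ∣-antisym (good-divides m (proj₂ (∈-range⁻ 0 (suc m) q∈)) good′ good)
                 (good-divides m (proj₂ (∈-range⁻ 0 (suc m) q′∈)) good good′)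

  -- Starting from q = 1, multiply q by divisors in [2, M] of y / q; the first q beyond M is at most M².
  good-exists : ∀ {d} m (y : Vec ℤ d) → let M = suc m in
    (∃[ q ] q ∈ range 0 M × Good m q y) ⊎ (∃[ q ] q ∈ range M (M * M ∸ M) × pos q ∣ᵛ y)
  good-exists m y = search M 1 (s≤s z≤n) (s≤s z≤n) ≤-refl (dividesᵛ y (sym (⊙-identity y)))
    where
    M = suc m
    search : ∀ fuel q → 1 ≤ q → q ≤ M → M < q + fuel → pos q ∣ᵛ y →
      (∃[ q ] q ∈ range 0 M × Good m q y) ⊎ (∃[ q ] q ∈ range M (M * M ∸ M) × pos q ∣ᵛ y)
    search zero       q 1≤q q≤M M<q+t q∣y = contradiction (subst (M <_) (+-identityʳ q) M<q+t) (≤⇒≯ q≤M)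
    search (suc fuel) q 1≤q q≤M M<q+t q∣y with any? (λ r → pos (q * r) ∣ᵛ? y) (range 1 m)
    ... | no none = inj₁ (q , ∈-range⁺ 0 M 1≤q q≤M , q∣y , All.¬Any⇒All¬ _ none)
    ... | yes some with r , r∈ , qr∣y ← find some with 1<r , r≤M ← ∈-range⁻ 1 m r∈ with q * r ≤? M
    ...   | no qr≰M = inj₂ (q * r , ∈-range⁺ M (M * M ∸ M) (≰⇒> qr≰M)
      (subst (q * r ≤_) (sym (m+[n∸m]≡n (m≤m*n M M))) (*-mono-≤ q≤M r≤M)) , qr∣y)
    ...   | yes qr≤M = search fuel (q * r) (≤-trans 1≤q (<⇒≤ q<qr)) qr≤M
      (<-≤-trans (subst (M <_) (+-suc q fuel) M<q+t) (+-monoˡ-≤ fuel q<qr)) qr∣y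
      where
      q<qr : q < q * r
      q<qr = m<m*n q r {{>-nonZero 1≤q}} 1<r

  good-covers : ∀ {d} m (y : Vec ℤ d) → let M = suc m in
    1 ≤ ∑ (range 0 M) (λ q → 𝟙 (good? m q y)) + ∑ (range M (M * M ∸ M)) (λ q → 𝟙 (pos q ∣ᵛ? y))
  good-covers m y with good-exists m y
  ... | inj₁ (q , q∈ , good) = ≤-trans (1≤𝟙 (good? m q y) good) (≤-trans (∑-∈ (range 0 (suc m)) (λ q → 𝟙 (good? m q y)) q∈) (m≤m+n _ _))
  ... | inj₂ (q , q∈ , q∣y)  = ≤-trans (1≤𝟙 (pos q ∣ᵛ? y) q∣y) (≤-trans (∑-∈ (range (suc m) _) (λ q → 𝟙 (pos q ∣ᵛ? y)) q∈) (m≤n+m _ _))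

  cube : ∀ e → ℕ → List (Vec ℤ e)
  cube e n = box (0ᵛ {e}) n

  ∑-box-multiples : ∀ {e} q .{{_ : NonZero q}} N (f : Vec ℤ e → ℕ) → (∀ x → ¬ pos q ∣ᵛ x → f x ≡ 0) →
    ∑ (cube e (N * q)) f ≡ ∑ (cube e N) (λ x → f (pos q ⊙ x))
  ∑-box-multiples {e} q N f vanish = subst (λ b → ∑ (box b (N * q)) f ≡ ∑ (cube e N) (λ x → f (pos q ⊙ x))) (⊙-zeroʳ (pos q)) (box-multiples q f vanish 0ᵛ N)

  ^-distribʳ-* : ∀ e m n → (m * n) ^ e ≡ m ^ e * n ^ e
  ^-distribʳ-* zero    m n = refl
  ^-distribʳ-* (suc e) m n = trans (cong (m * n *_) (^-distribʳ-* e m n)) ([m*n]*[o*p]≡[m*o]*[n*p] m n (m ^ e) (n ^ e))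

  count-divides : ∀ {e} q .{{_ : NonZero q}} {L} → q ∣ L → q ^ e * ∑ (cube e L) (λ y → 𝟙 (pos q ∣ᵛ? y)) ≡ L ^ e
  count-divides {e} q (divides N refl) = begin
    q ^ e * ∑ (cube e (N * q)) (λ y → 𝟙 (pos q ∣ᵛ? y))      ≡⟨ cong (q ^ e *_) (∑-box-multiples {e} q N _ (λ x → 𝟙-no (pos q ∣ᵛ? x))) ⟩
    q ^ e * ∑ (cube e N) (λ y → 𝟙 (pos q ∣ᵛ? pos q ⊙ y))    ≡⟨ cong (q ^ e *_) (∑-cong (cube e N) (λ y → 𝟙-yes (pos q ∣ᵛ? _) (dividesᵛ y refl))) ⟩
    q ^ e * ∑ (cube e N) (λ y → 1)                          ≡⟨ cong (q ^ e *_) (trans (∑-box-const (0ᵛ {e}) N 1) (*-identityʳ (N ^ e))) ⟩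
    q ^ e * N ^ e                                           ≡⟨ *-comm (q ^ e) (N ^ e) ⟩
    N ^ e * q ^ e                                           ≡⟨ ^-distribʳ-* e N q ⟨
    (N * q) ^ e                                             ∎
    where open ≡-Reasoning

  -- The vectors that are good for `q` in the cube of side `N * q` are `q` times those good for 1 in
  -- the cube of side `N`. Being good for 1 is periodic modulo `N`, so `q ^ e` copies of the small
  -- cube fill the large one.
  count-good : ∀ {e} m q .{{_ : NonZero q}} N → (∀ {r} → r ∈ range 1 m → r ∣ N) →
    q ^ e * ∑ (cube e (N * q)) (λ y → 𝟙 (good? m q y)) ≡ ∑ (cube e (N * q)) (λ y → 𝟙 (good? m 1 y))
  count-good {e} m q N r∣N = begin
    q ^ e * ∑ (cube e (N * q)) (λ y → 𝟙 (good? m q y))     ≡⟨ cong (q ^ e *_) (∑-box-multiples {e} q N _ (λ x q∤x → 𝟙-no (good? m q x) (q∤x ∘ proj₁))) ⟩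
    q ^ e * ∑ (cube e N) (λ y → 𝟙 (good? m q (pos q ⊙ y))) ≡⟨ cong (q ^ e *_) (∑-cong (cube e N) scale) ⟩
    q ^ e * ∑ (cube e N) (λ y → 𝟙 (good? m 1 y))           ≡⟨ box-tile {e} {N} {λ y → 𝟙 (good? m 1 y)} (good-periodic m 1 (1∣ N) (λ {r} r∈ → subst (_∣ N) (sym (*-identityˡ r)) (r∣N r∈))) 0ᵛ q ⟨
    ∑ (cube e (q * N)) (λ y → 𝟙 (good? m 1 y))             ≡⟨ cong (λ L → ∑ (cube e L) (λ y → 𝟙 (good? m 1 y))) (*-comm q N) ⟩
    ∑ (cube e (N * q)) (λ y → 𝟙 (good? m 1 y))             ∎
    where
    open ≡-Reasoning
    scale : ∀ (y : Vec ℤ e) → 𝟙 (good? m q (pos q ⊙ y)) ≡ 𝟙 (good? m 1 y)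
    scale y = 𝟙-cong (good? m q (pos q ⊙ y)) (good? m 1 y)
      (λ (_ , rough) → dividesᵛ y (sym (⊙-identity y)) , All.map (λ {r} ∤ 1r∣y → ∤ (∣ᵛ-*⁺ q r (subst (λ n → pos n ∣ᵛ y) (*-identityˡ r) 1r∣y))) rough)
      (λ (_ , rough) → dividesᵛ y refl , All.map (λ {r} ∤ qr∣qy → ∤ (subst (λ n → pos n ∣ᵛ y) (sym (*-identityˡ r)) (∣ᵛ-*⁻ q r qr∣qy))) rough)

  ∣! : ∀ {k n} → k ≤ n → .{{_ : NonZero k}} → k ∣ n !
  ∣! {suc k} k≤n = ∣-trans (m∣m*n (k !)) (m≤n⇒m!∣n! k≤n)

  -- A multiple of q r for all q, r ≤ M and of all q ≤ M², where M = m + 1.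
  modulus : ℕ → ℕ
  modulus m = (suc m) ! * (suc m * suc m) !

  modulus-factor : ∀ m q → q ∈ range 0 (suc m) → ∃[ N ] modulus m ≡ N * q × (∀ {r} → r ∈ range 1 m → r ∣ N)
  modulus-factor m q q∈ with _ , q≤M ← ∈-range⁻ 0 (suc m) q∈ with divides x M!≡xq ← ∣! q≤M {{range-nonZero 0 (suc m) q∈}} =
    x * F , trans (cong (_* F) M!≡xq) (trans (*-assoc x q F) (trans (cong (x *_) (*-comm q F)) (sym (*-assoc x F q)))) ,
    λ {r} r∈ → ∣-trans (∣! (≤-trans (proj₂ (∈-range⁻ 1 m r∈)) (m≤m*n (suc m) (suc m))) {{range-nonZero 1 m r∈}}) (n∣m*n x)
    where
    F = (suc m * suc m) !

  modulus-divisible : ∀ m q .{{_ : NonZero q}} → q ≤ suc m * suc m → q ∣ modulus m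
  modulus-divisible m q q≤M² = ∣-trans (∣! q≤M²) (n∣m*n ((suc m) !))

  -- The hypothesis makes each `f q` equal to `x / q^e`, so the sum of `f` is `x` times a segment of
  -- the series for ζ(e).
  ζ-partial-∑ : ∀ e k n f x → (∀ {q} → q ∈ range k n → q ^ e * f q ≡ x) →
    ζ-partial e (k + n) ℚ.* ιₙ x ≡ ζ-partial e k ℚ.* ιₙ x ℚ.+ ιₙ (∑ (range k n) f)
  ζ-partial-∑ e k zero f x h = trans (cong (λ j → ζ-partial e j ℚ.* ιₙ x) (+-identityʳ k)) (sym (trans (cong (ζ-partial e k ℚ.* ιₙ x ℚ.+_) ιₙ-zero) (ℚ.+-identityʳ _)))
  ζ-partial-∑ e k (suc n) f x h = begin
    ζ-partial e (k + suc n) ℚ.* ιₙ x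
      ≡⟨ cong (λ j → ζ-partial e j ℚ.* ιₙ x) (+-suc k n) ⟩
    (ζ-partial e (k + n) ℚ.+ ζ-term e (suc (k + n))) ℚ.* ιₙ x
      ≡⟨ ℚ.*-distribʳ-+ (ιₙ x) (ζ-partial e (k + n)) (ζ-term e (suc (k + n))) ⟩
    ζ-partial e (k + n) ℚ.* ιₙ x ℚ.+ ζ-term e (suc (k + n)) ℚ.* ιₙ x
      ≡⟨ cong₂ ℚ._+_ (ζ-partial-∑ e k n f x (h ∘ there)) (ζ-term-* e (suc (k + n)) (h (here refl))) ⟩
    ζ-partial e k ℚ.* ιₙ x ℚ.+ ιₙ (∑ (range k n) f) ℚ.+ ιₙ (f (suc (k + n)))
      ≡⟨ ℚ.+-assoc (ζ-partial e k ℚ.* ιₙ x) _ _ ⟩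
    ζ-partial e k ℚ.* ιₙ x ℚ.+ (ιₙ (∑ (range k n) f) ℚ.+ ιₙ (f (suc (k + n))))
      ≡⟨ cong (ζ-partial e k ℚ.* ιₙ x ℚ.+_) (trans (sym (ιₙ-+ (∑ (range k n) f) _)) (cong ιₙ (+-comm (∑ (range k n) f) _))) ⟩
    ζ-partial e k ℚ.* ιₙ x ℚ.+ ιₙ (∑ (range k (suc n)) f) ∎
    where open ≡-Reasoning

  module _ (e m : ℕ) where
    private
      M = suc m
      L = modulus m
      A B : ℕ → ℕ
      A q = ∑ (cube e L) (λ y → 𝟙 (good? m q y))
      B q = ∑ (cube e L) (λ y → 𝟙 (pos q ∣ᵛ? y))

    -- Divided by `modulus m ^ e`, this is the density `ρ` of the vectors without divisors in
    -- `[2, M]`.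
    roughCount : ℕ
    roughCount = ∑ (cube e (modulus m)) (λ y → 𝟙 (good? m 1 y))

    private
      total : ∑ (cube e L) (λ _ → 1) ≡ L ^ e
      total = trans (∑-box-const (0ᵛ {e}) L 1) (*-identityʳ (L ^ e))

      A-scaled : ∀ {q} → q ∈ range 0 M → q ^ e * A q ≡ roughCount
      A-scaled {q} q∈ with N , L≡ , r∣N ← modulus-factor m q q∈ =
        subst (λ L → q ^ e * ∑ (cube e L) (λ y → 𝟙 (good? m q y)) ≡ ∑ (cube e L) (λ y → 𝟙 (good? m 1 y)))
          (sym L≡) (count-good {e} m q {{range-nonZero 0 M q∈}} N r∣N)

      M≤M² : M ≤ M * M
      M≤M² = m≤m*n M M

      B-scaled : ∀ {q} → q ∈ range M (M * M ∸ M) → q ^ e * B q ≡ L ^ e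
      B-scaled {q} q∈ = count-divides {e} q (modulus-divisible m q (subst (q ≤_) (m+[n∸m]≡n M≤M²) (proj₂ (∈-range⁻ M (M * M ∸ M) q∈))))
        where instance _ = range-nonZero M (M * M ∸ M) q∈

      ζA : ζ-partial e M ℚ.* ιₙ roughCount ≡ ιₙ (∑ (range 0 M) A)
      ζA = trans (ζ-partial-∑ e 0 M A roughCount A-scaled)
        (trans (cong (ℚ._+ ιₙ (∑ (range 0 M) A)) (ℚ.*-zeroˡ (ιₙ roughCount))) (ℚ.+-identityˡ _))

    roughCount-upper : ζ-partial e (suc m) ℚ.* ιₙ roughCount ℚ.≤ ιₙ (modulus m ^ e)
    roughCount-upper = subst (ℚ._≤ ιₙ (L ^ e)) (sym ζA) (ιₙ-mono-≤ (begin
      ∑ (range 0 M) A                                               ≡⟨ ∑-swap (range 0 M) (cube e L) _ ⟩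
      ∑ (cube e L) (λ y → ∑ (range 0 M) (λ q → 𝟙 (good? m q y)))    ≤⟨ ∑-mono (cube e L) (good-unique m) ⟩
      ∑ (cube e L) (λ _ → 1)                                        ≡⟨ total ⟩
      L ^ e                                                         ∎))
      where open ≤-Reasoning

    roughCount-lower : 2 ≤ e → ιₙ (modulus m ^ e) ℚ.≤ ζ-partial e (suc m) ℚ.* ιₙ roughCount ℚ.+ (1ℤ ℚ./ suc m) ℚ.* ιₙ (modulus m ^ e)
    roughCount-lower 2≤e = begin
      ιₙ (L ^ e)
        ≤⟨ ιₙ-mono-≤ cover ⟩
      ιₙ (∑ (range 0 M) A + ∑ (range M (M * M ∸ M)) B)
        ≡⟨ ιₙ-+ (∑ (range 0 M) A) _ ⟩
      ιₙ (∑ (range 0 M) A) ℚ.+ ιₙ (∑ (range M (M * M ∸ M)) B)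
        ≤⟨ ℚ.+-mono-≤ (ℚ.≤-reflexive (sym ζA)) B-bound ⟩
      ζ-partial e M ℚ.* ιₙ roughCount ℚ.+ (1ℤ ℚ./ M) ℚ.* ιₙ (L ^ e) ∎
      where
      open ℚ.≤-Reasoning
      open +-*-Solver
      cover : L ^ e ≤ ∑ (range 0 M) A + ∑ (range M (M * M ∸ M)) B
      cover = subst₂ _≤_ total
        (trans (∑-+ (cube e L) _ _) (cong₂ _+_ (∑-swap (cube e L) (range 0 M) _) (∑-swap (cube e L) (range M (M * M ∸ M)) _)))
        (∑-mono (cube e L) (good-covers m))
      -- Adding and subtracting the partial sum up to `M` turns the sum over `(M, M²]` into a
      -- segment of the series beyond `M`, which is at most `1 / M`.
      B-bound : ιₙ (∑ (range M (M * M ∸ M)) B) ℚ.≤ (1ℤ ℚ./ M) ℚ.* ιₙ (L ^ e)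
      B-bound = begin
        ιₙ (∑ (range M (M * M ∸ M)) B)
          ≡⟨ solve 2 (λ z b → b := :- z :+ (z :+ b)) refl (ζ-partial e M ℚ.* ιₙ (L ^ e)) _ ⟩
        ℚ.- (ζ-partial e M ℚ.* ιₙ (L ^ e)) ℚ.+ (ζ-partial e M ℚ.* ιₙ (L ^ e) ℚ.+ ιₙ (∑ (range M (M * M ∸ M)) B))
          ≡⟨ cong (ℚ.- (ζ-partial e M ℚ.* ιₙ (L ^ e)) ℚ.+_) (ζ-partial-∑ e M (M * M ∸ M) B (L ^ e) B-scaled) ⟨
        ℚ.- (ζ-partial e M ℚ.* ιₙ (L ^ e)) ℚ.+ ζ-partial e (M + (M * M ∸ M)) ℚ.* ιₙ (L ^ e)
          ≤⟨ ℚ.+-monoʳ-≤ (ℚ.- (ζ-partial e M ℚ.* ιₙ (L ^ e))) (*-monoʳ-ι (L ^ e)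
               (ζ-partial-upper 2≤e {m} {M + (M * M ∸ M)} (m≤m+n M (M * M ∸ M)))) ⟩
        ℚ.- (ζ-partial e M ℚ.* ιₙ (L ^ e)) ℚ.+ (ζ-partial e M ℚ.+ 1ℤ ℚ./ M) ℚ.* ιₙ (L ^ e)
          ≡⟨ solve 3 (λ z i x → :- (z :* x) :+ (z :+ i) :* x := i :* x) refl (ζ-partial e M) (1ℤ ℚ./ M) (ιₙ (L ^ e)) ⟩
        (1ℤ ℚ./ M) ℚ.* ιₙ (L ^ e) ∎

-- Frequencies of periodic conditions on `φ · x` in boxes of arbitrary side.

module Sieve where

  open Sums
  open Vectors
  open Periodic
  open Density
  open import Data.Nat.Base
  open import Data.Nat.Divisibility
  open import Data.Nat.DivMod using (_/_; _%_; m≡m%n+[m/n]*n; m%n<n; m/n*n≤m)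
  open import Data.Nat.Properties
  open import Algebra.Properties.CommutativeSemigroup *-commutativeSemigroup using (x∙yz≈y∙xz)

  modulus-nonZero : ∀ m → NonZero (modulus m)
  modulus-nonZero m = m*n≢0 (suc m !) ((suc m * suc m) !) {{n!≢0 (suc m)}} {{n!≢0 (suc m * suc m)}}
    where
    n!≢0 : ∀ n → NonZero (n !)
    n!≢0 zero    = _
    n!≢0 (suc n) = m*n≢0 (suc n) (n !) {{_}} {{n!≢0 n}}

  n≤[1+n/q]q : ∀ n q .{{_ : NonZero q}} → n ≤ suc (n / q) * q
  n≤[1+n/q]q n q = begin
    n                       ≡⟨ m≡m%n+[m/n]*n n q ⟩
    n % q + n / q * q       ≤⟨ +-monoˡ-≤ _ (<⇒≤ (m%n<n n q)) ⟩
    q + n / q * q           ∎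
    where open ≤-Reasoning

  module _ {d e} (M : Vec (Vec ℤ d) e) (σ : Vec ℤ e → Vec ℤ d) (section : ∀ y → M · σ y ≡ y) where

    ∑-periods : ∀ {q} {f : Vec ℤ e → ℕ} → Periodic q f → ∀ b c t →
      q ^ e * ∑ (box b (t * q)) (f ∘ (M ·_)) ≡ (t * q) ^ d * ∑ (box c q) f
    ∑-periods {q} {f} periodic b c t = begin
      q ^ e * ∑ (box b (t * q)) (f ∘ (M ·_))          ≡⟨ cong (q ^ e *_) (box-tile {d} {q} (periodic-pullback {q = q} {f} M periodic) b t) ⟩
      q ^ e * (t ^ d * ∑ (box b q) (f ∘ (M ·_)))      ≡⟨ x∙yz≈y∙xz (q ^ e) (t ^ d) _ ⟩
      t ^ d * (q ^ e * ∑ (box b q) (f ∘ (M ·_)))      ≡⟨ cong (t ^ d *_) (equidistribution M σ section periodic b c) ⟩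
      t ^ d * (q ^ d * ∑ (box c q) f)                 ≡⟨ *-assoc (t ^ d) (q ^ d) _ ⟨
      t ^ d * q ^ d * ∑ (box c q) f                   ≡⟨ cong (_* ∑ (box c q) f) (^-distribʳ-* d t q) ⟨
      (t * q) ^ d * ∑ (box c q) f                     ∎
      where open ≡-Reasoning

    -- Rounding the side up to a multiple of `q` makes the count exact; the lower bound rounds down
    -- instead.
    ∑-periodic-upper : ∀ {q} .{{_ : NonZero q}} {f : Vec ℤ e → ℕ} → Periodic q f → ∀ b c n →
      q ^ e * ∑ (box b n) (f ∘ (M ·_)) ≤ (n + q) ^ d * ∑ (box c q) f
    ∑-periodic-upper {q} {f} periodic b c n = begin
      q ^ e * ∑ (box b n) (f ∘ (M ·_))                    ≤⟨ *-monoʳ-≤ (q ^ e) (∑-box-mono-side b _ (n≤[1+n/q]q n q)) ⟩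
      q ^ e * ∑ (box b (suc (n / q) * q)) (f ∘ (M ·_))    ≡⟨ ∑-periods periodic b c (suc (n / q)) ⟩
      (suc (n / q) * q) ^ d * ∑ (box c q) f               ≤⟨ *-monoˡ-≤ _ (^-monoˡ-≤ d side≤) ⟩
      (n + q) ^ d * ∑ (box c q) f                         ∎
      where
      open ≤-Reasoning
      side≤ : suc (n / q) * q ≤ n + q
      side≤ = ≤-trans (+-monoʳ-≤ q (m/n*n≤m n q)) (≤-reflexive (+-comm q n))

    ∑-periodic-lower : ∀ {q} .{{_ : NonZero q}} {f : Vec ℤ e → ℕ} → Periodic q f → ∀ b c n →
      (n ∸ q) ^ d * ∑ (box c q) f ≤ q ^ e * ∑ (box b n) (f ∘ (M ·_))
    ∑-periodic-lower {q} {f} periodic b c n = begin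
      (n ∸ q) ^ d * ∑ (box c q) f                   ≤⟨ *-monoˡ-≤ _ (^-monoˡ-≤ d ≤side) ⟩
      (n / q * q) ^ d * ∑ (box c q) f               ≡⟨ ∑-periods periodic b c (n / q) ⟨
      q ^ e * ∑ (box b (n / q * q)) (f ∘ (M ·_))    ≤⟨ *-monoʳ-≤ (q ^ e) (∑-box-mono-side b _ (m/n*n≤m n q)) ⟩
      q ^ e * ∑ (box b n) (f ∘ (M ·_))              ∎
      where
      open ≤-Reasoning
      ≤side : n ∸ q ≤ n / q * q
      ≤side = ≤-trans (∸-monoˡ-≤ q (n≤[1+n/q]q n q)) (≤-reflexive (m+n∸m≡n q (n / q * q)))

    -- For `q ≤ n` the rounded side is at most `2 * n`, a loss of a factor `2 ^ d` independent of
    -- `q`. Beyond `n` this loss is unbounded, so larger primes need another argument.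
    count-divides-upper : ∀ q .{{_ : NonZero q}} b n → q ≤ n →
      q ^ e * ∑ (box b n) (λ x → 𝟙 (pos q ∣ᵛ? M · x)) ≤ (2 * n) ^ d
    count-divides-upper q b n q≤n = begin
      q ^ e * ∑ (box b n) (λ x → 𝟙 (pos q ∣ᵛ? M · x))      ≤⟨ ∑-periodic-upper (divides-periodic q ∣-refl) b 0ᵛ n ⟩
      (n + q) ^ d * ∑ (cube e q) (λ y → 𝟙 (pos q ∣ᵛ? y))   ≡⟨ cong ((n + q) ^ d *_) one ⟩
      (n + q) ^ d * 1                                      ≡⟨ *-identityʳ _ ⟩
      (n + q) ^ d                                          ≤⟨ ^-monoˡ-≤ d (+-monoʳ-≤ n (≤-trans q≤n (≤-reflexive (sym (+-identityʳ n))))) ⟩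
      (2 * n) ^ d                                          ∎
      where
      open ≤-Reasoning
      one : ∑ (cube e q) (λ y → 𝟙 (pos q ∣ᵛ? y)) ≡ 1
      one = *-cancelˡ-≡ _ 1 (q ^ e) {{m^n≢0 q e}} (trans (count-divides {e} q ∣-refl) (sym (*-identityʳ _)))

    rough-periodic : ∀ m → Periodic {e} (modulus m) (λ y → 𝟙 (good? m 1 y))
    rough-periodic m = good-periodic m 1 (1∣ modulus m) λ {r} r∈ → subst (_∣ modulus m) (sym (*-identityˡ r))
      (modulus-divisible m r {{range-nonZero 1 m r∈}} (≤-trans (proj₂ (∈-range⁻ 1 m r∈)) (m≤m*n (suc m) (suc m))))

    count-rough-upper : ∀ m b n → modulus m ^ e * ∑ (box b n) (λ x → 𝟙 (good? m 1 (M · x))) ≤ (n + modulus m) ^ d * roughCount e m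
    count-rough-upper m b n = ∑-periodic-upper {{modulus-nonZero m}} (rough-periodic m) b 0ᵛ n

    count-rough-lower : ∀ m b n → (n ∸ modulus m) ^ d * roughCount e m ≤ modulus m ^ e * ∑ (box b n) (λ x → 𝟙 (good? m 1 (M · x)))
    count-rough-lower m b n = ∑-periodic-lower {{modulus-nonZero m}} (rough-periodic m) b 0ᵛ n

-- Fraction-free elimination with polynomial bounds on the coefficients.

module Elimination where

  open Vectors
  open import Data.Fin.Base using (punchIn)
  open import Data.Fin.Properties using (punchIn-injective; punchInᵢ≢i; any?)
  open import Data.Integer.Base using (-_; _+_; _*_)
  open import Data.Integer.Properties using (_≟_)
  open import Data.Nat.Base using (_≤_; z≤n; _^_)
  open import Data.Vec.Base using (lookup)
  open import Data.Vec.Properties using (lookup-zipWith; lookup-map)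
  open import Data.Vec.Relation.Unary.All using (All; []; _∷_)
  open import Function.Base using (id)
  open import Relation.Nullary.Decidable using (decidable-stable)

  Bounded : ∀ {d} → ℕ → Vec ℤ d → Set
  Bounded B x = ∀ i → abs (lookup x i) ≤ B

  abs-∙ : ∀ {d} {C B} (r x : Vec ℤ d) → Bounded C r → Bounded B x → abs (r ∙ x) ≤ d ℕ.* (C ℕ.* B)
  abs-∙ []       []       r≤C x≤B = z≤n
  abs-∙ (r ∷ rs) (x ∷ xs) r≤C x≤B = ℕ.≤-trans (ℤ.∣i+j∣≤∣i∣+∣j∣ (r * x) (rs ∙ xs)) (ℕ.+-mono-≤
    (ℕ.≤-trans (ℕ.≤-reflexive (ℤ.abs-* r x)) (ℕ.*-mono-≤ (r≤C Fin.zero) (x≤B Fin.zero)))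
    (abs-∙ rs xs (r≤C ∘ Fin.suc) (x≤B ∘ Fin.suc)))

  -- A fully reduced system of r equations for the span of S: up to a common factor Δ,
  -- each form is solved for its own pivot coordinate.
  record Forms {k d} (S : Vec (Vec ℤ d) k) (r C : ℕ) : Set where
    field
      Δ        : ℤ
      Δ≢0      : Δ ≢ 0ℤ
      pivot    : Fin r → Fin d
      ψ        : Fin r → Vec ℤ d
      diagonal : ∀ a → lookup (ψ a) (pivot a) ≡ Δ
      off      : ∀ {a b} → a ≢ b → lookup (ψ a) (pivot b) ≡ 0ℤ
      kills    : ∀ a → All (λ s → ψ a ∙ s ≡ 0ℤ) S
      bound    : ∀ a → Bounded C (ψ a)

  initial-forms : ∀ {d} → Forms {d = d} [] d 1
  initial-forms = record
    { Δ = 1ℤ ; Δ≢0 = λ () ; pivot = id ; ψ = unit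
    ; diagonal = lookup-unit-diagonal ; off = lookup-unit-off ; kills = λ _ → [] ; bound = bounded }
    where
    bounded : ∀ {d} (a : Fin d) → Bounded 1 (unit a)
    bounded a i with a Fin.≟ i
    ... | yes refl = ℕ.≤-reflexive (cong abs (lookup-unit-diagonal a))
    ... | no a≢i   = ℕ.≤-trans (ℕ.≤-reflexive (cong abs (lookup-unit-off a≢i))) z≤n

  -- Both `p` and `v a` are values of forms at `s`, at most `d * (C * B)`, and each multiplies a
  -- coefficient at most `C`. The separate `C` covers the case where the forms are kept as they are.
  nextBound : ℕ → ℕ → ℕ → ℕ
  nextBound d B C = C ℕ.+ (d ℕ.* (C ℕ.* B) ℕ.* C ℕ.+ d ℕ.* (C ℕ.* B) ℕ.* C)

  -- A form `ψ a₀` that is nonzero at `s` is sacrificed to clear the values of the others at `s`. It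
  -- vanishes at their pivots, so every diagonal entry is just multiplied by the same `p`: the new
  -- forms again share one `Δ` and stay fully reduced.
  eliminate : ∀ {k d r C B} {S : Vec (Vec ℤ d) k} → Forms S (suc r) C → ∀ s → Bounded B s → Forms (s ∷ S) r (nextBound d B C)
  eliminate {d = d} {r} {C} {B} {S} forms s s≤B with any? (λ a → ¬? (Forms.ψ forms a ∙ s ≟ 0ℤ))
  -- All forms already kill `s`; one is dropped only to reach the required number.
  ... | no all-zero = record
    { Δ = Δ ; Δ≢0 = Δ≢0 ; pivot = pivot ∘ Fin.suc ; ψ = ψ ∘ Fin.suc
    ; diagonal = diagonal ∘ Fin.suc ; off = λ a≢b → off (a≢b ∘ Fin.suc-injective)
    ; kills = λ a → decidable-stable (ψ (Fin.suc a) ∙ s ≟ 0ℤ) (λ ≢0 → all-zero (Fin.suc a , ≢0)) ∷ kills (Fin.suc a)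
    ; bound = λ a i → ℕ.≤-trans (bound (Fin.suc a) i) (ℕ.m≤m+n C _) }
    where open Forms forms
  ... | yes (a₀ , p≢0) = record
    { Δ = p * Δ ; Δ≢0 = λ eq → p≢0 (nonZero-factor eq) ; pivot = pivot ∘ punchIn a₀ ; ψ = ψ′
    ; diagonal = λ a → trans (entry a (pivot (punchIn a₀ a))) (combine (v a) (diagonal (punchIn a₀ a)) (off (punchInᵢ≢i a₀ a ∘ sym)))
    ; off = λ {a} {b} a≢b → trans (entry a (pivot (punchIn a₀ b)))
        (trans (combine (v a) (off (a≢b ∘ punchIn-injective a₀ a b)) (off (punchInᵢ≢i a₀ b ∘ sym))) (ℤ.*-zeroʳ p))
    ; kills = λ a → trans (∙-ψ′ a s) (cancel p (v a)) ∷ kills′ a (kills (punchIn a₀ a)) (kills a₀)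
    ; bound = bound′ }
    where
    open Forms forms
    p = ψ a₀ ∙ s
    v : Fin r → ℤ
    v a = ψ (punchIn a₀ a) ∙ s
    ψ′ : Fin r → Vec ℤ d
    ψ′ a = p ⊙ ψ (punchIn a₀ a) ⊕ (- v a) ⊙ ψ a₀
    entry : ∀ a i → lookup (ψ′ a) i ≡ p * lookup (ψ (punchIn a₀ a)) i + - v a * lookup (ψ a₀) i
    entry a i = trans (lookup-zipWith _+_ i (p ⊙ ψ (punchIn a₀ a)) _)
      (cong₂ _+_ (lookup-map i (p *_) (ψ (punchIn a₀ a))) (lookup-map i (- v a *_) (ψ a₀)))
    combine : ∀ w {x y z} → x ≡ y → z ≡ 0ℤ → p * x + - w * z ≡ p * y
    combine w {x} refl refl = trans (cong (p * x +_) (ℤ.*-zeroʳ (- w))) (ℤ.+-identityʳ _)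
    ∙-ψ′ : ∀ a x → ψ′ a ∙ x ≡ p * (ψ (punchIn a₀ a) ∙ x) + - v a * (ψ a₀ ∙ x)
    ∙-ψ′ a x = trans (∙-⊕ˡ (p ⊙ ψ (punchIn a₀ a)) ((- v a) ⊙ ψ a₀) x)
      (cong₂ _+_ (∙-⊙ˡ p (ψ (punchIn a₀ a)) x) (∙-⊙ˡ (- v a) (ψ a₀) x))
    cancel : ∀ p v → p * v + - v * p ≡ 0ℤ
    cancel = solve-∀
    kills′ : ∀ {k} {S : Vec (Vec ℤ d) k} a → All (λ s → ψ (punchIn a₀ a) ∙ s ≡ 0ℤ) S → All (λ s → ψ a₀ ∙ s ≡ 0ℤ) S → All (λ s → ψ′ a ∙ s ≡ 0ℤ) S
    kills′ a []       []       = []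
    kills′ {S = x ∷ S} a (u ∷ us) (w ∷ ws) = trans (∙-ψ′ a x) (trans (combine (v a) u w) (ℤ.*-zeroʳ p)) ∷ kills′ a us ws
    nonZero-factor : p * Δ ≡ 0ℤ → p ≡ 0ℤ
    nonZero-factor eq with ℤ.i*j≡0⇒i≡0∨j≡0 p eq
    ... | inj₁ p≡0 = p≡0
    ... | inj₂ Δ≡0 = contradiction Δ≡0 Δ≢0
    bound′ : ∀ a → Bounded (nextBound d B C) (ψ′ a)
    bound′ a i = begin
      abs (lookup (ψ′ a) i)
        ≡⟨ cong abs (entry a i) ⟩
      abs (p * lookup (ψ (punchIn a₀ a)) i + - v a * lookup (ψ a₀) i)
        ≤⟨ ℤ.∣i+j∣≤∣i∣+∣j∣ (p * lookup (ψ (punchIn a₀ a)) i) _ ⟩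
      abs (p * lookup (ψ (punchIn a₀ a)) i) ℕ.+ abs (- v a * lookup (ψ a₀) i)
        ≡⟨ cong₂ ℕ._+_ (ℤ.abs-* p _) (trans (ℤ.abs-* (- v a) _) (cong (ℕ._* abs (lookup (ψ a₀) i)) (ℤ.∣-i∣≡∣i∣ (v a)))) ⟩
      abs p ℕ.* abs (lookup (ψ (punchIn a₀ a)) i) ℕ.+ abs (v a) ℕ.* abs (lookup (ψ a₀) i)
        ≤⟨ ℕ.+-mono-≤ (ℕ.*-mono-≤ (abs-∙ (ψ a₀) s (bound a₀) s≤B) (bound (punchIn a₀ a) i)) (ℕ.*-mono-≤ (abs-∙ (ψ (punchIn a₀ a)) s (bound (punchIn a₀ a)) s≤B) (bound a₀ i)) ⟩
      d ℕ.* (C ℕ.* B) ℕ.* C ℕ.+ d ℕ.* (C ℕ.* B) ℕ.* C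
        ≤⟨ ℕ.m≤n+m _ C ⟩
      nextBound d B C ∎
      where open ℕ.≤-Reasoning

  formBound : ℕ → ℕ → ℕ → ℕ
  formBound d B zero    = 1
  formBound d B (suc k) = nextBound d B (formBound d B k)

  forms : ∀ {k d} r B (S : Vec (Vec ℤ d) k) → All (Bounded B) S → k ℕ.+ r ≡ d → Forms S r (formBound d B k)
  forms r B [] [] refl = initial-forms
  forms {suc k} r B (s ∷ S) (s≤B ∷ S≤B) eq = eliminate (forms (suc r) B S S≤B (trans (ℕ.+-suc k r) eq)) s s≤B

  -- The products in `nextBound` contain `C` twice and `B` once, whence `γ + (γ + κ)` for
  -- `C ≤ n ^ γ` and `B ≤ n ^ κ`. The outer `suc` absorbs the constant `1 + 2d`, which is at most
  -- `n`.
  formExponent : ℕ → ℕ → ℕ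
  formExponent κ zero    = 0
  formExponent κ (suc k) = suc (formExponent κ k ℕ.+ (formExponent κ k ℕ.+ κ))

  formBound≤ : ∀ d n κ B k .{{_ : ℕ.NonZero n}} → suc (d ℕ.+ d) ≤ n → B ≤ n ^ κ → formBound d B k ≤ n ^ formExponent κ k
  formBound≤ d n κ B zero    1+2d≤n B≤nκ = ℕ.≤-refl
  formBound≤ d n κ B (suc k) 1+2d≤n B≤nκ = begin
    C ℕ.+ (d ℕ.* (C ℕ.* B) ℕ.* C ℕ.+ d ℕ.* (C ℕ.* B) ℕ.* C)
      ≤⟨ ℕ.+-mono-≤ (ℕ.≤-trans C≤nγ (ℕ.^-monoʳ-≤ n (ℕ.m≤m+n γ (γ ℕ.+ κ)))) (ℕ.+-mono-≤ term term) ⟩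
    N ℕ.+ (d ℕ.* N ℕ.+ d ℕ.* N)
      ≡⟨ cong (N ℕ.+_) (ℕ.*-distribʳ-+ N d d) ⟨
    suc (d ℕ.+ d) ℕ.* N
      ≤⟨ ℕ.*-monoˡ-≤ N 1+2d≤n ⟩
    n ^ suc (γ ℕ.+ (γ ℕ.+ κ)) ∎
    where
    open ℕ.≤-Reasoning
    C = formBound d B k
    γ = formExponent κ k
    N = n ^ (γ ℕ.+ (γ ℕ.+ κ))
    C≤nγ : C ≤ n ^ γ
    C≤nγ = formBound≤ d n κ B k 1+2d≤n B≤nκ
    term : d ℕ.* (C ℕ.* B) ℕ.* C ≤ d ℕ.* N
    term = begin
      d ℕ.* (C ℕ.* B) ℕ.* C          ≡⟨ ℕ.*-assoc d (C ℕ.* B) C ⟩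
      d ℕ.* (C ℕ.* B ℕ.* C)          ≡⟨ cong (d ℕ.*_) (ℕ.*-comm (C ℕ.* B) C) ⟩
      d ℕ.* (C ℕ.* (C ℕ.* B))        ≤⟨ ℕ.*-monoʳ-≤ d (ℕ.*-mono-≤ C≤nγ (ℕ.*-mono-≤ C≤nγ B≤nκ)) ⟩
      d ℕ.* (n ^ γ ℕ.* (n ^ γ ℕ.* n ^ κ))  ≡⟨ cong (d ℕ.*_) (trans (ℕ.^-distribˡ-+-* n γ (γ ℕ.+ κ)) (cong (n ^ γ ℕ.*_) (ℕ.^-distribˡ-+-* n γ κ))) ⟨
      d ℕ.* N                        ∎

-- Divisibility of `φ · x` by primes above `n`.

module LargePrimes where

  open Sums
  open Vectors
  open Quotients
  open Elimination
  open import Data.Fin.Properties using (any?)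
  open import Data.List.Base using (filter; length)
  open import Data.List.Properties using (filter-accept; filter-reject)
  open import Data.List.Membership.Propositional.Properties using (∈-filter⁺; ∈-filter⁻)
  open import Data.List.Relation.Unary.All as All using (All; []; _∷_)
  open import Data.Nat.Base
  open import Data.Nat.Divisibility
  open import Data.Nat.ListAction using (product)
  open import Data.Nat.Primality using (Prime; euclidsLemma; prime⇒nonZero; ¬prime[1])
  open import Data.Nat.Primality.Factorisation using (PrimeFactorisation; factorise; factorisationHasAllPrimeFactors)
  open import Data.Nat.Properties
  open import Data.Sum.Base using ([_,_]′)
  open import Data.Vec.Base using (lookup; insertAt; removeAt)
  open import Data.Vec.Relation.Unary.All using () renaming (All to Allᵛ)
  open import Relation.Nullary.Decidable using (decidable-stable; _×-dec_)

  -- Truncated to [] when D = 0 or ∣D∣ > n ^ K, so that the length is at most K unconditionally.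
  largePrimes : ℕ → ℕ → ℤ → List ℕ
  largePrimes n K D with abs D ≤? n ^ K
  ... | no _  = []
  ... | yes _ with abs D
  ...   | zero      = []
  ...   | N@(suc _) = filter (n <?_) (PrimeFactorisation.factors (factorise N))

  length-filter-large : ∀ n .{{_ : NonZero n}} {ps} → All Prime ps → n ^ length (filter (n <?_) ps) ≤ product ps
  length-filter-large n [] = ≤-refl
  length-filter-large n {p ∷ ps} (p-prime ∷ primes) = large (n <? p)
    where
    large : Dec (n < p) → n ^ length (filter (n <?_) (p ∷ ps)) ≤ p * product ps
    large (yes n<p) = subst (λ qs → n ^ length qs ≤ p * product ps) (sym (filter-accept (n <?_) {p} {ps} n<p))
      (*-mono-≤ (<⇒≤ n<p) (length-filter-large n primes))
    large (no n≮p)  = subst (λ qs → n ^ length qs ≤ p * product ps) (sym (filter-reject (n <?_) {p} {ps} n≮p))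
      (≤-trans (length-filter-large n primes) (m≤n*m (product ps) p {{prime⇒nonZero p-prime}}))

  ^-cancelˡ-≤ : ∀ n → 2 ≤ n → ∀ {a b} → n ^ a ≤ n ^ b → a ≤ b
  ^-cancelˡ-≤ n 2≤n {a} {b} le with a ≤? b
  ... | yes a≤b = a≤b
  ... | no a≰b  = contradiction le (<⇒≱ (^-monoʳ-< n 2≤n (≰⇒> a≰b)))

  length-largePrimes : ∀ n K D → 2 ≤ n → length (largePrimes n K D) ≤ K
  length-largePrimes n K D 2≤n with abs D ≤? n ^ K
  ... | no _   = z≤n
  ... | yes ∣D∣≤ with abs D
  ...   | zero      = z≤n
  ...   | N@(suc _) = ^-cancelˡ-≤ n 2≤n (≤-trans
    (length-filter-large n {{>-nonZero (≤-trans (s≤s z≤n) 2≤n)}} (PrimeFactorisation.factorsPrime F))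
    (≤-trans (≤-reflexive (sym (PrimeFactorisation.isFactorisation F))) ∣D∣≤))
    where F = factorise N

  ∈-largePrimes⁻ : ∀ n K D {p} → p ∈ largePrimes n K D → Prime p × n < p
  ∈-largePrimes⁻ n K D p∈ with abs D ≤? n ^ K
  ... | yes _ with abs D
  ...   | N@(suc _) = let p∈′ , n<p = ∈-filter⁻ (n <?_) {xs = PrimeFactorisation.factors (factorise N)} p∈ in
    All.lookup (PrimeFactorisation.factorsPrime (factorise N)) p∈′ , n<p

  ∈-largePrimes⁺ : ∀ n K D {p} → abs D ≤ n ^ K → D ≢ 0ℤ → Prime p → n < p → p ∣ abs D → p ∈ largePrimes n K D
  ∈-largePrimes⁺ n K D {p} ∣D∣≤ D≢0 p-prime n<p p∣D with abs D ≤? n ^ K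
  ... | no ∣D∣≰ = contradiction ∣D∣≤ ∣D∣≰
  ... | yes _ with abs D in eq
  ...   | zero      = contradiction (ℤ.∣i∣≡0⇒i≡0 eq) D≢0
  ...   | N@(suc _) = ∈-filter⁺ (n <?_) (factorisationHasAllPrimeFactors p-prime
    (subst (p ∣_) (PrimeFactorisation.isFactorisation (factorise N)) p∣D) (PrimeFactorisation.factorsPrime (factorise N))) n<p

  prime-∣-* : ∀ {p} → Prime p → ∀ a b → pos p ℤ.∣ a ℤ.* b → pos p ℤ.∣ a ⊎ pos p ℤ.∣ b
  prime-∣-* {p} p-prime a b p∣ab with euclidsLemma (abs a) (abs b) p-prime (subst (p ∣_) (ℤ.abs-* a b) (ℤ.∣⇒∣ᵤ p∣ab))
  ... | inj₁ p∣a = inj₁ (ℤ.∣ᵤ⇒∣ p∣a)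
  ... | inj₂ p∣b = inj₂ (ℤ.∣ᵤ⇒∣ p∣b)

  interval-difference : ∀ b n {x y} → x ∈ interval b n → y ∈ interval b n → abs (x ℤ.- y) < n
  interval-difference b n x∈ y∈ with i , i<n , refl ← ∈-interval⁻ b n x∈ | j , j<n , refl ← ∈-interval⁻ b n y∈ =
    ≤-<-trans (≤-reflexive (cong abs (trans (shift b (pos i) (pos j)) (ℤ.m-n≡m⊖n i j))))
      (≤-<-trans (ℤ.∣m⊝n∣≤m⊔n i j) (⊔-pres-<m i<n j<n))
    where
    shift : ∀ b i j → (b ℤ.+ i) ℤ.- (b ℤ.+ j) ≡ i ℤ.- j
    shift = solve-∀

  -- Two points of the interval differ by less than `n < p`, so a residue class modulo `p` contains
  -- at most one of them. Above `n` this takes the place of equidistribution.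
  ∣-small⇒≡ : ∀ {n p} b {x y} → n < p → x ∈ interval b n → y ∈ interval b n → pos p ℤ.∣ x ℤ.- y → x ≡ y
  ∣-small⇒≡ {n} {p} b {x} {y} n<p x∈ y∈ p∣x-y with abs (x ℤ.- y) in eq
  ... | zero  = ℤ.i-j≡0⇒i≡j x y (ℤ.∣i∣≡0⇒i≡0 eq)
  ... | suc k = contradiction (∣⇒≤ (subst (p ∣_) eq (ℤ.∣⇒∣ᵤ p∣x-y)))
    (<⇒≱ (<-trans (subst (_< n) eq (interval-difference b n x∈ y∈)) n<p))

  ∑-box-line : ∀ {d} (b : Vec ℤ (suc d)) n i f c →
    (∀ xs → ∑ (interval (lookup b i) n) (λ t → f (insertAt xs i t)) ≤ c) → ∑ (box b n) f ≤ n ^ d * c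
  ∑-box-line b n i f c line≤c = ≤-trans (≤-reflexive (∑-box-insertAt b n i f))
    (∑-box-≤ (removeAt b i) n c (λ {xs} _ → line≤c xs))

  module _ {d} (r : Vec ℤ (suc d)) (i : Fin (suc d)) where
    private
      line : ∀ xs t u → r ∙ insertAt xs i t ℤ.- r ∙ insertAt xs i u ≡ lookup r i ℤ.* (t ℤ.- u)
      line xs t u = trans (cong₂ ℤ._-_ (∙-insertAt r xs i t) (∙-insertAt r xs i u)) (simplify (lookup r i) t u (removeAt r i ∙ xs))
        where
        simplify : ∀ D t u c → (D ℤ.* t ℤ.+ c) ℤ.- (D ℤ.* u ℤ.+ c) ≡ D ℤ.* (t ℤ.- u)
        simplify = solve-∀

    -- Along coordinate `i` the form is affine with slope `lookup r i`, invertible modulo `p`, so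
    -- divisibility by `p` determines `t` modulo `p`.
    line-divides-≤1 : ∀ {n p} → Prime p → n < p → ¬ pos p ℤ.∣ lookup r i → ∀ b xs →
      ∑ (interval b n) (λ t → 𝟙 (pos p ℤ.∣? r ∙ insertAt xs i t)) ≤ 1
    line-divides-≤1 {n} {p} p-prime n<p p∤D b xs = ∑-interval-≤1 b n (λ t → pos p ℤ.∣? r ∙ insertAt xs i t) unique
      where
      unique : ∀ {t u} → t ∈ interval b n → u ∈ interval b n →
        pos p ℤ.∣ r ∙ insertAt xs i t → pos p ℤ.∣ r ∙ insertAt xs i u → t ≡ u
      unique {t} {u} t∈ u∈ p∣t p∣u = [ (λ p∣D → contradiction p∣D p∤D) , ∣-small⇒≡ b n<p t∈ u∈ ]′
        (prime-∣-* p-prime (lookup r i) (t ℤ.- u) (subst (pos p ℤ.∣_) (line xs t u) (ℤ.∣m∣n⇒∣m-n p∣t p∣u)))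

    line-zero-≤1 : lookup r i ≢ 0ℤ → ∀ b n xs → ∑ (interval b n) (λ t → 𝟙 (r ∙ insertAt xs i t ℤ.≟ 0ℤ)) ≤ 1
    line-zero-≤1 D≢0 b n xs = ∑-interval-≤1 b n (λ t → r ∙ insertAt xs i t ℤ.≟ 0ℤ) unique
      where
      unique : ∀ {t u} → t ∈ interval b n → u ∈ interval b n →
        r ∙ insertAt xs i t ≡ 0ℤ → r ∙ insertAt xs i u ≡ 0ℤ → t ≡ u
      unique {t} {u} _ _ t≡ u≡ = [ (λ D≡0 → contradiction D≡0 D≢0) , ℤ.i-j≡0⇒i≡j t u ]′
        (ℤ.i*j≡0⇒i≡0∨j≡0 (lookup r i) (trans (sym (line xs t u)) (cong₂ ℤ._-_ t≡ u≡)))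

  ∣-∙ : ∀ {d p} (r x : Vec ℤ d) → (∀ i → p ℤ.∣ lookup r i) → p ℤ.∣ r ∙ x
  ∣-∙ []       []       h = ℤ.divides 0ℤ refl
  ∣-∙ (r ∷ rs) (x ∷ xs) h = ℤ.∣m∣n⇒∣m+n (ℤ.∣m⇒∣m*n x (h Fin.zero)) (∣-∙ rs xs (h ∘ Fin.suc))

  module _ {k d e} {S : Vec (Vec ℤ (suc d)) k} (Q : Quotient S (suc e)) where
    open Quotient Q

    count-prime-divides : ∀ {p n} → Prime p → n < p → ∀ b → ∑ (box b n) (λ x → 𝟙 (pos p ∣ᵛ? φ · x)) ≤ n ^ d * 1
    -- The section shows that the first row `r` of `φ` takes the value 1. Hence `p` does not divide
    -- all entries of `r`, and some coordinate has a slope invertible modulo `p`.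
    count-prime-divides {p} {n} p-prime n<p b with φ | section (1ℤ ∷ 0ᵛ)
    ... | r ∷ φ′ | r∙x≡1 with any? (λ i → ¬? (pos p ℤ.∣? lookup r i))
    ...   | no all-divisible = contradiction
      (subst Prime (∣1⇒≡1 (ℤ.∣⇒∣ᵤ {pos p} {1ℤ} (subst (pos p ℤ.∣_) (cong Vec.head r∙x≡1)
        (∣-∙ r _ (λ i → decidable-stable (pos p ℤ.∣? lookup r i) (λ ∤ → all-divisible (i , ∤))))))) p-prime) ¬prime[1]
    ...   | yes (i , p∤rᵢ) = ≤-trans
      (∑-mono (box b n) (λ x → 𝟙-mono (pos p ∣ᵛ? (r ∷ φ′) · x) (pos p ℤ.∣? r ∙ x)
        λ { (dividesᵛ (z ∷ _) eq) → ℤ.divides z (trans (cong Vec.head eq) (ℤ.*-comm (pos p) z)) }))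
      (∑-box-line b n i _ 1 (line-divides-≤1 r i p-prime n<p p∤rᵢ (lookup b i)))

    -- If `φ · x` is `p` times `z`, then `x` minus `p` times `σ z` lies in the span of `S`, where
    -- `ψ` vanishes. So `ψ ∙ x` is `p` times `ψ ∙ σ z`.
    quotient-divides : ∀ {p} (ψ : Vec ℤ (suc d)) → Allᵛ (λ s → ψ ∙ s ≡ 0ℤ) S → ∀ x → pos p ∣ᵛ φ · x → pos p ℤ.∣ ψ ∙ x
    quotient-divides {p} ψ ψ-kills x (dividesᵛ z φx≡pz) = conclude (kernel _ in-kernel)
      where
      w = x ⊕ (ℤ.- pos p) ⊙ σ z
      in-kernel : φ · w ≡ 0ᵛ
      in-kernel = trans (·-⊕ φ x _) (trans (cong₂ _⊕_ φx≡pz (trans (·-⊙ φ (ℤ.- pos p) _) (cong ((ℤ.- pos p) ⊙_) (section z)))) (⊕-inverseʳ (pos p) z))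
      conclude : ∃[ c ] comb c S ≡ w → pos p ℤ.∣ ψ ∙ x
      conclude (c , c≡) = subst (λ v → pos p ℤ.∣ ψ ∙ v) (⊕-cancelʳ-⊙ (pos p) x (σ z))
        (subst (pos p ℤ.∣_) (sym (trans (∙-⊕ʳ ψ w _) (cong₂ ℤ._+_ (trans (cong (ψ ∙_) (sym c≡)) (∙-comb-zero {r = ψ} ψ-kills c)) (∙-⊙ʳ ψ (pos p) (σ z)))))
          (subst (pos p ℤ.∣_) (sym (ℤ.+-identityˡ _)) (ℤ.∣m⇒∣m*n (ψ ∙ σ z) ℤ.∣-refl)))

    module _ {r C} (forms : Forms S (suc (suc r)) C) (n K : ℕ) where
      open Forms forms renaming (kills to ψ-kills)
      private
        ψ₀ = ψ Fin.zero
        ψ₁ = ψ (Fin.suc Fin.zero)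
        i = pivot Fin.zero
        j = pivot (Fin.suc Fin.zero)

        -- Excluding the divisors of `Δ` makes the slope of `ψ₁` along `j` invertible for every `p`
        -- counted here; those divisors are left to `w₁`.
        Event : ℕ → Vec ℤ (suc d) → Set
        Event p x = (pos p ℤ.∣ ψ₁ ∙ x) × ¬ (pos p ℤ.∣ Δ)

        event? : ∀ p x → Dec (Event p x)
        event? p x = (pos p ℤ.∣? ψ₁ ∙ x) ×-dec ¬? (pos p ℤ.∣? Δ)

        w₁ w₂ w₃ : Vec ℤ (suc d) → ℕ
        w₁ x = ∑ (largePrimes n K Δ) (λ p → 𝟙 (pos p ∣ᵛ? φ · x))
        w₂ x = 𝟙 (ψ₀ ∙ x ℤ.≟ 0ℤ)
        w₃ x = ∑ (largePrimes n K (ψ₀ ∙ x)) (λ p → 𝟙 (event? p x))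

      -- A union bound written as a sum, so that it can be summed over the box term by term. `w₁`
      -- accounts for the primes dividing `Δ`, `w₂` for the zeros of `ψ₀`, where its divisors would
      -- restrict nothing, and `w₃` for the remaining primes.
      largePrimeWeight : Vec ℤ (suc d) → ℕ
      largePrimeWeight x = w₁ x + w₂ x + w₃ x

      1≤largePrimeWeight : abs Δ ≤ n ^ K → ∀ x → abs (ψ₀ ∙ x) ≤ n ^ K → ∀ {p} → Prime p → n < p → pos p ∣ᵛ φ · x →
        1 ≤ largePrimeWeight x
      1≤largePrimeWeight Δ≤ x ψx≤ {p} p-prime n<p p∣φx = by-cases (pos p ℤ.∣? Δ) (ψ₀ ∙ x ℤ.≟ 0ℤ)
        where
        by-cases : Dec (pos p ℤ.∣ Δ) → Dec (ψ₀ ∙ x ≡ 0ℤ) → 1 ≤ w₁ x + w₂ x + w₃ x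
        by-cases (yes p∣Δ) _ = ≤-trans (≤-trans (1≤𝟙 (pos p ∣ᵛ? φ · x) p∣φx)
          (∑-∈ (largePrimes n K Δ) (λ p → 𝟙 (pos p ∣ᵛ? φ · x)) (∈-largePrimes⁺ n K Δ Δ≤ Δ≢0 p-prime n<p (ℤ.∣⇒∣ᵤ p∣Δ))))
          (≤-trans (m≤m+n (w₁ x) (w₂ x)) (m≤m+n (w₁ x + w₂ x) (w₃ x)))
        by-cases (no _) (yes ψx≡0) = ≤-trans (1≤𝟙 (ψ₀ ∙ x ℤ.≟ 0ℤ) ψx≡0)
          (≤-trans (m≤n+m (w₂ x) (w₁ x)) (m≤m+n (w₁ x + w₂ x) (w₃ x)))
        by-cases (no p∤Δ) (no ψx≢0) = ≤-trans
          (≤-trans (1≤𝟙 (event? p x) (quotient-divides ψ₁ (ψ-kills _) x p∣φx , p∤Δ))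
            (∑-∈ (largePrimes n K (ψ₀ ∙ x)) (λ p → 𝟙 (event? p x))
              (∈-largePrimes⁺ n K (ψ₀ ∙ x) ψx≤ ψx≢0 p-prime n<p (ℤ.∣⇒∣ᵤ (quotient-divides ψ₀ (ψ-kills _) x p∣φx)))))
          (m≤n+m (w₃ x) (w₁ x + w₂ x))

      -- The value ψ₀ ∙ x does not involve the coordinate j, along which ψ₁ ∙ x has slope Δ.
      ∑-largePrimeWeight : 2 ≤ n → ∀ b → ∑ (box b n) largePrimeWeight ≤ n ^ d * suc (K + K)
      ∑-largePrimeWeight 2≤n b = begin
        ∑ (box b n) largePrimeWeight
          ≡⟨ trans (∑-+ (box b n) (λ x → w₁ x + w₂ x) w₃) (cong (_+ ∑ (box b n) w₃) (∑-+ (box b n) w₁ w₂)) ⟩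
        ∑ (box b n) w₁ + ∑ (box b n) w₂ + ∑ (box b n) w₃
          ≤⟨ +-mono-≤ (+-mono-≤ first second) third ⟩
        n ^ d * K + n ^ d * 1 + n ^ d * K
          ≡⟨ trans (cong (_+ n ^ d * K) (sym (*-distribˡ-+ (n ^ d) K 1))) (sym (*-distribˡ-+ (n ^ d) (K + 1) K)) ⟩
        n ^ d * (K + 1 + K)
          ≡⟨ cong (λ c → n ^ d * (c + K)) (+-comm K 1) ⟩
        n ^ d * suc (K + K) ∎
        where
        open ≤-Reasoning
        ∑-primes : ∀ D {f : ℕ → ℕ} c → (∀ {p} → Prime p → n < p → f p ≤ c) → ∑ (largePrimes n K D) f ≤ K * c
        ∑-primes D {f} c f≤c = begin
          ∑ (largePrimes n K D) f              ≤⟨ ∑-mono-∈ (largePrimes n K D) (λ p∈ → let p-prime , n<p = ∈-largePrimes⁻ n K D p∈ in f≤c p-prime n<p) ⟩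
          ∑ (largePrimes n K D) (λ _ → c)      ≡⟨ ∑-const (largePrimes n K D) c ⟩
          length (largePrimes n K D) * c       ≤⟨ *-monoˡ-≤ c (length-largePrimes n K D 2≤n) ⟩
          K * c                                ∎
        first : ∑ (box b n) (λ x → ∑ (largePrimes n K Δ) (λ p → 𝟙 (pos p ∣ᵛ? φ · x))) ≤ n ^ d * K
        first = begin
          ∑ (box b n) (λ x → ∑ (largePrimes n K Δ) (λ p → 𝟙 (pos p ∣ᵛ? φ · x)))  ≡⟨ ∑-swap (box b n) (largePrimes n K Δ) _ ⟩
          ∑ (largePrimes n K Δ) (λ p → ∑ (box b n) (λ x → 𝟙 (pos p ∣ᵛ? φ · x)))  ≤⟨ ∑-primes Δ (n ^ d * 1) (λ p-prime n<p → count-prime-divides p-prime n<p b) ⟩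
          K * (n ^ d * 1)                                                        ≡⟨ trans (cong (K *_) (*-identityʳ (n ^ d))) (*-comm K (n ^ d)) ⟩
          n ^ d * K                                                              ∎
        second : ∑ (box b n) (λ x → 𝟙 (ψ₀ ∙ x ℤ.≟ 0ℤ)) ≤ n ^ d * 1
        second = ∑-box-line b n i _ 1 (line-zero-≤1 ψ₀ i (Δ≢0 ∘ trans (sym (diagonal Fin.zero))) (lookup b i) n)
        third : ∑ (box b n) (λ x → ∑ (largePrimes n K (ψ₀ ∙ x)) (λ p → 𝟙 (event? p x))) ≤ n ^ d * K
        third = ∑-box-line b n j _ K λ xs → begin
          ∑ (interval (lookup b j) n) (λ t → ∑ (largePrimes n K (ψ₀ ∙ insertAt xs j t)) (λ p → 𝟙 (event? p (insertAt xs j t))))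
            ≡⟨ ∑-cong (interval (lookup b j) n) (λ t → cong (λ D → ∑ (largePrimes n K D) (λ p → 𝟙 (event? p (insertAt xs j t)))) (independent xs t)) ⟩
          ∑ (interval (lookup b j) n) (λ t → ∑ (largePrimes n K (removeAt ψ₀ j ∙ xs)) (λ p → 𝟙 (event? p (insertAt xs j t))))
            ≡⟨ ∑-swap (interval (lookup b j) n) (largePrimes n K (removeAt ψ₀ j ∙ xs)) _ ⟩
          ∑ (largePrimes n K (removeAt ψ₀ j ∙ xs)) (λ p → ∑ (interval (lookup b j) n) (λ t → 𝟙 (event? p (insertAt xs j t))))
            ≤⟨ ∑-primes (removeAt ψ₀ j ∙ xs) 1 (λ p-prime n<p → event-line p-prime n<p xs) ⟩
          K * 1
            ≡⟨ *-identityʳ K ⟩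
          K ∎
          where
          independent : ∀ xs t → ψ₀ ∙ insertAt xs j t ≡ removeAt ψ₀ j ∙ xs
          independent xs t = trans (∙-insertAt ψ₀ xs j t)
            (trans (cong (λ z → z ℤ.* t ℤ.+ removeAt ψ₀ j ∙ xs) (off {Fin.zero} {Fin.suc Fin.zero} (λ ()))) (ℤ.+-identityˡ _))
          event-line : ∀ {p} → Prime p → n < p → ∀ xs → ∑ (interval (lookup b j) n) (λ t → 𝟙 (event? p (insertAt xs j t))) ≤ 1
          event-line {p} p-prime n<p xs = by-cases (pos p ℤ.∣? Δ)
            where
            by-cases : Dec (pos p ℤ.∣ Δ) → ∑ (interval (lookup b j) n) (λ t → 𝟙 (event? p (insertAt xs j t))) ≤ 1
            by-cases (yes p∣Δ) = ≤-trans (≤-reflexive (∑-zero (interval (lookup b j) n)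
              λ {t} _ → 𝟙-no (event? p (insertAt xs j t)) (λ (_ , p∤Δ) → p∤Δ p∣Δ))) z≤n
            by-cases (no p∤Δ) = ≤-trans
              (∑-mono (interval (lookup b j) n) (λ t → 𝟙-mono (event? p (insertAt xs j t)) (pos p ℤ.∣? ψ₁ ∙ insertAt xs j t) proj₁))
              (line-divides-≤1 ψ₁ j p-prime n<p (p∤Δ ∘ subst (pos p ℤ.∣_) (diagonal (Fin.suc Fin.zero))) (lookup b j) xs)

-- Bounds for the number of rows that extend a given primitive set.

module RowCounts where

  open Sums
  open Vectors
  open Rationals
  open Quotients
  open Density
  open Sieve
  open Elimination
  open LargePrimes
  open Classification using (Unimodular; unimodular?)
  open import Defs using (ζ-partial; ζ-term; ζ-partial-upper; ζ-partial-mono; ζ-term-pos)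
  open import Data.List.Relation.Unary.All as All using (All; []; _∷_)
  open import Data.Nat.Base
  open import Data.Nat.Divisibility
  open import Data.Nat.Primality using (Prime)
  open import Data.Nat.Primality.Factorisation using (factorise)
  open import Data.Nat.ListAction using (product)
  open import Data.Nat.Properties
  open import Data.Vec.Relation.Unary.All using () renaming (All to Allᵛ)

  prime-divisor : ∀ n → 2 ≤ n → ∃[ p ] Prime p × p ∣ n
  prime-divisor n@(suc _) 2≤n with factorise n
  ... | record { factors = [] ; isFactorisation = eq } = contradiction eq (>⇒≢ 2≤n)
  ... | record { factors = p ∷ ps ; isFactorisation = eq ; factorsPrime = p-prime ∷ _ } =
    p , p-prime , divides (product ps) (trans eq (*-comm p (product ps)))

  prime>1 : ∀ {p} → Prime p → 1 < p
  prime>1 {suc (suc p)} _ = s≤s (s≤s z≤n)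

  gcd-multiple : ∀ {e} (y : Vec ℤ (suc e)) {p} → p ∣ abs (Reduction.gcd (reduce y)) → pos p ∣ᵛ y
  gcd-multiple y {p} p∣g with ℤ.divides h eq ← ℤ.∣ᵤ⇒∣ {pos p} {Reduction.gcd (reduce y)} p∣g = gcd-divides (reduce y) {pos p} {h} eq

  unimodular⇒rough : ∀ {e} m (y : Vec ℤ (suc e)) → Unimodular y → Good m 1 y
  unimodular⇒rough m y g≡1 = dividesᵛ y (sym (⊙-identity y)) , All.tabulate λ {r} r∈ r∣y →
    contradiction (∣1⇒≡1 (subst₂ _∣_ (*-identityˡ r) (trans (cong abs β-y) g≡1) (ℤ.∣⇒∣ᵤ {pos (1 * r)} {β ∙ y} (∣ᵛ⇒∣∙ β r∣y))))
      (>⇒≢ (proj₁ (∈-range⁻ 1 m r∈)))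
    where open Reduction (reduce y)

  rough⇒large-prime : ∀ {e} m → 1 ≤ m → (y : Vec ℤ (suc e)) → ¬ Unimodular y → Good m 1 y →
    ∃[ p ] Prime p × suc m < p × pos p ∣ᵛ y
  rough⇒large-prime m 1≤m y g≢1 (_ , rough) with abs (Reduction.gcd (reduce y)) in eq
  -- A zero gcd means that `y` is zero, hence divisible by 2; the condition `1 ≤ m` puts 2 in the
  -- range `[2, M]`.
  ... | 0 = contradiction (gcd-multiple y (subst (2 ∣_) (sym eq) (2 ∣0))) (All.lookup rough (∈-range⁺ 1 m (s≤s (s≤s z≤n)) (s≤s 1≤m)))
  ... | 1 = contradiction refl g≢1
  ... | g@(suc (suc _)) with p , p-prime , p∣g ← prime-divisor g (s≤s (s≤s z≤n)) =
    p , p-prime , ≰⇒> (λ p≤M → All.lookup rough (∈-range⁺ 1 m (prime>1 p-prime) p≤M)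
      (subst (λ q → pos q ∣ᵛ y) (sym (*-identityˡ p)) p∣y)) , p∣y
    where p∣y = gcd-multiple y (subst (_ ∣_) (sym eq) p∣g)

  ζ-partial-∑-≤ : ∀ e k n f x → (∀ {q} → q ∈ range k n → q ^ e * f q ≤ x) →
    ζ-partial e k ℚ.* ιₙ x ℚ.+ ιₙ (∑ (range k n) f) ℚ.≤ ζ-partial e (k + n) ℚ.* ιₙ x
  ζ-partial-∑-≤ e k zero f x h = ℚ.≤-reflexive (trans (cong (ζ-partial e k ℚ.* ιₙ x ℚ.+_) ιₙ-zero)
    (trans (ℚ.+-identityʳ _) (cong (λ j → ζ-partial e j ℚ.* ιₙ x) (sym (+-identityʳ k)))))
  ζ-partial-∑-≤ e k (suc n) f x h = begin
    ζ-partial e k ℚ.* ιₙ x ℚ.+ ιₙ (f q + ∑ (range k n) f)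
      ≡⟨ cong (ζ-partial e k ℚ.* ιₙ x ℚ.+_) (ιₙ-+ (f q) _) ⟩
    ζ-partial e k ℚ.* ιₙ x ℚ.+ (ιₙ (f q) ℚ.+ ιₙ (∑ (range k n) f))
      ≡⟨ solve 3 (λ a b c → a :+ (b :+ c) := (a :+ c) :+ b) refl (ζ-partial e k ℚ.* ιₙ x) (ιₙ (f q)) _ ⟩
    ζ-partial e k ℚ.* ιₙ x ℚ.+ ιₙ (∑ (range k n) f) ℚ.+ ιₙ (f q)
      ≤⟨ ℚ.+-mono-≤ (ζ-partial-∑-≤ e k n f x (h ∘ there)) term ⟩
    ζ-partial e (k + n) ℚ.* ιₙ x ℚ.+ ζ-term e q ℚ.* ιₙ x
      ≡⟨ ℚ.*-distribʳ-+ (ιₙ x) (ζ-partial e (k + n)) (ζ-term e q) ⟨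
    ζ-partial e q ℚ.* ιₙ x
      ≡⟨ cong (λ j → ζ-partial e j ℚ.* ιₙ x) (+-suc k n) ⟨
    ζ-partial e (k + suc n) ℚ.* ιₙ x ∎
    where
    open ℚ.≤-Reasoning
    open +-*-Solver
    q = suc (k + n)
    term : ιₙ (f q) ℚ.≤ ζ-term e q ℚ.* ιₙ x
    term = ℚ.≤-trans (ℚ.≤-reflexive (sym (ζ-term-* e q refl)))
      (*-monoˡ-0≤ {ζ-term e q} (ℚ.<⇒≤ (ζ-term-pos e q)) (ιₙ-mono-≤ (h (here refl))))

  0≤ζ : ∀ e n → ℚ.0ℚ ℚ.≤ ζ-partial e n
  0≤ζ e n = ζ-partial-mono e {0} {n} z≤n

  *-monoˡ-ζ : ∀ e M {x y} → x ℚ.≤ y → ζ-partial e M ℚ.* x ℚ.≤ ζ-partial e M ℚ.* y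
  *-monoˡ-ζ e M = *-monoˡ-0≤ (0≤ζ e M)

  -- The value `ψ₀ ∙ x` is at most the dimension times a coefficient bound times a coordinate bound;
  -- the `suc` absorbs the dimension, which is at most `n`.
  rowExponent : ℕ → ℕ → ℕ
  rowExponent κ k = suc (formExponent κ k + κ)

  module _ {k d r} {S : Vec (Vec ℤ (suc d)) k} (Q : Quotient S (suc (suc r))) (eq : k + suc (suc r) ≡ suc d)
    (n κ : ℕ) (1+2d≤n : suc (suc d + suc d) ≤ n) (S≤ : Allᵛ (Bounded (n ^ κ)) S)
    (b : Vec ℤ (suc d)) (box≤ : ∀ {x} → x ∈ box b n → Bounded (n ^ κ) x)
    (m : ℕ) (1≤m : 1 ≤ m) (M≤n : suc m ≤ n) where

    open Quotient Q
    private
      D = suc d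
      e = suc (suc r)
      M = suc m
      K = rowExponent κ k
      instance
        n≢0 : NonZero n
        n≢0 = >-nonZero (≤-trans (s≤s z≤n) 1+2d≤n)
      2≤n : 2 ≤ n
      2≤n = ≤-trans (s≤s (s≤s z≤n)) M≤n′
        where
        M≤n′ : 2 ≤ n
        M≤n′ = ≤-trans (s≤s 1≤m) M≤n
      F : Forms S (suc (suc r)) (formBound D (n ^ κ) k)
      F = forms (suc (suc r)) (n ^ κ) S S≤ eq
      open Forms F hiding (kills)
      C≤ : formBound D (n ^ κ) k ≤ n ^ formExponent κ k
      C≤ = formBound≤ D n κ (n ^ κ) k 1+2d≤n ≤-refl
      Δ≤ : abs Δ ≤ n ^ K
      Δ≤ = begin
        abs Δ                       ≤⟨ subst (λ D → abs D ≤ formBound (suc d) (n ^ κ) k) (diagonal Fin.zero) (bound Fin.zero (pivot Fin.zero)) ⟩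
        formBound D (n ^ κ) k       ≤⟨ C≤ ⟩
        n ^ formExponent κ k        ≤⟨ ^-monoʳ-≤ n (≤-trans (m≤m+n (formExponent κ k) κ) (n≤1+n _)) ⟩
        n ^ K                       ∎
        where open ≤-Reasoning
      D≤n : D ≤ n
      D≤n = ≤-trans (≤-trans (m≤m+n D D) (n≤1+n (D + D))) 1+2d≤n
      ψ≤ : ∀ {x} → Bounded (n ^ κ) x → abs (ψ Fin.zero ∙ x) ≤ n ^ K
      ψ≤ {x} x≤ = begin
        abs (ψ Fin.zero ∙ x)                         ≤⟨ abs-∙ (ψ Fin.zero) x (bound Fin.zero) x≤ ⟩
        D * (formBound D (n ^ κ) k * n ^ κ)          ≤⟨ *-mono-≤ D≤n (*-monoˡ-≤ (n ^ κ) C≤) ⟩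
        n * (n ^ formExponent κ k * n ^ κ)           ≡⟨ cong (n *_) (^-distribˡ-+-* n (formExponent κ k) κ) ⟨
        n ^ K                                        ∎
        where open ≤-Reasoning

      weight : Vec ℤ D → ℕ
      weight = largePrimeWeight Q F n K
      -- All `q` in `(M, n]` are counted, prime or not: the sum of `1 / q^e` over them is at most
      -- `1 / M` anyway, and it can be read off the partial sums of ζ.
      divisorCount : Vec ℤ D → ℕ
      divisorCount x = ∑ (range M (n ∸ M)) (λ q → 𝟙 (pos q ∣ᵛ? φ · x))

    rowCount roughRowCount : ℕ
    rowCount      = ∑ (box b n) (λ x → 𝟙 (unimodular? (φ · x)))
    roughRowCount = ∑ (box b n) (λ x → 𝟙 (good? m 1 (φ · x)))

    private
      pointwise : ∀ {x} → x ∈ box b n → 𝟙 (good? m 1 (φ · x)) ≤ 𝟙 (unimodular? (φ · x)) + divisorCount x + weight x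
      pointwise {x} x∈ = by-cases (unimodular? (φ · x)) (good? m 1 (φ · x))
        where
        by-cases : (U : Dec (Unimodular (φ · x))) (G : Dec (Good m 1 (φ · x))) → 𝟙 G ≤ 𝟙 U + divisorCount x + weight x
        by-cases (yes _) G = ≤-trans (𝟙≤1 G) (≤-trans (m≤m+n 1 (divisorCount x)) (m≤m+n _ (weight x)))
        by-cases (no _) (no _) = z≤n
        by-cases (no ¬u) (yes good) with p , p-prime , M<p , p∣y ← rough⇒large-prime m 1≤m (φ · x) ¬u good with p ≤? n
        ... | yes p≤n = ≤-trans (≤-trans (1≤𝟙 (pos p ∣ᵛ? φ · x) p∣y)
          (∑-∈ (range M (n ∸ M)) (λ q → 𝟙 (pos q ∣ᵛ? φ · x)) (∈-range⁺ M (n ∸ M) M<p (subst (p ≤_) (sym (m+[n∸m]≡n M≤n)) p≤n))))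
          (m≤m+n (divisorCount x) (weight x))
        ... | no p≰n = ≤-trans (1≤largePrimeWeight Q F n K Δ≤ x (ψ≤ (box≤ x∈)) p-prime (≰⇒> p≰n) p∣y) (m≤n+m (weight x) (divisorCount x))

      divisorTotal : ℕ
      divisorTotal = ∑ (range M (n ∸ M)) (λ q → ∑ (box b n) (λ x → 𝟙 (pos q ∣ᵛ? φ · x)))

      rough≤ : roughRowCount ≤ rowCount + divisorTotal + n ^ d * suc (K + K)
      rough≤ = begin
        roughRowCount
          ≤⟨ ∑-mono-∈ (box b n) pointwise ⟩
        ∑ (box b n) (λ x → 𝟙 (unimodular? (φ · x)) + divisorCount x + weight x)
          ≡⟨ trans (∑-+ (box b n) (λ x → 𝟙 (unimodular? (φ · x)) + divisorCount x) weight)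
               (cong (_+ ∑ (box b n) weight) (∑-+ (box b n) (λ x → 𝟙 (unimodular? (φ · x))) divisorCount)) ⟩
        rowCount + ∑ (box b n) divisorCount + ∑ (box b n) weight
          ≤⟨ +-mono-≤ (≤-reflexive (cong (rowCount +_) (∑-swap (box b n) (range M (n ∸ M)) _))) (∑-largePrimeWeight Q F n K 2≤n b) ⟩
        rowCount + divisorTotal + n ^ d * suc (K + K) ∎
        where open ≤-Reasoning

      h : ℚ
      h = 1ℤ ℚ./ M
      z = ζ-partial e M
      L = modulus m
      A = roughCount e m
      instance
        Le≢0 : NonZero (L ^ e)
        Le≢0 = m^n≢0 L e {{modulus-nonZero m}}

      divisorTotal≤ : ιₙ divisorTotal ℚ.≤ h ℚ.* ιₙ ((2 * n) ^ D)
      divisorTotal≤ = begin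
        ιₙ divisorTotal
          ≡⟨ solve 2 (λ z b → b := :- z :+ (z :+ b)) refl (z ℚ.* ιₙ X) _ ⟩
        ℚ.- (z ℚ.* ιₙ X) ℚ.+ (z ℚ.* ιₙ X ℚ.+ ιₙ divisorTotal)
          ≤⟨ ℚ.+-monoʳ-≤ (ℚ.- (z ℚ.* ιₙ X)) (ζ-partial-∑-≤ e M (n ∸ M) _ X scaled) ⟩
        ℚ.- (z ℚ.* ιₙ X) ℚ.+ ζ-partial e (M + (n ∸ M)) ℚ.* ιₙ X
          ≤⟨ ℚ.+-monoʳ-≤ (ℚ.- (z ℚ.* ιₙ X)) (*-monoʳ-ι X
               (ζ-partial-upper {e} (s≤s (s≤s z≤n)) {m} {M + (n ∸ M)} (m≤m+n M (n ∸ M)))) ⟩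
        ℚ.- (z ℚ.* ιₙ X) ℚ.+ (z ℚ.+ h) ℚ.* ιₙ X
          ≡⟨ solve 3 (λ z i x → :- (z :* x) :+ (z :+ i) :* x := i :* x) refl z h (ιₙ X) ⟩
        h ℚ.* ιₙ X ∎
        where
        open ℚ.≤-Reasoning
        open +-*-Solver
        X = (2 * n) ^ D
        scaled : ∀ {q} → q ∈ range M (n ∸ M) → q ^ e * ∑ (box b n) (λ x → 𝟙 (pos q ∣ᵛ? φ · x)) ≤ X
        scaled {q} q∈ = count-divides-upper φ σ section q {{range-nonZero M (n ∸ M) q∈}} b n
          (subst (q ≤_) (m+[n∸m]≡n M≤n) (proj₂ (∈-range⁻ M (n ∸ M) q∈)))

    -- Unimodular vectors are rough, rough vectors have density `ρ` up to rounding the side by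
    -- `modulus m`, and `ζ-partial e M` times `ρ` is at most 1. The factor `L ^ e` clears the
    -- denominator of `ρ`.
    rowCount-upper : ζ-partial e M ℚ.* ιₙ rowCount ℚ.≤ ιₙ ((n + modulus m) ^ D)
    rowCount-upper = *-cancelˡ-ι (L ^ e) (begin
      ιₙ (L ^ e) ℚ.* (z ℚ.* ιₙ rowCount)
        ≡⟨ solve 3 (λ l z g → l :* (z :* g) := z :* (l :* g)) refl (ιₙ (L ^ e)) z (ιₙ rowCount) ⟩
      z ℚ.* (ιₙ (L ^ e) ℚ.* ιₙ rowCount)
        ≡⟨ cong (z ℚ.*_) (ιₙ-* (L ^ e) rowCount) ⟨
      z ℚ.* ιₙ (L ^ e * rowCount)
        ≤⟨ *-monoˡ-ζ e M (ιₙ-mono-≤ (≤-trans (*-monoʳ-≤ (L ^ e) rowCount≤rough) (count-rough-upper φ σ section m b n))) ⟩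
      z ℚ.* ιₙ ((n + L) ^ D * A)
        ≡⟨ cong (z ℚ.*_) (ιₙ-* ((n + L) ^ D) A) ⟩
      z ℚ.* (ιₙ ((n + L) ^ D) ℚ.* ιₙ A)
        ≡⟨ solve 3 (λ z x a → z :* (x :* a) := x :* (z :* a)) refl z (ιₙ ((n + L) ^ D)) (ιₙ A) ⟩
      ιₙ ((n + L) ^ D) ℚ.* (z ℚ.* ιₙ A)
        ≤⟨ *-monoˡ-ι ((n + L) ^ D) (roughCount-upper e m) ⟩
      ιₙ ((n + L) ^ D) ℚ.* ιₙ (L ^ e)
        ≡⟨ ℚ.*-comm (ιₙ ((n + L) ^ D)) (ιₙ (L ^ e)) ⟩
      ιₙ (L ^ e) ℚ.* ιₙ ((n + L) ^ D) ∎)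
      where
      open ℚ.≤-Reasoning
      open +-*-Solver
      rowCount≤rough : rowCount ≤ roughRowCount
      rowCount≤rough = ∑-mono (box b n) (λ x → 𝟙-mono (unimodular? (φ · x)) (good? m 1 (φ · x)) (unimodular⇒rough m (φ · x)))

    -- The error with `(n ∸ modulus m) ^ D` is the defect of the density `ρ`. The error multiplied
    -- by `ζ-partial e M` bounds the rough vectors that are not unimodular: first those with a
    -- divisor in `(M, n]`, then those with a prime divisor above `n`.
    rowCount-lower : ιₙ ((n ∸ modulus m) ^ D) ℚ.≤ ζ-partial e M ℚ.* ιₙ rowCount ℚ.+ (1ℤ ℚ./ M) ℚ.* ιₙ ((n ∸ modulus m) ^ D)
      ℚ.+ ζ-partial e M ℚ.* ((1ℤ ℚ./ M) ℚ.* ιₙ ((2 * n) ^ D) ℚ.+ ιₙ (n ^ d * suc (K + K)))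
    rowCount-lower = begin
      ιₙ Y
        ≤⟨ *-cancelˡ-ι (L ^ e) scaled ⟩
      z ℚ.* ιₙ roughRowCount ℚ.+ h ℚ.* ιₙ Y
        ≤⟨ ℚ.+-monoˡ-≤ (h ℚ.* ιₙ Y) (*-monoˡ-ζ e M (ℚ.≤-trans (ιₙ-mono-≤ rough≤) split)) ⟩
      z ℚ.* (ιₙ rowCount ℚ.+ h ℚ.* ιₙ X ℚ.+ ιₙ W) ℚ.+ h ℚ.* ιₙ Y
        ≡⟨ solve 5 (λ z g x w y → z :* (g :+ x :+ w) :+ y := z :* g :+ y :+ z :* (x :+ w)) refl z (ιₙ rowCount) (h ℚ.* ιₙ X) (ιₙ W) (h ℚ.* ιₙ Y) ⟩
      z ℚ.* ιₙ rowCount ℚ.+ h ℚ.* ιₙ Y ℚ.+ z ℚ.* (h ℚ.* ιₙ X ℚ.+ ιₙ W) ∎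
      where
      open ℚ.≤-Reasoning
      open +-*-Solver
      X = (2 * n) ^ D
      Y = (n ∸ L) ^ D
      W = n ^ d * suc (K + K)
      split : ιₙ (rowCount + divisorTotal + W) ℚ.≤ ιₙ rowCount ℚ.+ h ℚ.* ιₙ X ℚ.+ ιₙ W
      split = begin
        ιₙ (rowCount + divisorTotal + W)                  ≡⟨ ιₙ-+ (rowCount + divisorTotal) W ⟩
        ιₙ (rowCount + divisorTotal) ℚ.+ ιₙ W             ≡⟨ cong (ℚ._+ ιₙ W) (ιₙ-+ rowCount divisorTotal) ⟩
        ιₙ rowCount ℚ.+ ιₙ divisorTotal ℚ.+ ιₙ W          ≤⟨ ℚ.+-monoˡ-≤ (ιₙ W) (ℚ.+-monoʳ-≤ (ιₙ rowCount) divisorTotal≤) ⟩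
        ιₙ rowCount ℚ.+ h ℚ.* ιₙ X ℚ.+ ιₙ W               ∎
      scaled : ιₙ (L ^ e) ℚ.* ιₙ Y ℚ.≤ ιₙ (L ^ e) ℚ.* (z ℚ.* ιₙ roughRowCount ℚ.+ h ℚ.* ιₙ Y)
      scaled = begin
        ιₙ (L ^ e) ℚ.* ιₙ Y
          ≡⟨ ℚ.*-comm (ιₙ (L ^ e)) (ιₙ Y) ⟩
        ιₙ Y ℚ.* ιₙ (L ^ e)
          ≤⟨ *-monoˡ-ι Y (roughCount-lower e m (s≤s (s≤s z≤n))) ⟩
        ιₙ Y ℚ.* (z ℚ.* ιₙ A ℚ.+ h ℚ.* ιₙ (L ^ e))
          ≡⟨ solve 5 (λ y z a h l → y :* (z :* a :+ h :* l) := z :* (y :* a) :+ l :* (h :* y)) refl (ιₙ Y) z (ιₙ A) h (ιₙ (L ^ e)) ⟩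
        z ℚ.* (ιₙ Y ℚ.* ιₙ A) ℚ.+ ιₙ (L ^ e) ℚ.* (h ℚ.* ιₙ Y)
          ≡⟨ cong (λ u → z ℚ.* u ℚ.+ ιₙ (L ^ e) ℚ.* (h ℚ.* ιₙ Y)) (ιₙ-* Y A) ⟨
        z ℚ.* ιₙ (Y * A) ℚ.+ ιₙ (L ^ e) ℚ.* (h ℚ.* ιₙ Y)
          ≤⟨ ℚ.+-monoˡ-≤ (ιₙ (L ^ e) ℚ.* (h ℚ.* ιₙ Y)) (*-monoˡ-ζ e M (ιₙ-mono-≤ (count-rough-lower φ σ section m b n))) ⟩
        z ℚ.* ιₙ (L ^ e * roughRowCount) ℚ.+ ιₙ (L ^ e) ℚ.* (h ℚ.* ιₙ Y)
          ≡⟨ cong (λ u → z ℚ.* u ℚ.+ ιₙ (L ^ e) ℚ.* (h ℚ.* ιₙ Y)) (ιₙ-* (L ^ e) roughRowCount) ⟩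
        z ℚ.* (ιₙ (L ^ e) ℚ.* ιₙ roughRowCount) ℚ.+ ιₙ (L ^ e) ℚ.* (h ℚ.* ιₙ Y)
          ≡⟨ solve 4 (λ z l g y → z :* (l :* g) :+ l :* y := l :* (z :* g :+ y)) refl z (ιₙ (L ^ e)) (ιₙ roughRowCount) (h ℚ.* ιₙ Y) ⟩
        ιₙ (L ^ e) ℚ.* (z ℚ.* ιₙ roughRowCount ℚ.+ h ℚ.* ιₙ Y) ∎

-- Uniform asymptotics for a single row.

module Asymptotics where

  open Sums
  open Vectors
  open Rationals
  open Quotients
  open Density
  open Elimination
  open RowCounts
  open Classification
  open import Defs using (ζ-partial; ζ-partial-upper; ζ-partial-mono; half-pos; half+half; 1/large<ε)
  open import Data.Nat.Base
  open import Data.Nat.Properties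
  open import Data.Nat.Solver using () renaming (module +-*-Solver to ℕ-Solver)
  open import Data.Vec.Relation.Unary.All using (All)

  -- A relative error: it adds up over the rows already chosen and multiplies along successive rows,
  -- without any division.
  record Near (ε x T : ℚ) : Set where
    constructor near
    field
      lower : (1ℚ ℚ.- ε) ℚ.* T ℚ.≤ x
      upper : x ℚ.≤ (1ℚ ℚ.+ ε) ℚ.* T

  archimedean : ∀ ε → 0ℚ ℚ.< ε → ∀ c → ∃[ N ] ∀ n → N ≤ n → ιₙ c ℚ.≤ ιₙ n ℚ.* ε
  archimedean ε 0<ε c = c * t , λ n N≤n → begin
    ιₙ c                           ≡⟨ ℚ.*-identityʳ (ιₙ c) ⟨
    ιₙ c ℚ.* 1ℚ                    ≡⟨ cong (ιₙ c ℚ.*_) (trans (ℚ.*-comm (ιₙ t) (1ℤ ℚ./ t)) (1/n*n≡1 t)) ⟨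
    ιₙ c ℚ.* (ιₙ t ℚ.* (1ℤ ℚ./ t)) ≡⟨ ℚ.*-assoc (ιₙ c) (ιₙ t) (1ℤ ℚ./ t) ⟨
    ιₙ c ℚ.* ιₙ t ℚ.* (1ℤ ℚ./ t)   ≡⟨ cong (ℚ._* (1ℤ ℚ./ t)) (ιₙ-* c t) ⟨
    ιₙ (c * t) ℚ.* (1ℤ ℚ./ t)      ≤⟨ *-monoʳ-0≤ {1ℤ ℚ./ t} (0≤1/ t) (ιₙ-mono-≤ N≤n) ⟩
    ιₙ n ℚ.* (1ℤ ℚ./ t)            ≤⟨ *-monoˡ-ι n (ℚ.<⇒≤ (1/large<ε ε 0<ε)) ⟩
    ιₙ n ℚ.* ε                     ∎
    where
    open ℚ.≤-Reasoning
    t = suc (ℚ.denominatorℕ ε)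

  -- This is `2 ^ D - 1`, the constant in `(1 + x)^D ≤ 1 + (2^D - 1) x` for `0 ≤ x ≤ 1`, applied
  -- with `x = L / n`.
  growth : ℕ → ℕ
  growth zero    = 0
  growth (suc D) = suc (growth D + growth D)

  power-upper : ∀ D {n L} → L ≤ n → n * (n + L) ^ D ≤ n * n ^ D + growth D * L * n ^ D
  power-upper zero    L≤n = m≤m+n _ _
  power-upper (suc D) {n} {L} L≤n = begin
    n * ((n + L) * (n + L) ^ D)                                            ≡⟨ solve 3 (λ n l p → n :* ((n :+ l) :* p) := (n :+ l) :* (n :* p)) refl n L ((n + L) ^ D) ⟩
    (n + L) * (n * (n + L) ^ D)                                            ≤⟨ *-monoʳ-≤ (n + L) (power-upper D L≤n) ⟩
    (n + L) * (n * P + g * L * P)                                          ≡⟨ solve 4 (λ n l p g → (n :+ l) :* (n :* p :+ g :* l :* p) := n :* (n :* p) :+ l :* (n :* p) :+ g :* l :* (n :* p) :+ g :* l :* p :* l) refl n L P g ⟩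
    n * (n * P) + L * (n * P) + g * L * (n * P) + g * L * P * L            ≤⟨ +-monoʳ-≤ _ (*-monoʳ-≤ (g * L * P) L≤n) ⟩
    n * (n * P) + L * (n * P) + g * L * (n * P) + g * L * P * n            ≡⟨ solve 4 (λ n l p g → n :* (n :* p) :+ l :* (n :* p) :+ g :* l :* (n :* p) :+ g :* l :* p :* n := n :* (n :* p) :+ (con 1 :+ (g :+ g)) :* l :* (n :* p)) refl n L P g ⟩
    n * (n * P) + suc (g + g) * L * (n * P)                                ∎
    where
    open ≤-Reasoning
    open ℕ-Solver
    P = n ^ D
    g = growth D

  -- Bernoulli's inequality for `(1 - L / n)^D`, multiplied by `n^(D+1)`.
  power-lower : ∀ D {n L} → L ≤ n → n * n ^ D ≤ n * (n ∸ L) ^ D + D * L * n ^ D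
  power-lower zero    L≤n = m≤m+n _ _
  power-lower (suc D) {n} {L} L≤n = begin
    n * (n * n ^ D)                                    ≤⟨ *-monoʳ-≤ n (power-lower D L≤n) ⟩
    n * (n * Y + D * L * P)                            ≡⟨ cong (λ x → n * (x * Y + D * L * P)) (m∸n+n≡m L≤n) ⟨
    n * ((w + L) * Y + D * L * P)                      ≡⟨ solve 6 (λ n w l y d p → n :* ((w :+ l) :* y :+ d :* l :* p) := n :* (w :* y) :+ l :* (n :* y) :+ d :* l :* (n :* p)) refl n w L Y D P ⟩
    n * (w * Y) + L * (n * Y) + D * L * (n * P)        ≤⟨ +-monoˡ-≤ _ (+-monoʳ-≤ (n * (w * Y)) (*-monoʳ-≤ L (*-monoʳ-≤ n (^-monoˡ-≤ D (m∸n≤m n L))))) ⟩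
    n * (w * Y) + L * (n * P) + D * L * (n * P)        ≡⟨ solve 5 (λ a l q d n → a :+ l :* q :+ d :* l :* q := a :+ (l :+ d :* l) :* q) refl (n * (w * Y)) L (n * P) D n ⟩
    n * (w * Y) + suc D * L * (n * P)                  ∎
    where
    open ≤-Reasoning
    open ℕ-Solver
    P = n ^ D
    w = n ∸ L
    Y = w ^ D

  unimodularCount : ∀ {k d e} {S : Vec (Vec ℤ d) k} → Quotient S (suc e) → Vec ℤ d → ℕ → ℕ
  unimodularCount Q b n = ∑ (box b n) (λ x → 𝟙 (unimodular? (Quotient.φ Q · x)))

  BoundedBox : ∀ {d} → ℕ → ℕ → Vec ℤ d → Set
  BoundedBox κ n b = ∀ {x} → x ∈ box b n → Bounded (n ^ κ) x

  module _ (d k r κ : ℕ) (eq : k + suc (suc r) ≡ suc d) (ε : ℚ) (0<ε : 0ℚ ℚ.< ε) where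
    private
      D = suc d
      e = suc (suc r)
      K = rowExponent κ k
      -- Collects the errors of order `1 / M`: one from the density, and `2 * 2 ^ D` from the
      -- divisors in `(M, n]`, with `2 ^ D` for the box of side `2 * n` and 2 as a bound for ζ.
      c = suc (2 * 2 ^ D)
      -- The `suc` ensures `1 ≤ m`, that is `M ≥ 2`.
      m = suc (proj₁ (archimedean (ε ℚ.* ½) (half-pos 0<ε) c))
      M = suc m
      h = 1ℤ ℚ./ M
      L = modulus m
      -- Collects the errors of relative order `1 / n`: enlarging the box by `L`, shrinking it by
      -- `L`, and the large primes, again with 2 as a bound for ζ.
      C = growth D * L + (D * L + 2 * suc (K + K))
      N = proj₁ (archimedean (ε ℚ.* ½) (half-pos 0<ε) C)

      threshold : ℕ
      threshold = N + (L + (M + suc (suc d + suc d)))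

      hc≤ : h ℚ.* ιₙ c ℚ.≤ ε ℚ.* ½
      hc≤ = begin
        h ℚ.* ιₙ c                      ≤⟨ *-monoˡ-0≤ {h} (0≤1/ M) (proj₂ (archimedean (ε ℚ.* ½) (half-pos 0<ε) c) M (m≤n+m _ 2)) ⟩
        h ℚ.* (ιₙ M ℚ.* (ε ℚ.* ½))      ≡⟨ ℚ.*-assoc h (ιₙ M) _ ⟨
        h ℚ.* ιₙ M ℚ.* (ε ℚ.* ½)        ≡⟨ cong (ℚ._* (ε ℚ.* ½)) (1/n*n≡1 M) ⟩
        1ℚ ℚ.* (ε ℚ.* ½)                ≡⟨ ℚ.*-identityˡ _ ⟩
        ε ℚ.* ½                         ∎
        where open ℚ.≤-Reasoning

    -- The threshold precedes `S`, `Q` and `b`: this uniformity allows summation over all choices of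
    -- the earlier rows. The index `j` is free because it will run through the Cauchy sequence of
    -- ζ(e) while `n` stays fixed.
    unimodularCount-near : ∃[ N ] ∀ n → N ≤ n → ∀ {S : Vec (Vec ℤ D) k} (Q : Quotient S e) →
      All (Bounded (n ^ κ)) S → ∀ b → BoundedBox κ n b → ∀ j → N ≤ j →
      Near ε (ζ-partial e j ℚ.* ιₙ (unimodularCount Q b n)) (ιₙ (n ^ D))
    unimodularCount-near = threshold , estimate
      where
      module _ (n : ℕ) (T≤n : threshold ≤ n) {S : Vec (Vec ℤ D) k} (Q : Quotient S e)
        (S≤ : All (Bounded (n ^ κ)) S) (b : Vec ℤ D) (box≤ : BoundedBox κ n b) (j : ℕ) (T≤j : threshold ≤ j) where
        N≤n : N ≤ n
        N≤n = m+n≤o⇒m≤o N T≤n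
        L≤n : L ≤ n
        L≤n = m+n≤o⇒m≤o L (m+n≤o⇒n≤o N T≤n)
        M≤ : ∀ {n} → threshold ≤ n → M ≤ n
        M≤ T≤n = m+n≤o⇒m≤o M (m+n≤o⇒n≤o L (m+n≤o⇒n≤o N T≤n))
        1+2d≤n : suc (suc d + suc d) ≤ n
        1+2d≤n = m+n≤o⇒n≤o M (m+n≤o⇒n≤o L (m+n≤o⇒n≤o N T≤n))
        instance
          n≢0 : NonZero n
          n≢0 = >-nonZero (≤-trans (s≤s z≤n) 1+2d≤n)
        G = unimodularCount Q b n
        P = n ^ D
        g p y w z ζ ν : ℚ
        g = ιₙ G
        p = ιₙ P
        y = ιₙ ((n ∸ L) ^ D)
        w = ιₙ (n ^ d * suc (K + K))
        z = ζ-partial e M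
        ζ = ζ-partial e j
        ν = ιₙ n

        C≤ : ιₙ C ℚ.≤ ν ℚ.* (ε ℚ.* ½)
        C≤ = proj₂ (archimedean (ε ℚ.* ½) (half-pos 0<ε) C) n N≤n

        part≤ : ∀ {x} → x ≤ C → ιₙ x ℚ.* p ℚ.≤ ν ℚ.* (ε ℚ.* ½) ℚ.* p
        part≤ x≤C = *-monoʳ-ι P (ℚ.≤-trans (ιₙ-mono-≤ x≤C) C≤)

        large-box : ιₙ ((n + L) ^ D) ℚ.≤ p ℚ.+ ε ℚ.* ½ ℚ.* p
        large-box = *-cancelˡ-ι n (begin
          ν ℚ.* ιₙ ((n + L) ^ D)                   ≡⟨ ιₙ-* n ((n + L) ^ D) ⟨
          ιₙ (n * (n + L) ^ D)                     ≤⟨ ιₙ-mono-≤ (power-upper D L≤n) ⟩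
          ιₙ (n * P + growth D * L * P)            ≡⟨ trans (ιₙ-+ (n * P) _) (cong₂ ℚ._+_ (ιₙ-* n P) (ιₙ-* (growth D * L) P)) ⟩
          ν ℚ.* p ℚ.+ ιₙ (growth D * L) ℚ.* p      ≤⟨ ℚ.+-monoʳ-≤ (ν ℚ.* p) (part≤ (m≤m+n (growth D * L) _)) ⟩
          ν ℚ.* p ℚ.+ ν ℚ.* (ε ℚ.* ½) ℚ.* p        ≡⟨ solve 3 (λ ν p u → ν :* p :+ ν :* u :* p := ν :* (p :+ u :* p)) refl ν p (ε ℚ.* ½) ⟩
          ν ℚ.* (p ℚ.+ ε ℚ.* ½ ℚ.* p)              ∎)
          where
          open ℚ.≤-Reasoning
          open +-*-Solver

        small-box : p ℚ.+ (w ℚ.+ w) ℚ.≤ y ℚ.+ ε ℚ.* ½ ℚ.* p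
        small-box = *-cancelˡ-ι n (begin
          ν ℚ.* (p ℚ.+ (w ℚ.+ w))
            ≡⟨ trans (cong (λ q → ν ℚ.* (p ℚ.+ q)) (sym (ιₙ-+ W W))) (trans (cong (ν ℚ.*_) (sym (ιₙ-+ P (W + W)))) (sym (ιₙ-* n (P + (W + W))))) ⟩
          ιₙ (n * (P + (W + W)))
            ≤⟨ ιₙ-mono-≤ combined ⟩
          ιₙ (n * (n ∸ L) ^ D + (D * L + 2 * suc (K + K)) * P)
            ≡⟨ trans (ιₙ-+ (n * (n ∸ L) ^ D) _) (cong₂ ℚ._+_ (ιₙ-* n ((n ∸ L) ^ D)) (ιₙ-* (D * L + 2 * suc (K + K)) P)) ⟩
          ν ℚ.* y ℚ.+ ιₙ (D * L + 2 * suc (K + K)) ℚ.* p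
            ≤⟨ ℚ.+-monoʳ-≤ (ν ℚ.* y) (part≤ (m≤n+m _ (growth D * L))) ⟩
          ν ℚ.* y ℚ.+ ν ℚ.* (ε ℚ.* ½) ℚ.* p
            ≡⟨ solve 4 (λ ν y p u → ν :* y :+ ν :* u :* p := ν :* (y :+ u :* p)) refl ν y p (ε ℚ.* ½) ⟩
          ν ℚ.* (y ℚ.+ ε ℚ.* ½ ℚ.* p) ∎)
          where
          open ℚ.≤-Reasoning
          open +-*-Solver
          W = n ^ d * suc (K + K)
          combined : n * (P + (W + W)) ≤ n * (n ∸ L) ^ D + (D * L + 2 * suc (K + K)) * P
          combined = ≤-trans (≤-reflexive (S.solve 4 (λ n p q s → n S.:* (p S.:+ (q S.:* s S.:+ q S.:* s)) S.:= n S.:* p S.:+ S.con 2 S.:* s S.:* (n S.:* q)) refl n P (n ^ d) (suc (K + K))))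
            (≤-trans (+-monoˡ-≤ _ (power-lower D L≤n))
              (≤-reflexive (S.solve 4 (λ a b s p → a S.:+ b S.:* p S.:+ s S.:* p S.:= a S.:+ (b S.:+ s) S.:* p) refl (n * (n ∸ L) ^ D) (D * L) (2 * suc (K + K)) P)))
            where module S = ℕ-Solver

        hcp≤ : h ℚ.* ιₙ c ℚ.* p ℚ.≤ ε ℚ.* ½ ℚ.* p
        hcp≤ = *-monoʳ-ι P hc≤

        *-monoˡ-h : ∀ {x x′} → x ℚ.≤ x′ → h ℚ.* x ℚ.≤ h ℚ.* x′
        *-monoˡ-h = *-monoˡ-0≤ {h} (0≤1/ M)

        G≤P : G ≤ P
        G≤P = ≤-trans (∑-box-≤ b n 1 (λ {x} _ → 𝟙≤1 (unimodular? (Quotient.φ Q · x)))) (≤-reflexive (*-identityʳ P))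

        estimate : Near ε (ζ ℚ.* g) p
        estimate = near lower upper
          where
          open ℚ.≤-Reasoning
          open +-*-Solver
          upper : ζ ℚ.* g ℚ.≤ (1ℚ ℚ.+ ε) ℚ.* p
          upper = begin
            ζ ℚ.* g
              ≤⟨ *-monoʳ-ι G (ζ-partial-upper {e} (s≤s (s≤s z≤n)) {m} {j} (M≤ T≤j)) ⟩
            (z ℚ.+ h) ℚ.* g
              ≡⟨ ℚ.*-distribʳ-+ g z h ⟩
            z ℚ.* g ℚ.+ h ℚ.* g
              ≤⟨ ℚ.+-mono-≤ (rowCount-upper Q eq n κ 1+2d≤n S≤ b box≤ m (s≤s z≤n) (M≤ T≤n)) h*g≤ ⟩
            ιₙ ((n + L) ^ D) ℚ.+ ε ℚ.* ½ ℚ.* p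
              ≤⟨ ℚ.+-monoˡ-≤ (ε ℚ.* ½ ℚ.* p) large-box ⟩
            p ℚ.+ ε ℚ.* ½ ℚ.* p ℚ.+ ε ℚ.* ½ ℚ.* p
              ≡⟨ solve 2 (λ p u → p :+ u :* p :+ u :* p := (con 1ℚ :+ (u :+ u)) :* p) refl p (ε ℚ.* ½) ⟩
            (1ℚ ℚ.+ (ε ℚ.* ½ ℚ.+ ε ℚ.* ½)) ℚ.* p
              ≡⟨ cong (λ ε → (1ℚ ℚ.+ ε) ℚ.* p) (half+half ε) ⟩
            (1ℚ ℚ.+ ε) ℚ.* p ∎
            where
            h*g≤ : h ℚ.* g ℚ.≤ ε ℚ.* ½ ℚ.* p
            h*g≤ = begin
              h ℚ.* g               ≤⟨ *-monoˡ-h (ιₙ-mono-≤ (≤-trans G≤P (m≤n*m P c))) ⟩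
              h ℚ.* ιₙ (c * P)      ≡⟨ trans (cong (h ℚ.*_) (ιₙ-* c P)) (sym (ℚ.*-assoc h (ιₙ c) p)) ⟩
              h ℚ.* ιₙ c ℚ.* p      ≤⟨ hcp≤ ⟩
              ε ℚ.* ½ ℚ.* p         ∎
          -- The tail estimate after the first term: `1 + 1 / 1`.
          z≤2 : z ℚ.≤ ιₙ 2
          z≤2 = begin
            z                                    ≤⟨ ζ-partial-upper {e} (s≤s (s≤s z≤n)) {0} {M} (s≤s z≤n) ⟩
            ζ-partial e 1 ℚ.+ 1ℤ ℚ./ 1           ≡⟨ cong (ℚ._+ (1ℤ ℚ./ 1)) (trans (ζ-partial-one e) (sym ιₙ-one)) ⟩
            ιₙ 1 ℚ.+ 1ℤ ℚ./ 1                    ≡⟨ cong (ιₙ 1 ℚ.+_) (ιₙ≡ι 1) ⟨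
            ιₙ 1 ℚ.+ ιₙ 1                        ≡⟨ ιₙ-+ 1 1 ⟨
            ιₙ 2                                 ∎
          remainder : ℚ
          remainder = h ℚ.* ιₙ ((2 * n) ^ D) ℚ.+ w
          0≤remainder : 0ℚ ℚ.≤ remainder
          0≤remainder = ℚ.≤-trans (ℚ.≤-reflexive (sym (trans (cong (ℚ._+ 0ℚ) (ℚ.*-zeroʳ h)) (ℚ.+-identityˡ 0ℚ))))
            (ℚ.+-mono-≤ (*-monoˡ-h (0≤ιₙ ((2 * n) ^ D))) (0≤ιₙ _))
          y≤ : y ℚ.≤ ζ ℚ.* g ℚ.+ ε ℚ.* ½ ℚ.* p ℚ.+ (w ℚ.+ w)
          y≤ = begin
            y
              ≤⟨ rowCount-lower Q eq n κ 1+2d≤n S≤ b box≤ m (s≤s z≤n) (M≤ T≤n) ⟩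
            z ℚ.* g ℚ.+ h ℚ.* y ℚ.+ z ℚ.* remainder
              ≤⟨ ℚ.+-mono-≤ (ℚ.+-mono-≤ (*-monoʳ-ι G (ζ-partial-mono e (M≤ T≤j)))
                   (*-monoˡ-h (ιₙ-mono-≤ (^-monoˡ-≤ D (m∸n≤m n L)))))
                   (*-monoʳ-0≤ {remainder} 0≤remainder z≤2) ⟩
            ζ ℚ.* g ℚ.+ h ℚ.* p ℚ.+ ιₙ 2 ℚ.* (h ℚ.* ιₙ ((2 * n) ^ D) ℚ.+ w)
              ≡⟨ cong₂ (λ t q → ζ ℚ.* g ℚ.+ h ℚ.* p ℚ.+ t ℚ.* (h ℚ.* q ℚ.+ w)) two (trans (cong ιₙ (^-distribʳ-* D 2 n)) (ιₙ-* (2 ^ D) P)) ⟩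
            ζ ℚ.* g ℚ.+ h ℚ.* p ℚ.+ (1ℚ ℚ.+ 1ℚ) ℚ.* (h ℚ.* (ιₙ (2 ^ D) ℚ.* p) ℚ.+ w)
              ≡⟨ solve 5 (λ a h p t w → a :+ h :* p :+ (con 1ℚ :+ con 1ℚ) :* (h :* (t :* p) :+ w) := a :+ h :* (con 1ℚ :+ (t :+ t)) :* p :+ (w :+ w)) refl (ζ ℚ.* g) h p (ιₙ (2 ^ D)) w ⟩
            ζ ℚ.* g ℚ.+ h ℚ.* (1ℚ ℚ.+ (ιₙ (2 ^ D) ℚ.+ ιₙ (2 ^ D))) ℚ.* p ℚ.+ (w ℚ.+ w)
              ≡⟨ cong (λ c → ζ ℚ.* g ℚ.+ h ℚ.* c ℚ.* p ℚ.+ (w ℚ.+ w)) c≡ ⟨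
            ζ ℚ.* g ℚ.+ h ℚ.* ιₙ c ℚ.* p ℚ.+ (w ℚ.+ w)
              ≤⟨ ℚ.+-monoˡ-≤ (w ℚ.+ w) (ℚ.+-monoʳ-≤ (ζ ℚ.* g) hcp≤) ⟩
            ζ ℚ.* g ℚ.+ ε ℚ.* ½ ℚ.* p ℚ.+ (w ℚ.+ w) ∎
            where
            two : ιₙ 2 ≡ 1ℚ ℚ.+ 1ℚ
            two = trans (ιₙ-+ 1 1) (cong₂ ℚ._+_ ιₙ-one ιₙ-one)
            c≡ : ιₙ c ≡ 1ℚ ℚ.+ (ιₙ (2 ^ D) ℚ.+ ιₙ (2 ^ D))
            c≡ = trans (ιₙ-+ 1 (2 * 2 ^ D)) (cong₂ ℚ._+_ ιₙ-one (trans (cong (λ x → ιₙ (2 ^ D + x)) (+-identityʳ (2 ^ D))) (ιₙ-+ (2 ^ D) (2 ^ D))))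
          lower : (1ℚ ℚ.- ε) ℚ.* p ℚ.≤ ζ ℚ.* g
          lower = begin
            (1ℚ ℚ.- ε) ℚ.* p
              ≡⟨ cong (λ ε → (1ℚ ℚ.- ε) ℚ.* p) (half+half ε) ⟨
            (1ℚ ℚ.- (ε ℚ.* ½ ℚ.+ ε ℚ.* ½)) ℚ.* p
              ≡⟨ solve 3 (λ p u w → (con 1ℚ :- (u :+ u)) :* p := p :+ (w :+ w) :- u :* p :- u :* p :- (w :+ w)) refl p (ε ℚ.* ½) w ⟩
            p ℚ.+ (w ℚ.+ w) ℚ.- ε ℚ.* ½ ℚ.* p ℚ.- ε ℚ.* ½ ℚ.* p ℚ.- (w ℚ.+ w)
              ≤⟨ shift (shift (shift small-box)) ⟩
            y ℚ.+ ε ℚ.* ½ ℚ.* p ℚ.- ε ℚ.* ½ ℚ.* p ℚ.- ε ℚ.* ½ ℚ.* p ℚ.- (w ℚ.+ w)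
              ≤⟨ shift (shift (shift (ℚ.+-monoˡ-≤ (ε ℚ.* ½ ℚ.* p) y≤))) ⟩
            ζ ℚ.* g ℚ.+ ε ℚ.* ½ ℚ.* p ℚ.+ (w ℚ.+ w) ℚ.+ ε ℚ.* ½ ℚ.* p ℚ.- ε ℚ.* ½ ℚ.* p ℚ.- ε ℚ.* ½ ℚ.* p ℚ.- (w ℚ.+ w)
              ≡⟨ solve 3 (λ a u w → a :+ u :+ w :+ u :- u :- u :- w := a) refl (ζ ℚ.* g) (ε ℚ.* ½ ℚ.* p) (w ℚ.+ w) ⟩
            ζ ℚ.* g ∎
            where
            shift : ∀ {x x′ u} → x ℚ.≤ x′ → x ℚ.- u ℚ.≤ x′ ℚ.- u
            shift {u = u} = ℚ.+-monoˡ-≤ (ℚ.- u)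

-- Counting primitive matrices by induction on the number of rows.

module Matrices where

  open Sums
  open Rationals
  open Quotients
  open Elimination using (Bounded)
  open RowCounts using (0≤ζ)
  open Classification
  open Asymptotics
  open import Defs using (ζ-partial; half-pos; half+half; 1/large<ε)
  open import Data.List.Base using (cartesianProductWith)
  open import Data.List.Membership.Propositional.Properties using (∈-cartesianProductWith⁻)
  open import Data.Nat.Base
  open import Data.Nat.Properties
  open import Data.Vec.Relation.Unary.All using (All; []; _∷_)

  matrices : ∀ {k d} → Vec (Vec ℤ d) k → ℕ → List (Vec (Vec ℤ d) k)
  matrices []      n = [] ∷ []
  matrices (b ∷ B) n = cartesianProductWith _∷_ (box b n) (matrices B n)

  primitiveCount : ∀ {k d} e → k + e ≡ d → Vec (Vec ℤ d) k → ℕ → ℕ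
  primitiveCount e eq B n = ∑ (matrices B n) (λ S → indicator (classify e S eq))

  matrices-bounded : ∀ {k d} κ n (B : Vec (Vec ℤ d) k) → All (BoundedBox κ n) B → ∀ {S} → S ∈ matrices B n → All (Bounded (n ^ κ)) S
  matrices-bounded κ n [] [] (here refl) = []
  matrices-bounded κ n (b ∷ B) (box≤ ∷ B≤) S∈ with _ , _ , s∈ , S∈′ , refl ← ∈-cartesianProductWith⁻ _∷_ (box b n) (matrices B n) S∈ =
    box≤ s∈ ∷ matrices-bounded κ n B B≤ S∈′

  rowExtensions : ∀ {k d e} {S : Vec (Vec ℤ d) k} → Vec ℤ d → ℕ → Completable S (suc e) ⊎ ¬ Saturated S → ℕ
  rowExtensions b n c = ∑ (box b n) (λ s → indicator (classify-∷ s c))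

  -- The classification recurses on the tail, so the head is the row added last. Swapping the sums
  -- fixes the tail and lets the head run through its box.
  primitiveCount-∷ : ∀ {k d} e (eq : suc k + e ≡ d) b (B : Vec (Vec ℤ d) k) n →
    primitiveCount e eq (b ∷ B) n ≡ ∑ (matrices B n) (λ S → rowExtensions b n (classify (suc e) S (trans (+-suc k e) eq)))
  primitiveCount-∷ e eq b B n = trans (∑-cartesianProductWith _∷_ (box b n) (matrices B n) _) (∑-swap (box b n) (matrices B n) _)

  near-∑ : ∀ {A : Set} ε z (xs : List A) f g → (∀ {x} → x ∈ xs → Near ε (z ℚ.* ιₙ (f x)) (ιₙ (g x))) →
    Near ε (z ℚ.* ιₙ (∑ xs f)) (ιₙ (∑ xs g))
  near-∑ ε z [] f g h = near
    (ℚ.≤-reflexive (trans (*-ιₙ0 (1ℚ ℚ.- ε)) (sym (*-ιₙ0 z))))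
    (ℚ.≤-reflexive (trans (*-ιₙ0 z) (sym (*-ιₙ0 (1ℚ ℚ.+ ε)))))
    where
    *-ιₙ0 : ∀ z → z ℚ.* ιₙ 0 ≡ 0ℚ
    *-ιₙ0 z = trans (cong (z ℚ.*_) ιₙ-zero) (ℚ.*-zeroʳ z)
  near-∑ ε z (x ∷ xs) f g h with near l u ← h (here refl) | near ls us ← near-∑ ε z xs f g (h ∘ there) = near
    (subst₂ ℚ._≤_ (sym (split (1ℚ ℚ.- ε) (g x) (∑ xs g))) (sym (split z (f x) (∑ xs f))) (ℚ.+-mono-≤ l ls))
    (subst₂ ℚ._≤_ (sym (split z (f x) (∑ xs f))) (sym (split (1ℚ ℚ.+ ε) (g x) (∑ xs g))) (ℚ.+-mono-≤ u us))
    where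
    split : ∀ z m n → z ℚ.* ιₙ (m + n) ≡ z ℚ.* ιₙ m ℚ.+ z ℚ.* ιₙ n
    split z m n = trans (cong (z ℚ.*_) (ιₙ-+ m n)) (ℚ.*-distribˡ-+ z (ιₙ m) (ιₙ n))

  ζ-partials : ℕ → ℕ → ℕ → ℚ
  ζ-partials d zero    j = 1ℚ
  ζ-partials d (suc k) j = ζ-partials d k j ℚ.* ζ-partial (d ∸ k) j

  0≤ζ-partials : ∀ d k j → 0ℚ ℚ.≤ ζ-partials d k j
  0≤ζ-partials d zero    j = ℚ.nonNegative⁻¹ 1ℚ
  0≤ζ-partials d (suc k) j = 0≤* (0≤ζ-partials d k j) (0≤ζ (d ∸ k) j)

  -- For `0 < δ ≤ 1` one has `(1 + δ)² ≤ 1 + 3 δ` and `(1 - δ)² ≥ 1 - 3 δ`, so two successive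
  -- relative errors `δ` amount to at most `ε`.
  record Third (ε : ℚ) : Set where
    field
      δ     : ℚ
      0<δ   : 0ℚ ℚ.< δ
      δ≤1   : δ ℚ.≤ 1ℚ
      3δ≤ε  : δ ℚ.+ δ ℚ.+ δ ℚ.≤ ε

  third : ∀ ε → 0ℚ ℚ.< ε → Third ε
  third ε 0<ε = record { δ = δ ; 0<δ = 0<δ ; δ≤1 = δ≤1 ; 3δ≤ε = 3δ≤ε }
    where
    η = ε ℚ.* ½ ℚ.* ½
    0<η : 0ℚ ℚ.< η
    0<η = half-pos (half-pos 0<ε)
    t = suc (ℚ.denominatorℕ η)
    -- The reciprocal of a positive integer is at most 1 automatically, and this integer is large
    -- enough to put it below `ε / 4`.
    δ = 1ℤ ℚ./ t
    0<δ : 0ℚ ℚ.< δ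
    0<δ = ℚ.positive⁻¹ δ {{ℚ.normalize-pos 1 t}}
    δ≤1 : δ ℚ.≤ 1ℚ
    δ≤1 = begin
      δ                ≡⟨ ℚ.*-identityʳ δ ⟨
      δ ℚ.* 1ℚ         ≡⟨ cong (δ ℚ.*_) ιₙ-one ⟨
      δ ℚ.* ιₙ 1       ≤⟨ *-monoˡ-0≤ {δ} (ℚ.<⇒≤ 0<δ) (ιₙ-mono-≤ {1} {t} (s≤s z≤n)) ⟩
      δ ℚ.* ιₙ t       ≡⟨ 1/n*n≡1 t ⟩
      1ℚ               ∎
      where open ℚ.≤-Reasoning
    3δ≤ε : δ ℚ.+ δ ℚ.+ δ ℚ.≤ ε
    3δ≤ε = begin
      δ ℚ.+ δ ℚ.+ δ                  ≤⟨ ℚ.+-mono-≤ (ℚ.+-mono-≤ δ≤η δ≤η) (ℚ.≤-trans (ℚ.≤-reflexive (sym (ℚ.+-identityʳ δ))) (ℚ.+-mono-≤ δ≤η (ℚ.<⇒≤ 0<η))) ⟩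
      η ℚ.+ η ℚ.+ (η ℚ.+ η)          ≡⟨ cong₂ ℚ._+_ (half+half (ε ℚ.* ½)) (half+half (ε ℚ.* ½)) ⟩
      ε ℚ.* ½ ℚ.+ ε ℚ.* ½            ≡⟨ half+half ε ⟩
      ε                              ∎
      where
      open ℚ.≤-Reasoning
      δ≤η : δ ℚ.≤ η
      δ≤η = ℚ.<⇒≤ (1/large<ε η 0<η)

  -- Here `a` counts the primitive tails, `p` is the volume of the box of the new row, and `x`
  -- counts the primitive extensions; `z` and `Z` are the new factor of ζ values and the product of
  -- the earlier ones.
  near-trans : ∀ {ε} (t : Third ε) → let open Third t in ∀ {Z z x} p a T → 0ℚ ℚ.≤ Z → 0ℚ ℚ.≤ p → 0ℚ ℚ.≤ T →
    Near δ (z ℚ.* x) (p ℚ.* a) → Near δ (Z ℚ.* a) T → Near ε (Z ℚ.* z ℚ.* x) (p ℚ.* T)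
  near-trans {ε} t {Z} {z} {x} p a T 0≤Z 0≤p 0≤T (near l₁ u₁) (near l₂ u₂) = near lower upper
    where
    open Third t
    open ℚ.≤-Reasoning
    open +-*-Solver
    0≤δ : 0ℚ ℚ.≤ δ
    0≤δ = ℚ.<⇒≤ 0<δ
    0≤1+δ : 0ℚ ℚ.≤ 1ℚ ℚ.+ δ
    0≤1+δ = ℚ.+-mono-≤ (ℚ.nonNegative⁻¹ 1ℚ) 0≤δ
    0≤1-δ : 0ℚ ℚ.≤ 1ℚ ℚ.- δ
    0≤1-δ = subst (ℚ._≤ 1ℚ ℚ.- δ) (ℚ.+-inverseʳ δ) (ℚ.+-monoˡ-≤ (ℚ.- δ) δ≤1)
    0≤pT : 0ℚ ℚ.≤ p ℚ.* T
    0≤pT = 0≤* 0≤p 0≤T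
    δδ≤δ : δ ℚ.* δ ℚ.≤ δ
    δδ≤δ = subst (δ ℚ.* δ ℚ.≤_) (ℚ.*-identityʳ δ) (*-monoˡ-0≤ 0≤δ δ≤1)
    upper : Z ℚ.* z ℚ.* x ℚ.≤ (1ℚ ℚ.+ ε) ℚ.* (p ℚ.* T)
    upper = begin
      Z ℚ.* z ℚ.* x                              ≡⟨ ℚ.*-assoc Z z x ⟩
      Z ℚ.* (z ℚ.* x)                            ≤⟨ *-monoˡ-0≤ 0≤Z u₁ ⟩
      Z ℚ.* ((1ℚ ℚ.+ δ) ℚ.* (p ℚ.* a))           ≡⟨ solve 4 (λ Z c p a → Z :* (c :* (p :* a)) := c :* p :* (Z :* a)) refl Z (1ℚ ℚ.+ δ) p a ⟩
      (1ℚ ℚ.+ δ) ℚ.* p ℚ.* (Z ℚ.* a)             ≤⟨ *-monoˡ-0≤ (0≤* 0≤1+δ 0≤p) u₂ ⟩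
      (1ℚ ℚ.+ δ) ℚ.* p ℚ.* ((1ℚ ℚ.+ δ) ℚ.* T)    ≡⟨ solve 3 (λ δ p T → (con 1ℚ :+ δ) :* p :* ((con 1ℚ :+ δ) :* T) := p :* T :* (con 1ℚ :+ (δ :+ δ :+ δ :* δ))) refl δ p T ⟩
      p ℚ.* T ℚ.* (1ℚ ℚ.+ (δ ℚ.+ δ ℚ.+ δ ℚ.* δ)) ≤⟨ *-monoˡ-0≤ 0≤pT (ℚ.+-monoʳ-≤ 1ℚ (ℚ.≤-trans (ℚ.+-monoʳ-≤ (δ ℚ.+ δ) δδ≤δ) 3δ≤ε)) ⟩
      p ℚ.* T ℚ.* (1ℚ ℚ.+ ε)                     ≡⟨ ℚ.*-comm (p ℚ.* T) _ ⟩
      (1ℚ ℚ.+ ε) ℚ.* (p ℚ.* T)                   ∎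
    lower : (1ℚ ℚ.- ε) ℚ.* (p ℚ.* T) ℚ.≤ Z ℚ.* z ℚ.* x
    lower = begin
      (1ℚ ℚ.- ε) ℚ.* (p ℚ.* T)                   ≡⟨ ℚ.*-comm (1ℚ ℚ.- ε) _ ⟩
      p ℚ.* T ℚ.* (1ℚ ℚ.- ε)                     ≤⟨ *-monoˡ-0≤ 0≤pT (ℚ.+-monoʳ-≤ 1ℚ (ℚ.neg-antimono-≤ 3δ≤ε)) ⟩
      p ℚ.* T ℚ.* (1ℚ ℚ.- (δ ℚ.+ δ ℚ.+ δ))       ≤⟨ *-monoˡ-0≤ 0≤pT shrink ⟩
      p ℚ.* T ℚ.* ((1ℚ ℚ.- δ) ℚ.* (1ℚ ℚ.- δ))    ≡⟨ solve 3 (λ c p T → p :* T :* (c :* c) := c :* p :* (c :* T)) refl (1ℚ ℚ.- δ) p T ⟩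
      (1ℚ ℚ.- δ) ℚ.* p ℚ.* ((1ℚ ℚ.- δ) ℚ.* T)    ≤⟨ *-monoˡ-0≤ (0≤* 0≤1-δ 0≤p) l₂ ⟩
      (1ℚ ℚ.- δ) ℚ.* p ℚ.* (Z ℚ.* a)             ≡⟨ solve 4 (λ Z c p a → Z :* (c :* (p :* a)) := c :* p :* (Z :* a)) refl Z (1ℚ ℚ.- δ) p a ⟨
      Z ℚ.* ((1ℚ ℚ.- δ) ℚ.* (p ℚ.* a))           ≤⟨ *-monoˡ-0≤ 0≤Z l₁ ⟩
      Z ℚ.* (z ℚ.* x)                            ≡⟨ ℚ.*-assoc Z z x ⟨
      Z ℚ.* z ℚ.* x                              ∎
      where
      shrink : 1ℚ ℚ.- (δ ℚ.+ δ ℚ.+ δ) ℚ.≤ (1ℚ ℚ.- δ) ℚ.* (1ℚ ℚ.- δ)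
      shrink = begin
        1ℚ ℚ.- (δ ℚ.+ δ ℚ.+ δ)                          ≡⟨ ℚ.+-identityʳ _ ⟨
        1ℚ ℚ.- (δ ℚ.+ δ ℚ.+ δ) ℚ.+ 0ℚ                   ≤⟨ ℚ.+-monoʳ-≤ (1ℚ ℚ.- (δ ℚ.+ δ ℚ.+ δ)) (ℚ.+-mono-≤ 0≤δ (0≤* 0≤δ 0≤δ)) ⟩
        1ℚ ℚ.- (δ ℚ.+ δ ℚ.+ δ) ℚ.+ (δ ℚ.+ δ ℚ.* δ)      ≡⟨ solve 1 (λ δ → con 1ℚ :- (δ :+ δ :+ δ) :+ (δ :+ δ :* δ) := (con 1ℚ :- δ) :* (con 1ℚ :- δ)) refl δ ⟩
        (1ℚ ℚ.- δ) ℚ.* (1ℚ ℚ.- δ)                       ∎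

  primitiveCount-near : ∀ d κ k e (eq : k + suc e ≡ suc d) ε → 0ℚ ℚ.< ε →
    ∃[ N ] ∀ n → N ≤ n → ∀ (B : Vec (Vec ℤ (suc d)) k) → All (BoundedBox κ n) B → ∀ j → N ≤ j →
    Near ε (ζ-partials (suc d) k j ℚ.* ιₙ (primitiveCount (suc e) eq B n)) (ιₙ ((n ^ suc d) ^ k))
  primitiveCount-near d κ zero .d refl ε 0<ε = 0 , λ { n _ [] _ j _ → near
    (begin
      (1ℚ ℚ.- ε) ℚ.* ιₙ 1    ≤⟨ *-monoʳ-ι 1 (ℚ.+-monoʳ-≤ 1ℚ (ℚ.neg-antimono-≤ (ℚ.<⇒≤ 0<ε))) ⟩
      (1ℚ ℚ.- 0ℚ) ℚ.* ιₙ 1   ≡⟨⟩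
      1ℚ ℚ.* ιₙ 1            ∎)
    (begin
      1ℚ ℚ.* ιₙ 1            ≡⟨⟩
      (1ℚ ℚ.+ 0ℚ) ℚ.* ιₙ 1   ≤⟨ *-monoʳ-ι 1 (ℚ.+-monoʳ-≤ 1ℚ (ℚ.<⇒≤ 0<ε)) ⟩
      (1ℚ ℚ.+ ε) ℚ.* ιₙ 1    ∎) }
    where open ℚ.≤-Reasoning
  primitiveCount-near d κ (suc k) e eq ε 0<ε = N₁ ⊔ N₂ , step
    where
    t = third ε 0<ε
    open Third t
    D = suc d
    eq′ : k + suc (suc e) ≡ D
    eq′ = trans (+-suc k (suc e)) eq
    rows-near = unimodularCount-near d k e κ eq′ δ 0<δ
    N₁ = proj₁ rows-near
    tail-near = primitiveCount-near d κ k (suc e) eq′ δ 0<δ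
    N₂ = proj₁ tail-near
    -- The quotient by the first `k` rows has rank `D ∸ k`, which is the argument of the ζ factor
    -- contributed by the next row.
    D∸k : suc (suc e) ≡ D ∸ k
    D∸k = trans (sym (m+n∸m≡n k (suc (suc e)))) (cong (_∸ k) eq′)
    step : ∀ n → N₁ ⊔ N₂ ≤ n → ∀ (B : Vec (Vec ℤ D) (suc k)) → All (BoundedBox κ n) B → ∀ j → N₁ ⊔ N₂ ≤ j →
      Near ε (ζ-partials D (suc k) j ℚ.* ιₙ (primitiveCount (suc e) eq B n)) (ιₙ ((n ^ D) ^ suc k))
    step n N≤n (b ∷ B) (box≤ ∷ B≤) j N≤j = subst (Near ε _) (sym (ιₙ-* (n ^ D) ((n ^ D) ^ k)))
      (near-trans t (ιₙ (n ^ D)) (ιₙ A) (ιₙ ((n ^ D) ^ k)) (0≤ζ-partials D k j) (0≤ιₙ (n ^ D)) (0≤ιₙ ((n ^ D) ^ k)) head-near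
        (proj₂ tail-near n (m⊔n≤o⇒n≤o N₁ N₂ N≤n) B B≤ j (m⊔n≤o⇒n≤o N₁ N₂ N≤j)))
      where
      A = primitiveCount (suc (suc e)) eq′ B n
      extension-near : ∀ {S} → S ∈ matrices B n → ∀ c →
        Near δ (ζ-partial (suc (suc e)) j ℚ.* ιₙ (rowExtensions {S = S} b n c)) (ιₙ (n ^ D * indicator c))
      extension-near {S} S∈ (inj₁ (Q , basis)) = subst₂ (λ x y → Near δ (ζ-partial (suc (suc e)) j ℚ.* ιₙ x) (ιₙ y))
        (∑-cong (box b n) (λ s → sym (indicator-classify-∷ s Q basis))) (sym (*-identityʳ (n ^ D)))
        (proj₂ rows-near n (m⊔n≤o⇒m≤o N₁ N₂ N≤n) Q (matrices-bounded κ n B B≤ S∈) b box≤ j (m⊔n≤o⇒m≤o N₁ N₂ N≤j))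
      -- A tail that is not saturated has no primitive extension, so both sides are zero; the empty
      -- sum supplies this trivial estimate.
      extension-near {S} S∈ (inj₂ ¬sat) = subst₂ (λ x y → Near δ (ζ-partial (suc (suc e)) j ℚ.* ιₙ x) (ιₙ y))
        (sym (∑-zero (box b n) (λ _ → refl))) (sym (*-zeroʳ (n ^ D))) (near-∑ δ (ζ-partial (suc (suc e)) j) [] (λ (x : ℕ) → x) (λ x → x) (λ ()))
      head-near : Near δ (ζ-partial (D ∸ k) j ℚ.* ιₙ (primitiveCount (suc e) eq (b ∷ B) n)) (ιₙ (n ^ D) ℚ.* ιₙ A)
      head-near = subst₂ (λ r x → Near δ (ζ-partial r j ℚ.* ιₙ x) (ιₙ (n ^ D) ℚ.* ιₙ A)) D∸k (sym (primitiveCount-∷ (suc e) eq b B n))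
        (subst (Near δ _) (trans (cong ιₙ (∑-*ˡ (matrices B n) (n ^ D) (λ S → indicator (classify (suc (suc e)) S eq′)))) (ιₙ-* (n ^ D) A))
          (near-∑ δ (ζ-partial (suc (suc e)) j) (matrices B n) _ _ (λ {S} S∈ → extension-near S∈ (classify (suc (suc e)) S eq′))))

-- Probabilities as normalised counts.

module Probability where

  open Sums
  open Rationals
  open RealSpans using (rows)
  open Matrices using (matrices)
  open import Defs using (Distribution; uniform; independent; probability; randomVectors)
  open import Data.List.Base using (_++_; map; cartesianProductWith; applyUpTo; upTo)
  open import Data.Rational.Base using (_+_; _*_; _/_)
  open import Data.Rational.Properties
  open import Data.Vec.Base using (tabulate)
  open import Function.Base using (id)

  expectation : {A : Set} → Distribution A → (A → ℚ) → ℚ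
  expectation []            f = 0ℚ
  expectation ((x , p) ∷ D) f = f x * p + expectation D f

  expectation-++ : ∀ {A : Set} (D D′ : Distribution A) f → expectation (D ++ D′) f ≡ expectation D f + expectation D′ f
  expectation-++ []            D′ f = sym (+-identityˡ _)
  expectation-++ ((x , p) ∷ D) D′ f = trans (cong (f x * p +_) (expectation-++ D D′ f)) (sym (+-assoc (f x * p) _ _))

  probability≡expectation : ∀ {A : Set} {P : A → Set} (P? : Decidable P) (D : Distribution A) →
    probability P? D ≡ expectation D (λ x → ιₙ (𝟙 (P? x)))
  probability≡expectation P? [] = refl
  probability≡expectation P? ((x , p) ∷ D) with P? x
  ... | yes _ = cong₂ _+_ (sym (trans (cong (_* p) ιₙ-one) (*-identityˡ p))) (probability≡expectation P? D)
  ... | no _  = trans (probability≡expectation P? D)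
    (sym (trans (cong (_+ expectation D _) (trans (cong (_* p) ιₙ-zero) (*-zeroˡ p))) (+-identityˡ _)))

  pair : ∀ {A : Set} {k} → A × ℚ → Vector A k × ℚ → Vector A (suc k) × ℚ
  pair (x , p) (xs , q) = x Vector.∷ xs , p * q

  expectation-pair : ∀ {A : Set} {k} (D : Distribution A) (D′ : Distribution (Vector A k)) f →
    expectation (cartesianProductWith pair D D′) f ≡ expectation D (λ x → expectation D′ (λ xs → f (x Vector.∷ xs)))
  expectation-pair []            D′ f = refl
  expectation-pair ((x , p) ∷ D) D′ f = trans (expectation-++ (map (pair (x , p)) D′) _ f)
    (cong₂ _+_ (first D′) (expectation-pair D D′ f))
    where
    open +-*-Solver
    first : ∀ D′ → expectation (map (pair (x , p)) D′) f ≡ expectation D′ (λ xs → f (x Vector.∷ xs)) * p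
    first []              = sym (*-zeroˡ p)
    first ((xs , q) ∷ D′) = trans (cong (f (x Vector.∷ xs) * (p * q) +_) (first D′))
      (solve 4 (λ a p q b → a :* (p :* q) :+ b :* p := (a :* q :+ b) :* p) refl (f (x Vector.∷ xs)) p q (expectation D′ (λ xs → f (x Vector.∷ xs))))

  -- D is uniform on N equally likely outcomes, whose images under h are listed by xs.
  record Uniform {A B : Set} (D : Distribution A) (xs : List B) (h : A → B) (N : ℕ) : Set where
    constructor mkUniform
    field
      count : ∀ f g c → (∀ x → f x * c ≡ ιₙ (g (h x))) → expectation D f * (ιₙ N * c) ≡ ιₙ (∑ xs g)

  open Uniform

  uniform-interval : ∀ b n .{{_ : ℕ.NonZero n}} → Uniform (uniform b n) (interval b n) id n
  uniform-interval b n = mkUniform λ f g c h → begin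
    expectation (uniform b n) f * (ιₙ n * c)        ≡⟨ solve 3 (λ e n c → e :* (n :* c) := e :* c :* n) refl (expectation (uniform b n) f) (ιₙ n) c ⟩
    expectation (uniform b n) f * c * ιₙ n          ≡⟨ cong (_* ιₙ n) (weigh f g c h (upTo n)) ⟩
    1ℤ / n * ιₙ (∑ (upTo n) (λ j → g (b ℤ.+ pos j))) * ιₙ n
      ≡⟨ solve 3 (λ u s n → u :* s :* n := u :* n :* s) refl (1ℤ / n) (ιₙ (∑ (upTo n) (λ j → g (b ℤ.+ pos j)))) (ιₙ n) ⟩
    1ℤ / n * ιₙ n * ιₙ (∑ (upTo n) (λ j → g (b ℤ.+ pos j)))
      ≡⟨ trans (cong (_* ιₙ (∑ (upTo n) (λ j → g (b ℤ.+ pos j)))) (1/n*n≡1 n)) (*-identityˡ _) ⟩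
    ιₙ (∑ (upTo n) (λ j → g (b ℤ.+ pos j)))         ≡⟨ cong ιₙ (list g b id n (λ _ → refl)) ⟩
    ιₙ (∑ (interval b n) g)                         ∎
    where
    open ≡-Reasoning
    open +-*-Solver
    weigh : ∀ f g c → (∀ x → f x * c ≡ ιₙ (g x)) → ∀ js →
      expectation (map (λ j → b ℤ.+ pos j , 1ℤ / n) js) f * c ≡ 1ℤ / n * ιₙ (∑ js (λ j → g (b ℤ.+ pos j)))
    weigh f g c h []       = trans (*-zeroˡ c) (sym (trans (cong (1ℤ / n *_) ιₙ-zero) (*-zeroʳ (1ℤ / n))))
    weigh f g c h (j ∷ js) = begin
      (f x * (1ℤ / n) + E) * c                   ≡⟨ solve 4 (λ a u e c → (a :* u :+ e) :* c := u :* (a :* c) :+ e :* c) refl (f x) (1ℤ / n) E c ⟩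
      1ℤ / n * (f x * c) + E * c                 ≡⟨ cong₂ (λ u v → 1ℤ / n * u + v) (h x) (weigh f g c h js) ⟩
      1ℤ / n * ιₙ (g x) + 1ℤ / n * ιₙ G          ≡⟨ *-distribˡ-+ (1ℤ / n) (ιₙ (g x)) (ιₙ G) ⟨
      1ℤ / n * (ιₙ (g x) + ιₙ G)                 ≡⟨ cong (1ℤ / n *_) (ιₙ-+ (g x) G) ⟨
      1ℤ / n * ιₙ (g x ℕ.+ G)                    ∎
      where
      x = b ℤ.+ pos j
      E = expectation (map (λ j → b ℤ.+ pos j , 1ℤ / n) js) f
      G = ∑ js (λ j → g (b ℤ.+ pos j))
    -- The enumeration `u` is general because `upTo` recurses by composing with `suc`, whereas
    -- `interval` recurses by moving its left end `c`.
    list : ∀ g c (u : ℕ → ℕ) n → (∀ j → b ℤ.+ pos (u j) ≡ c ℤ.+ pos j) →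
      ∑ (applyUpTo u n) (λ j → g (b ℤ.+ pos j)) ≡ ∑ (interval c n) g
    list g c u zero    h = refl
    list g c u (suc n) h = cong₂ ℕ._+_ (cong g (trans (h 0) (ℤ.+-identityʳ c)))
      (list g (c ℤ.+ 1ℤ) (u ∘ suc) n (λ j → trans (h (suc j)) (sym (suc-shift c j))))

  uniform-pair : ∀ {A B : Set} {k} {D : Distribution A} {D′ : Distribution (Vector A k)} {xs : List B} {ys : List (Vec B k)} {h h′ N N′} →
    Uniform D xs h N → Uniform D′ ys h′ N′ →
    Uniform (cartesianProductWith pair D D′) (cartesianProductWith _∷_ xs ys) (λ v → h (v Fin.zero) ∷ h′ (v ∘ Fin.suc)) (N ℕ.* N′)
  uniform-pair {D = D} {D′} {xs} {ys} {h} {h′} {N} {N′} U U′ = mkUniform λ f g c fg → begin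
    expectation (cartesianProductWith pair D D′) f * (ιₙ (N ℕ.* N′) * c)
      ≡⟨ cong₂ _*_ (expectation-pair D D′ f) (trans (cong (_* c) (ιₙ-* N N′)) (*-assoc (ιₙ N) (ιₙ N′) c)) ⟩
    expectation D (λ x → expectation D′ (λ v → f (x Vector.∷ v))) * (ιₙ N * (ιₙ N′ * c))
      -- The inner expectation becomes a count only after multiplication by its own number of
      -- outcomes. That number is passed to the outer factor through the free multiplier `c`.
      ≡⟨ count U _ (λ y → ∑ ys (λ v → g (y ∷ v))) (ιₙ N′ * c) (λ x → count U′ _ (λ v → g (h x ∷ v)) c (λ v → fg (x Vector.∷ v))) ⟩
    ιₙ (∑ xs (λ y → ∑ ys (λ v → g (y ∷ v))))
      ≡⟨ cong ιₙ (∑-cartesianProductWith _∷_ xs ys g) ⟨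
    ιₙ (∑ (cartesianProductWith _∷_ xs ys) g) ∎
    where open ≡-Reasoning

  uniform-nil : ∀ {A B : Set} {h : A → B} → Uniform ((Vector.[] , 1ℚ) ∷ []) ([] ∷ []) (λ v → tabulate {n = 0} (h ∘ v)) 1
  uniform-nil = mkUniform λ f g c fg → begin
    (f Vector.[] * 1ℚ + 0ℚ) * (ιₙ 1 * c)      ≡⟨ cong₂ _*_ (trans (+-identityʳ _) (*-identityʳ (f Vector.[]))) (trans (cong (_* c) ιₙ-one) (*-identityˡ c)) ⟩
    f Vector.[] * c                           ≡⟨ fg Vector.[] ⟩
    ιₙ (g [])                                 ≡⟨ cong ιₙ (ℕ.+-identityʳ (g [])) ⟨
    ιₙ (g [] ℕ.+ 0)                           ∎
    where open ≡-Reasoning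

  uniform-box : ∀ {d} (b : Fin d → ℤ) n .{{_ : ℕ.NonZero n}} →
    Uniform (independent (λ i → uniform (b i) n)) (box (tabulate b) n) tabulate (n ℕ.^ d)
  uniform-box {zero}  b n = uniform-nil {h = id}
  uniform-box {suc d} b n = uniform-pair (uniform-interval (b Fin.zero) n) (uniform-box (b ∘ Fin.suc) n)

  uniform-matrices : ∀ {k d} (b : Fin k → Fin d → ℤ) n .{{_ : ℕ.NonZero n}} →
    Uniform (randomVectors b n) (matrices (rows b) n) rows ((n ℕ.^ d) ℕ.^ k)
  uniform-matrices {zero}  b n = uniform-nil {h = tabulate}
  uniform-matrices {suc k} b n = uniform-pair (uniform-box (b Fin.zero) n) (uniform-matrices (b ∘ Fin.suc) n)

  probability-count : ∀ {k d} {P : Vector (Vector ℤ d) k → Set} (P? : Decidable P) g → (∀ F → 𝟙 (P? F) ≡ g (rows F)) →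
    ∀ b n .{{_ : ℕ.NonZero n}} → probability P? (randomVectors b n) * ιₙ ((n ℕ.^ d) ℕ.^ k) ≡ ιₙ (∑ (matrices (rows b) n) g)
  probability-count P? g h b n = trans
    (cong₂ _*_ (probability≡expectation P? (randomVectors b n)) (sym (*-identityʳ _)))
    (count (uniform-matrices b n) _ g 1ℚ (λ F → trans (*-identityʳ _) (cong ιₙ (h F))))

-- Polynomial bounds for the offsets and the boxes.

module Polynomials where

  open Sums
  open Rationals
  open Elimination using (Bounded)
  open Asymptotics using (archimedean; BoundedBox)
  open RealSpans using (rows)
  open import Defs using (seq; cauchy; fromℤ; eval; PolynomiallyBounded; Eventually; bounded; ⁻¹ℚ-pos; ⁻¹ℚ-inverse)
  open import Data.List.Base using (length)
  open import Data.List.Membership.Propositional.Properties using (∈-cartesianProductWith⁻)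
  open import Data.Nat.Base
  open import Data.Nat.Properties
  open import Data.Vec.Base using (tabulate)
  open import Data.Vec.Properties using (lookup∘tabulate)
  open import Data.Vec.Relation.Unary.All using (All; []; _∷_)

  above-inverse : ∀ {B I} → 0ℚ ℚ.< B → 0ℚ ℚ.< I → B ℚ.* I ≡ 1ℚ → ∃[ N ] B ℚ.≤ ιₙ N
  above-inverse {B} {I} 0<B 0<I BI≡1 = N , (begin
    B                           ≡⟨ trans (cong (B ℚ.*_) ιₙ-one) (ℚ.*-identityʳ B) ⟨
    B ℚ.* ιₙ 1                  ≤⟨ *-monoˡ-0≤ {B} (ℚ.<⇒≤ 0<B) (proj₂ (archimedean I 0<I 1) N ≤-refl) ⟩
    B ℚ.* (ιₙ N ℚ.* I)          ≡⟨ solve 3 (λ b n i → b :* (n :* i) := b :* i :* n) refl B (ιₙ N) I ⟩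
    B ℚ.* I ℚ.* ιₙ N            ≡⟨ trans (cong (ℚ._* ιₙ N) BI≡1) (ℚ.*-identityˡ (ιₙ N)) ⟩
    ιₙ N                        ∎)
    where
    open ℚ.≤-Reasoning
    open +-*-Solver
    N = proj₁ (archimedean I 0<I 1)

  natural-above : ∀ B → 0ℚ ℚ.< B → ∃[ N ] B ℚ.≤ ιₙ N
  natural-above B 0<B = above-inverse 0<B (⁻¹ℚ-pos 0<B) (⁻¹ℚ-inverse 0<B)

  p≤∣p∣ : ∀ p → p ℚ.≤ ℚ.∣ p ∣
  p≤∣p∣ p with ℚ.≤-total ℚ.0ℚ p
  ... | inj₁ 0≤p = ℚ.≤-reflexive (sym (ℚ.0≤p⇒∣p∣≡p 0≤p))
  ... | inj₂ p≤0 = ℚ.≤-trans p≤0 (ℚ.0≤∣p∣ p)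

  horner-step : ∀ n .{{_ : NonZero n}} l C₀ C {x y} → x ℚ.≤ ιₙ C₀ → y ℚ.≤ ιₙ (C * n ^ l) →
    x ℚ.+ ι (pos n) ℚ.* y ℚ.≤ ιₙ ((C₀ + C) * n ^ suc l)
  horner-step n l C₀ C {x} {y} x≤ y≤ = begin
    x ℚ.+ ι (pos n) ℚ.* y                 ≡⟨ cong (λ ν → x ℚ.+ ν ℚ.* y) (ιₙ≡ι n) ⟨
    x ℚ.+ ιₙ n ℚ.* y                      ≤⟨ ℚ.+-mono-≤ x≤ (*-monoˡ-ι n y≤) ⟩
    ιₙ C₀ ℚ.+ ιₙ n ℚ.* ιₙ (C * n ^ l)     ≡⟨ trans (cong (ιₙ C₀ ℚ.+_) (sym (ιₙ-* n (C * n ^ l)))) (sym (ιₙ-+ C₀ (n * (C * n ^ l)))) ⟩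
    ιₙ (C₀ + n * (C * n ^ l))             ≤⟨ ιₙ-mono-≤ natural-bound ⟩
    ιₙ ((C₀ + C) * n ^ suc l)             ∎
    where
    open ℚ.≤-Reasoning
    natural-bound : C₀ + n * (C * n ^ l) ≤ (C₀ + C) * n ^ suc l
    natural-bound = ≤-trans
      (+-mono-≤ (m≤m*n C₀ (n ^ suc l) {{m^n≢0 n (suc l)}})
        (≤-reflexive (trans (sym (*-assoc n C (n ^ l))) (trans (cong (_* n ^ l) (*-comm n C)) (*-assoc C n (n ^ l))))))
      (≤-reflexive (sym (*-distribʳ-+ (n ^ suc l) C₀ C)))

  -- Each coefficient is a Cauchy sequence, eventually bounded by a natural number, and `C` is the
  -- sum of these bounds. It does not depend on `n`; only the index from which the estimate holds
  -- may do so.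
  eval-bounded : ∀ f → ∃[ C ] ∀ n .{{_ : NonZero n}} →
    Eventually λ j → seq (eval f (fromℤ (pos n))) j ℚ.≤ ιₙ (C * n ^ length f)
  eval-bounded []      = 0 , λ n → 0 , λ j _ → ℚ.≤-reflexive (sym ιₙ-zero)
  eval-bounded (c ∷ f) = proj₁ C₀ + proj₁ (eval-bounded f) , λ n → J₀ ⊔ proj₁ (proj₂ (eval-bounded f) n) , λ j J≤j →
    step n (seq c j) (seq (eval f (fromℤ (pos n))) j)
      (ℚ.≤-trans (p≤∣p∣ (seq c j)) (ℚ.≤-trans (proj₂ (proj₂ (proj₂ B)) j (m⊔n≤o⇒m≤o J₀ _ J≤j)) (proj₂ C₀)))
      (proj₂ (proj₂ (eval-bounded f) n) j (m⊔n≤o⇒n≤o J₀ _ J≤j))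
    where
    l = length f
    B : ∃[ B ] 0ℚ ℚ.< B × Eventually λ j → ℚ.∣ seq c j ∣ ℚ.≤ B
    B = bounded (cauchy c)
    J₀ = proj₁ (proj₂ (proj₂ B))
    C₀ = natural-above (proj₁ B) (proj₁ (proj₂ B))
    step : ∀ n .{{_ : NonZero n}} x y → x ℚ.≤ ιₙ (proj₁ C₀) → y ℚ.≤ ιₙ (proj₁ (eval-bounded f) * n ^ l) →
      x ℚ.+ ι (pos n) ℚ.* y ℚ.≤ ιₙ ((proj₁ C₀ + proj₁ (eval-bounded f)) * n ^ suc l)
    step n x y x≤ y≤ = horner-step n l (proj₁ C₀) (proj₁ (eval-bounded f)) x≤ y≤

  -- The real inequality is read with tolerance 1 at an index `j` past both thresholds. The offset
  -- is a constant sequence, so this already gives a bound `C * n ^ l + 1` in ℕ, and `n > C` absorbs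
  -- the constants into one more power of `n`.
  offsets-bounded : ∀ {m d} (b : (n : ℕ) → .{{_ : NonZero n}} → Fin m → Fin d → ℤ) → PolynomiallyBounded b →
    ∃[ κ ] ∃[ N ] ∀ n .{{_ : NonZero n}} → N ≤ n → ∀ k i → abs (b n k i) ≤ n ^ suc κ
  offsets-bounded b (f , b≤f) = length f , suc C , λ n C<n k i →
    natural-bound n (abs (b n k i)) C<n (≤-term n k i)
    where
    C = proj₁ (eval-bounded f)
    ≤-term : ∀ n .{{_ : NonZero n}} k i → ι (pos (abs (b n k i))) ℚ.≤ ιₙ (C * n ^ length f) ℚ.+ 1ℚ
    ≤-term n k i = ℚ.≤-trans (ℚ.<⇒≤ (proj₂ nearby (proj₁ nearby ⊔ proj₁ below) (m≤m⊔n (proj₁ nearby) (proj₁ below))))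
      (ℚ.+-monoˡ-≤ 1ℚ (proj₂ below (proj₁ nearby ⊔ proj₁ below) (m≤n⊔m (proj₁ nearby) (proj₁ below))))
      where
      nearby : Eventually λ j → ι (pos (abs (b n k i))) ℚ.< seq (eval f (fromℤ (pos n))) j ℚ.+ 1ℚ
      nearby = b≤f n k i 1ℚ (ℚ.positive⁻¹ 1ℚ)
      below : Eventually λ j → seq (eval f (fromℤ (pos n))) j ℚ.≤ ιₙ (C * n ^ length f)
      below = proj₂ (eval-bounded f) n
    natural-bound : ∀ n .{{_ : NonZero n}} x → suc C ≤ n → ι (pos x) ℚ.≤ ιₙ (C * n ^ length f) ℚ.+ 1ℚ → x ≤ n ^ suc (length f)
    natural-bound n x C<n x≤ = begin
      x                                ≤⟨ ιₙ-cancel-≤ (subst₂ ℚ._≤_ (sym (ιₙ≡ι x)) (trans (cong (ιₙ (C * n ^ length f) ℚ.+_) (sym ιₙ-one)) (sym (ιₙ-+ (C * n ^ length f) 1))) x≤) ⟩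
      C * n ^ length f + 1             ≤⟨ +-monoʳ-≤ (C * n ^ length f) (m^n>0 n (length f)) ⟩
      C * n ^ length f + n ^ length f  ≡⟨ +-comm (C * n ^ length f) (n ^ length f) ⟩
      suc C * n ^ length f             ≤⟨ *-monoˡ-≤ (n ^ length f) C<n ⟩
      n ^ suc (length f)               ∎
      where open ≤-Reasoning

  box-bounded : ∀ {d} κ n → 2 ≤ n → (b : Vec ℤ d) → Bounded (n ^ suc κ) b → BoundedBox (suc (suc κ)) n b
  box-bounded κ n 2≤n (b ∷ bs) b≤ x∈ i with ∈-cartesianProductWith⁻ _∷_ (interval b n) (box bs n) x∈
  box-bounded κ n 2≤n (b ∷ bs) b≤ x∈ (Fin.suc i) | _ , _ , _ , xs∈ , refl = box-bounded κ n 2≤n bs (b≤ ∘ Fin.suc) xs∈ i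
  box-bounded κ n 2≤n (b ∷ bs) b≤ x∈ Fin.zero    | _ , _ , x₀∈ , _ , refl with j , j<n , refl ← ∈-interval⁻ b n x₀∈ = begin
    abs (b ℤ.+ pos j)          ≤⟨ ℤ.∣i+j∣≤∣i∣+∣j∣ b (pos j) ⟩
    -- The exponent `suc κ` is positive, so the offset `j < n` is also at most `n ^ suc κ`.
    abs b + j                  ≤⟨ +-mono-≤ (b≤ Fin.zero) (≤-trans (<⇒≤ j<n) (m≤m*n n (n ^ κ) {{m^n≢0 n κ {{n≢0}}}})) ⟩
    n ^ suc κ + n ^ suc κ      ≡⟨ cong (n ^ suc κ +_) (+-identityʳ (n ^ suc κ)) ⟨
    2 * n ^ suc κ              ≤⟨ *-monoˡ-≤ (n ^ suc κ) 2≤n ⟩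
    n ^ suc (suc κ)            ∎
    where
    open ≤-Reasoning
    n≢0 : NonZero n
    n≢0 = >-nonZero (≤-trans (s≤s z≤n) 2≤n)

  rows-bounded : ∀ {m d} κ n → 2 ≤ n → (b : Fin m → Fin d → ℤ) → (∀ k i → abs (b k i) ≤ n ^ suc κ) →
    All (BoundedBox (suc (suc κ)) n) (rows b)
  rows-bounded {zero}  κ n 2≤n b b≤ = []
  rows-bounded {suc m} κ n 2≤n b b≤ =
    box-bounded κ n 2≤n (tabulate (b Fin.zero)) (λ i → subst (λ z → abs z ≤ n ^ suc κ) (sym (lookup∘tabulate (b Fin.zero) i)) (b≤ Fin.zero i))
      ∷ rows-bounded κ n 2≤n (b ∘ Fin.suc) (b≤ ∘ Fin.suc)

-- Passage to the real product of ζ values and its reciprocal.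

module Limit where

  open Rationals
  open RealSpans using (rows)
  open Classification
  open Asymptotics using (Near; near)
  open Matrices
  open Probability
  open Polynomials
  open import Defs using (ℝ; seq; ∏; ζ; ζ-product; ζ-product-pos; ζ-partial; ζ-partial-mono; 2≤d∸k; recip; fromℚ; _⟶_; Primitive; probability; randomVectors; PolynomiallyBounded; _⁻¹ℚ; ⁻¹ℚ-pos; ⁻¹ℚ-inverse; half-pos; half+half; ∣p∣≤; drop-0+)
  open import Data.Fin.Base using (toℕ)
  open import Data.Nat.Base
  open import Data.Nat.Properties

  productℚ : (m : ℕ) → (ℕ → ℚ) → ℚ
  productℚ zero    g = 1ℚ
  productℚ (suc m) g = g 0 ℚ.* productℚ m (g ∘ suc)

  -- The product in the theorem is folded from the factor at `d`, while the induction over rows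
  -- appends the newest factor at the other end.
  productℚ-snoc : ∀ m g → productℚ (suc m) g ≡ productℚ m g ℚ.* g m
  productℚ-snoc zero    g = trans (ℚ.*-identityʳ (g 0)) (sym (ℚ.*-identityˡ (g 0)))
  productℚ-snoc (suc m) g = trans (cong (g 0 ℚ.*_) (productℚ-snoc m (g ∘ suc))) (sym (ℚ.*-assoc (g 0) _ _))

  seq-∏ : ∀ {m} (x : Vector ℝ m) j (g : ℕ → ℚ) → (∀ i → seq (x i) j ≡ g (toℕ i)) → seq (∏ x) j ≡ productℚ m g
  seq-∏ {zero}  x j g h = refl
  seq-∏ {suc m} x j g h = cong₂ ℚ._*_ (h Fin.zero) (seq-∏ (x ∘ Fin.suc) j (g ∘ suc) (h ∘ Fin.suc))

  ζ-partials≡ : ∀ d m j → ζ-partials d m j ≡ productℚ m (λ i → ζ-partial (d ∸ i) j)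
  ζ-partials≡ d zero    j = refl
  ζ-partials≡ d (suc m) j = trans (cong (ℚ._* ζ-partial (d ∸ m) j) (ζ-partials≡ d m j))
    (sym (productℚ-snoc m (λ i → ζ-partial (d ∸ i) j)))

  seq-ζ-product : ∀ {m d} (m<d : m < d) j → seq (ζ-product m<d) j ≡ ζ-partials d m j
  seq-ζ-product {m} {d} m<d j = trans
    (seq-∏ (λ k → ζ (d ∸ toℕ k) (2≤d∸k m<d k)) j (λ i → ζ-partial (d ∸ i) j) (λ _ → refl)) (sym (ζ-partials≡ d m j))

  1≤ζ-partial : ∀ e {j} → 1 ≤ j → 1ℚ ℚ.≤ ζ-partial e j
  1≤ζ-partial e {j} 1≤j = subst (ℚ._≤ ζ-partial e j) (ζ-partial-one e) (ζ-partial-mono e 1≤j)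

  1≤ζ-partials : ∀ d m {j} → 1 ≤ j → 1ℚ ℚ.≤ ζ-partials d m j
  1≤ζ-partials d zero    1≤j = ℚ.≤-refl
  1≤ζ-partials d (suc m) {j} 1≤j = begin
    1ℚ                                              ≤⟨ 1≤ζ-partials d m 1≤j ⟩
    ζ-partials d m j                                ≡⟨ ℚ.*-identityʳ _ ⟨
    ζ-partials d m j ℚ.* 1ℚ                         ≤⟨ *-monoˡ-0≤ {ζ-partials d m j} (0≤ζ-partials d m j) (1≤ζ-partial (d ∸ m) 1≤j) ⟩
    ζ-partials d m j ℚ.* ζ-partial (d ∸ m) j        ∎
    where open ℚ.≤-Reasoning

  near-cancel : ∀ {ε x T} → 0ℚ ℚ.< T → Near ε (x ℚ.* T) T → (1ℚ ℚ.- ε ℚ.≤ x) × (x ℚ.≤ 1ℚ ℚ.+ ε)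
  near-cancel {T = T} 0<T (near l u) =
    ℚ.*-cancelʳ-≤-pos T {{ℚ.positive 0<T}} l , ℚ.*-cancelʳ-≤-pos T {{ℚ.positive 0<T}} u

  -- p − Z⁻¹ = Z⁻¹ (Z p − 1) and Z⁻¹ ≤ 1.
  near-reciprocal : ∀ {ε Z p} → 0ℚ ℚ.≤ ε → 1ℚ ℚ.≤ Z → 1ℚ ℚ.- ε ℚ.≤ Z ℚ.* p → Z ℚ.* p ℚ.≤ 1ℚ ℚ.+ ε → ℚ.∣ p ℚ.- Z ⁻¹ℚ ∣ ℚ.≤ ε
  near-reciprocal {ε} {Z} {p} 0≤ε 1≤Z lower upper = ∣p∣≤
    (begin
      p ℚ.- I                            ≡⟨ difference ⟩
      I ℚ.* (Z ℚ.* p ℚ.- 1ℚ)             ≤⟨ *-monoˡ-I (ℚ.+-monoˡ-≤ (ℚ.- 1ℚ) upper) ⟩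
      I ℚ.* (1ℚ ℚ.+ ε ℚ.- 1ℚ)            ≡⟨ cong (I ℚ.*_) (solve 1 (λ ε → con 1ℚ :+ ε :- con 1ℚ := ε) refl ε) ⟩
      I ℚ.* ε                            ≤⟨ I*ε≤ε ⟩
      ε                                  ∎)
    (begin
      ℚ.- (p ℚ.- I)                      ≡⟨ cong ℚ.-_ difference ⟩
      ℚ.- (I ℚ.* (Z ℚ.* p ℚ.- 1ℚ))       ≡⟨ solve 2 (λ I y → :- (I :* (y :- con 1ℚ)) := I :* (con 1ℚ :- y)) refl I (Z ℚ.* p) ⟩
      I ℚ.* (1ℚ ℚ.- Z ℚ.* p)             ≤⟨ *-monoˡ-I (ℚ.+-monoʳ-≤ 1ℚ (ℚ.neg-antimono-≤ lower)) ⟩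
      I ℚ.* (1ℚ ℚ.- (1ℚ ℚ.- ε))          ≡⟨ cong (I ℚ.*_) (solve 1 (λ ε → con 1ℚ :- (con 1ℚ :- ε) := ε) refl ε) ⟩
      I ℚ.* ε                            ≤⟨ I*ε≤ε ⟩
      ε                                  ∎)
    where
    open ℚ.≤-Reasoning
    open +-*-Solver
    I = Z ⁻¹ℚ
    0<Z : 0ℚ ℚ.< Z
    0<Z = ℚ.<-≤-trans (ℚ.positive⁻¹ 1ℚ) 1≤Z
    0≤I : 0ℚ ℚ.≤ I
    0≤I = ℚ.<⇒≤ (⁻¹ℚ-pos 0<Z)
    *-monoˡ-I : ∀ {x y} → x ℚ.≤ y → I ℚ.* x ℚ.≤ I ℚ.* y
    *-monoˡ-I = ℚ.*-monoˡ-≤-nonNeg I {{ℚ.nonNegative 0≤I}}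
    I≤1 : I ℚ.≤ 1ℚ
    I≤1 = subst₂ ℚ._≤_ (ℚ.*-identityʳ I) (trans (ℚ.*-comm I Z) (⁻¹ℚ-inverse 0<Z)) (*-monoˡ-I 1≤Z)
    I*ε≤ε : I ℚ.* ε ℚ.≤ ε
    I*ε≤ε = subst (I ℚ.* ε ℚ.≤_) (ℚ.*-identityˡ ε) (*-monoʳ-0≤ {ε} 0≤ε I≤1)
    difference : p ℚ.- I ≡ I ℚ.* (Z ℚ.* p ℚ.- 1ℚ)
    difference = sym (trans (solve 3 (λ I Z p → I :* (Z :* p :- con 1ℚ) := Z :* I :* p :- I) refl I Z p)
      (cong (ℚ._- I) (trans (cong (ℚ._* p) (⁻¹ℚ-inverse 0<Z)) (ℚ.*-identityˡ p))))

  codimension : ∀ {m d} → m ≤ d → m + suc (d ∸ m) ≡ suc d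
  codimension {m} {d} m≤d = trans (+-suc m (d ∸ m)) (cong suc (m+[n∸m]≡n m≤d))

  primitive? : ∀ {m d} → m < d → Decidable (Primitive {m} {d})
  primitive? {m} {suc d} (s≤s m≤d) F = decide (suc (d ∸ m)) F (classify (suc (d ∸ m)) (rows F) (codimension m≤d))

  primitiveProbability : ∀ {d m} → m < d → ((n : ℕ) → .{{_ : NonZero n}} → Fin m → Fin d → ℤ) → (n : ℕ) → .{{_ : NonZero n}} → ℚ
  primitiveProbability m<d b n = probability (primitive? m<d) (randomVectors (b n) n)

  -- `n` and `j` vary independently: convergence of reals asks, for each large `n`, for an estimate
  -- along the whole Cauchy index `j`.
  probability-near : ∀ {d m} (m<d : m < d) b → PolynomiallyBounded b → ∀ ε → 0ℚ ℚ.< ε →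
    ∃[ N ] ∀ n .{{_ : NonZero n}} → N ≤ n → ∀ j → N ≤ j → ℚ.∣ primitiveProbability m<d b n ℚ.- ζ-partials d m j ⁻¹ℚ ∣ ℚ.≤ ε
  probability-near {suc d} {m} (s≤s m≤d) b b-bounded ε 0<ε = N₁ ⊔ (N₂ ⊔ 2) , estimate
    where
    D = suc d
    exponent = offsets-bounded b b-bounded
    κ = proj₁ exponent
    N₁ = proj₁ (proj₂ exponent)
    counts = primitiveCount-near d (suc (suc κ)) m (d ∸ m) (codimension m≤d) ε 0<ε
    N₂ = proj₁ counts
    estimate : ∀ n .{{_ : NonZero n}} → N₁ ⊔ (N₂ ⊔ 2) ≤ n → ∀ j → N₁ ⊔ (N₂ ⊔ 2) ≤ j →
      ℚ.∣ primitiveProbability (s≤s m≤d) b n ℚ.- ζ-partials D m j ⁻¹ℚ ∣ ℚ.≤ ε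
    estimate n N≤n j N≤j = near-reciprocal (ℚ.<⇒≤ 0<ε) (1≤ζ-partials D m (≤-trans (s≤s z≤n) (2≤ N≤j))) (proj₁ bounds) (proj₂ bounds)
      where
      2≤ : ∀ {n} → N₁ ⊔ (N₂ ⊔ 2) ≤ n → 2 ≤ n
      2≤ N≤n = m⊔n≤o⇒n≤o N₂ 2 (m⊔n≤o⇒n≤o N₁ (N₂ ⊔ 2) N≤n)
      N₂≤ : ∀ {n} → N₁ ⊔ (N₂ ⊔ 2) ≤ n → N₂ ≤ n
      N₂≤ N≤n = m⊔n≤o⇒m≤o N₂ 2 (m⊔n≤o⇒n≤o N₁ (N₂ ⊔ 2) N≤n)
      T = (n ^ D) ^ m
      p = primitiveProbability (s≤s m≤d) b n
      Z = ζ-partials D m j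
      counted : p ℚ.* ιₙ T ≡ ιₙ (primitiveCount (suc (d ∸ m)) (codimension m≤d) (rows (b n)) n)
      counted = probability-count (primitive? (s≤s m≤d)) _ (λ F → 𝟙-decide _ F (classify _ (rows F) (codimension m≤d))) (b n) n
      0<T : 0ℚ ℚ.< ιₙ T
      0<T = 0<ιₙ T {{m^n≢0 (n ^ D) m {{m^n≢0 n D}}}}
      bounds : (1ℚ ℚ.- ε ℚ.≤ Z ℚ.* p) × (Z ℚ.* p ℚ.≤ 1ℚ ℚ.+ ε)
      bounds = near-cancel 0<T (subst (λ x → Near ε x (ιₙ T)) (trans (cong (Z ℚ.*_) (sym counted)) (sym (ℚ.*-assoc Z p (ιₙ T))))
        (proj₂ counts n (N₂≤ N≤n) (rows (b n))
          (rows-bounded {d = D} κ n (2≤ N≤n) (b n) (proj₂ (proj₂ exponent) n (m⊔n≤o⇒m≤o N₁ (N₂ ⊔ 2) N≤n))) j (N₂≤ N≤j)))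

  probability-limit : ∀ {d m} (m<d : m < d) b → PolynomiallyBounded b →
    (λ n → fromℚ (primitiveProbability m<d b n)) ⟶ recip (ζ-product m<d) (ζ-product-pos m<d)
  probability-limit {d} {m} m<d b b-bounded ε (δ , 0<δ , J₀ , above) = proj₁ estimate , λ n N≤n →
    η , half-pos 0<δ , proj₁ estimate ⊔ J₀ , λ j N≤j →
      ℚ.≤-<-trans (ℚ.+-monoˡ-≤ η (subst (λ Z → ℚ.∣ primitiveProbability m<d b n ℚ.- Z ⁻¹ℚ ∣ ℚ.≤ η) (sym (seq-ζ-product m<d j))
        (proj₂ estimate n N≤n j (m⊔n≤o⇒m≤o (proj₁ estimate) J₀ N≤j))))
        (subst (ℚ._< seq ε j) (sym (half+half δ)) (drop-0+ (above j (m⊔n≤o⇒n≤o (proj₁ estimate) J₀ N≤j))))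
    where
    -- One half of `δ` bounds the error, the other half is the rational gap that a strict inequality
    -- of reals requires.
    η = δ ℚ.* ½
    estimate = probability-near m<d b b-bounded η (half-pos 0<δ)

open import Defs

theorem1 : ∀ (d m : ℕ) → 1 ℕ.≤ m → (m<d : m ℕ.< d) →
    (b : (n : ℕ) → .{{_ : ℕ.NonZero n}} → Fin m → Fin d → ℤ) →
    PolynomiallyBounded b →
    Σ[ primitive? ∈ Decidable (Primitive {m} {d}) ]
    (λ n → fromℚ (probability primitive? (randomVectors (b n) n)))
    ⟶ recip (ζ-product m<d) (ζ-product-pos m<d)
theorem1 d m 1≤m m<d b b-bounded = Limit.primitive? m<d , Limit.probability-limit m<d b b-bounded
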